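{- With $Q:=q^{13}$, the following hold: $$(2,1,44)-(8,1,11)=2q^2E(q^9)E(Q^3),$$ $$(5,3,18)-(8,1,11)=2q^5E(q^3)E(Q^9),$$ $$(4,1,22)-(10,7,10)=2q^4E(q^9)E(Q^3)U(3,13,q^3)^2,$$ $$(1,1,88)-(9,3,10)=2qE(q^3)E(Q^9)U(1,39,q^3)^2,$$ $$\frac{(4,1,22)-(10,7,10)}{(1,1,88)-(9,3,10)}=\frac{(5,3,18)-(8,1,11)}{(2,1,44)-(8,1,11)}=q^3\frac{E(q^3)E(Q^9)}{E(q^9)E(Q^3)}.$$
   Context: Let $|q|<1$, $(a;q)_\infty=\prod_{k\ge0}(1-aq^k)$, $(a;q)_n=\prod_{k=0}^{n-1}(1-aq^k)$. $G(q)=\sum_{n\ge0}\frac{q^{n^2}}{(q;q)_n}$, $H(q)=\sum_{n\ge0}\frac{q^{n(n+1)}}{(q;q)_n}$. For positive integers $r,s$, $U(r,s,q)=G(q^r)G(q^s)+q^{(s+r)/5}H(q^r)H(q^s)$ if $s+r\equiv0\pmod5$ and $U(r,s,q)=H(q^r)G(q^s)-q^{(s-r)/5}G(q^r)H(q^s)$ if $s-r\equiv0\pmod5$; $U(r,s,x)$ denotes this expression with $q$ replaced by $x$. $E(q)=(q;q)_\infty$. For integers $a,b,c$ with $a,c>0$, $b^2-4ac<0$, $(a,b,c)$ denotes $\sum_{n,m=-\infty}^{\infty}q^{an^2+bnm+cm^2}$. -}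

module Defs where

open import Data.Nat as ℕ using (ℕ; zero; suc; NonZero)
open import Data.Nat.DivMod using (_/_; _%_)
open import Data.Integer using (ℤ; +_; _+_; _-_; _*_; -_; ∣_∣)
import Data.Integer as ℤ
open import Data.List using (List; map; upTo; concatMap; foldr)
open import Data.Bool using (if_then_else_)
open import Relation.Nullary using (does)

-- Formal power series in q with integer coefficients: n ↦ coefficient of q^n.
PS : Set
PS = ℕ → ℤ

sumTo : (ℕ → ℤ) → ℕ → ℤ
sumTo f zero = f 0
sumTo f (suc n) = sumTo f n + f (suc n)

infixl 6 _⊕_ _⊟_
infixl 7 _⊛_

_⊕_ : PS → PS → PS
(f ⊕ g) n = f n + g n

_⊟_ : PS → PS → PS
(f ⊟ g) n = f n - g n

_⊛_ : PS → PS → PS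
(f ⊛ g) n = sumTo (λ i → f i * g (n ℕ.∸ i)) n

cst : ℤ → PS
cst c zero = c
cst c (suc n) = + 0

one : PS
one = cst (+ 1)

mono : ℕ → PS
mono m n = if does (n ℕ.≟ m) then + 1 else + 0

dilate : (k : ℕ) .{{_ : NonZero k}} → PS → PS
dilate k f n = if does (n % k ℕ.≟ 0) then f (n / k) else + 0

pochPoly : ℕ → PS
pochPoly zero = one
pochPoly (suc k) = pochPoly k ⊛ (one ⊟ mono (suc k))

-- E(q) = (q;q)_∞ : the coefficient of q^n of the infinite product equals that
-- of the finite product over k ≤ n (factors with k > n are ≡ 1 mod q^{n+1}).
E : PS
E n = pochPoly n n

-- 1/(1 - q^k) = Σ_j q^{kj}   (k > 0)
geom : (k : ℕ) .{{_ : NonZero k}} → PS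
geom k n = if does (n % k ℕ.≟ 0) then + 1 else + 0

invPoch : ℕ → PS
invPoch zero = one
invPoch (suc k) = invPoch k ⊛ geom (suc k)

-- G(q) = Σ_{n≥0} q^{n²}/(q;q)_n ; only n ≤ N contribute to the coefficient of q^N
G : PS
G N = sumTo (λ n → (mono (n ℕ.* n) ⊛ invPoch n) N) N

H : PS
H N = sumTo (λ n → (mono (n ℕ.* suc n) ⊛ invPoch n) N) N

-- U(r,s,q) in the case s + r ≡ 0 (mod 5):
--   G(q^r)G(q^s) + q^{(s+r)/5} H(q^r)H(q^s)
Uplus : (r s : ℕ) .{{_ : NonZero r}} .{{_ : NonZero s}} → PS
Uplus r s = dilate r G ⊛ dilate s G ⊕ mono ((s ℕ.+ r) / 5) ⊛ (dilate r H ⊛ dilate s H)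

-- U(r,s,q) in the case s - r ≡ 0 (mod 5), s ≥ r:
--   H(q^r)G(q^s) - q^{(s-r)/5} G(q^r)H(q^s)
Uminus : (r s : ℕ) .{{_ : NonZero r}} .{{_ : NonZero s}} → PS
Uminus r s = dilate r H ⊛ dilate s G ⊟ mono ((s ℕ.∸ r) / 5) ⊛ (dilate r G ⊛ dilate s H)

box : ℕ → List ℤ
box B = map (λ i → + i - + B) (upTo (suc (B ℕ.+ B)))

-- The binary theta series (a,b,c) = Σ_{n,m ∈ ℤ} q^{a n² + b n m + c m²}.
-- Coefficient of q^N = #{(n,m) ∈ ℤ² : a n² + b n m + c m² = N}.  For a,c > 0 and
-- b² - 4ac < 0 every solution has n² ≤ 4cN/(4ac-b²) ≤ 4cN and m² ≤ 4aN, hence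
-- |n|,|m| ≤ 4·|a|·|c|·N, so counting inside that box counts all representations.
theta : ℤ → ℤ → ℤ → PS
theta a b c N =
  foldr _+_ (+ 0) (concatMap (λ n → map (λ m →
        if does (a * n * n + b * n * m + c * m * m ℤ.≟ + N) then + 1 else + 0)
       (box B)) (box B))
  where
  B : ℕ
  B = 4 ℕ.* ∣ a ∣ ℕ.* ∣ c ∣ ℕ.* N

{-# OPTIONS --safe #-}
module Submission where

-- By the Rogers–Ramanujan identities and the Jacobi triple product, E·G, E·H and E are one-variable theta series with
-- (E·G)(E·H) = E(q)E(q⁵), hence E·G·H = E(q⁵), and by the quintuple product E·G² and E·H² are one-variable theta series too.
-- Expanding the squares, every right-hand side of the first four identities becomes a combination of series
-- Σ_{x,y∈ℤ} q^{Q(x,y)} with Q an inhomogeneous quadratic polynomial, and so does the relation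
-- E(q)E(q³⁹)U(1,39) = E(q³)E(q¹³)U(3,13), which is needed for the quotient identity.
-- Such combinations are equal because both sides agree after cutting ℤ² into cosets of suitable sublattices
-- and identifying cosets by unimodular affine maps.
-- G_k = Σ q^{n²+kn}/(q;q)_n is identified through its recurrence G_k = G_{k+1} + q^{k+1}G_{k+2}, which Rogers' series for E·G_k
-- satisfies by telescoping.

open import Defs
open import Data.Nat as ℕ using (ℕ; zero; suc; NonZero; z≤n; s≤s)
import Data.Nat.Properties as ℕₚ
import Data.Nat.Tactic.RingSolver as ℕ-Solver
open import Data.Nat.DivMod using (_/_; _%_; m<n⇒m%n≡m; m<n⇒m/n≡0; [m+n]%n≡m%n; m/n≡1+[m∸n]/n; m/n≤m)
open import Data.Nat.Induction using (<-rec)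
open import Data.Nat.ListAction using (sum)
open import Data.Integer using (ℤ; +_; -[1+_]; _+_; _-_; _*_; -_; ∣_∣; 0ℤ; 1ℤ; -1ℤ)
import Data.Integer as ℤ
import Data.Integer.Properties as ℤₚ
open import Data.Integer.DivMod using (_/ℕ_; n%ℕd<d; a≡a%ℕn+[a/ℕn]*n)
open import Data.Integer.Tactic.RingSolver using (solve-∀)
open import Data.Bool using (Bool; true; false; if_then_else_; _∧_)
open import Data.Fin using (Fin; toℕ; fromℕ<) renaming (zero to fzero; suc to fsuc)
import Data.Fin.Properties as Finₚ
open import Data.List using (List; []; _∷_; _++_; map; concatMap; foldr; upTo; applyUpTo; allFin; replicate; cartesianProduct; cartesianProductWith; deduplicate)
open import Data.List.Membership.Propositional using (_∈_)
open import Data.List.Membership.Propositional.Properties using (∈-map⁺; ∈-map⁻; ∈-upTo⁺; ∈-allFin; ∈-++⁺ˡ; ∈-++⁺ʳ; ∈-cartesianProduct⁺; ∈-cartesianProductWith⁺; ∈-deduplicate⁺)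
open import Data.List.Relation.Unary.Any using (here; there)
import Data.List.Relation.Unary.All as All
open import Data.List.Relation.Unary.AllPairs using ([]; _∷_)
open import Data.List.Relation.Unary.Unique.Propositional using (Unique)
import Data.List.Relation.Unary.Unique.Propositional.Properties as Uniqueₚ
open import Data.List.Relation.Unary.Unique.DecPropositional.Properties using (deduplicate-!)
open import Data.Maybe using (just; nothing)
open import Data.Product using (_×_; _,_; Σ; proj₁; proj₂)
open import Data.Product.Properties using (≡-dec)
open import Data.Sum using (inj₁; inj₂)
open import Function using (_∘_; id)
open import Level using (0ℓ)
open import Relation.Nullary using (does; yes; no)
open import Relation.Nullary.Decidable using (True; toWitness; dec-true; dec-false; map′; _×-dec_)
open import Relation.Nullary.Negation using (contradiction)
open import Relation.Binary.Definitions using (DecidableEquality; WeaklyDecidable; tri<; tri≈; tri>)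
open import Relation.Binary.PropositionalEquality using (_≡_; _≢_; _≗_; refl; sym; trans; cong; cong₂; subst; module ≡-Reasoning)
import Relation.Binary.Reasoning.Setoid
open import Algebra.Bundles using (CommutativeRing)
open import Algebra.Properties.AbelianGroup ℤₚ.+-0-abelianGroup using (∙-cancelʳ)
open import Algebra.Solver.Ring.AlmostCommutativeRing using (AlmostCommutativeRing; fromCommutativeRing; _-Raw-AlmostCommutative⟶_; Induced-equivalence)
import Algebra.Solver.Ring

-- The ring of formal power series

-- All seven forms in the four product identities have discriminant -351; the auxiliary forms
-- (1,1,10) and (3,3,4) have discriminant -39. A product of two one-variable theta series belongs to
-- a diagonal form, so a binary theta series can be compared with it only on cosets of a sublattice
-- that has an orthogonal basis. What does not fit must cancel beforehand: in each difference two
-- forms agree on sublattices of index 2, up to isometry. The pairs (4,1,22), (10,7,10) and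
-- (1,1,88), (9,3,10) share no such sublattice; therefore (9,3,10) in the first case and (4,1,22) in
-- the second is added and subtracted as a stepping stone. The cuttings are not argued case by case.
-- A cutting is a datum, its soundness is proved once, and each identity becomes the evaluation of a
-- finite integer combination of quadratic polynomials, whose collected coefficients must all be 0.
-- This is why theta series are represented by their exponents and why the sums over ℤ and ℤ² are
-- handled as sums with finite support, one for each coefficient.

sumTo-cong : ∀ {f g} n → (∀ i → i ℕ.≤ n → f i ≡ g i) → sumTo f n ≡ sumTo g n
sumTo-cong zero    p = p 0 z≤n
sumTo-cong (suc n) p = cong₂ _+_ (sumTo-cong n λ i i≤n → p i (ℕₚ.m≤n⇒m≤1+n i≤n)) (p (suc n) ℕₚ.≤-refl)

sumTo-0 : ∀ n → sumTo (λ _ → 0ℤ) n ≡ 0ℤ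
sumTo-0 zero    = refl
sumTo-0 (suc n) = cong (_+ 0ℤ) (sumTo-0 n)

interchange : ∀ a b c d → (a + b) + (c + d) ≡ (a + c) + (b + d)
interchange = solve-∀

sumTo-+ : ∀ f g n → sumTo (λ i → f i + g i) n ≡ sumTo f n + sumTo g n
sumTo-+ f g zero    = refl
sumTo-+ f g (suc n) = trans (cong (_+ (f (suc n) + g (suc n))) (sumTo-+ f g n)) (interchange (sumTo f n) (sumTo g n) (f (suc n)) (g (suc n)))

sumTo-*ˡ : ∀ c f n → sumTo (λ i → c * f i) n ≡ c * sumTo f n
sumTo-*ˡ c f zero    = refl
sumTo-*ˡ c f (suc n) = trans (cong (_+ c * f (suc n)) (sumTo-*ˡ c f n)) (sym (ℤₚ.*-distribˡ-+ c (sumTo f n) (f (suc n))))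

sumTo-head : ∀ f n → sumTo f (suc n) ≡ f 0 + sumTo (λ i → f (suc i)) n
sumTo-head f zero    = refl
sumTo-head f (suc n) = trans (cong (_+ f (2 ℕ.+ n)) (sumTo-head f n)) (ℤₚ.+-assoc (f 0) _ (f (2 ℕ.+ n)))

tail : PS → PS
tail f n = f (suc n)

⊖_ : PS → PS
(⊖ f) n = - f n

infix 4 _≋_
-- A record rather than _≗_, so that the two series can be inferred from a proof.
record _≋_ (f g : PS) : Set where
  constructor pointwise
  field at : ∀ n → f n ≡ g n
open _≋_

≋-refl : ∀ {f} → f ≋ f
≋-refl .at n = refl

≋-sym : ∀ {f g} → f ≋ g → g ≋ f
≋-sym p .at n = sym (p .at n)

≋-trans : ∀ {f g h} → f ≋ g → g ≋ h → f ≋ h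
≋-trans p q .at n = trans (p .at n) (q .at n)

⊛-head : ∀ f g n → (f ⊛ g) (suc n) ≡ f 0 * g (suc n) + (tail f ⊛ g) n
⊛-head f g n = sumTo-head (λ i → f i * g (suc n ℕ.∸ i)) n

⊛-last : ∀ f g n → (f ⊛ g) (suc n) ≡ (f ⊛ tail g) n + f (suc n) * g 0
⊛-last f g n = cong₂ _+_
  (sumTo-cong n λ i i≤n → cong (λ k → f i * g k) (ℕₚ.+-∸-assoc 1 i≤n))
  (cong (λ k → f (suc n) * g k) (ℕₚ.n∸n≡0 n))

⊛-cong-at : ∀ {f f′ g g′} n → (∀ i → i ℕ.≤ n → f i ≡ f′ i) → (∀ i → i ℕ.≤ n → g i ≡ g′ i) →
            (f ⊛ g) n ≡ (f′ ⊛ g′) n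
⊛-cong-at n p q = sumTo-cong n λ i i≤n → cong₂ _*_ (p i i≤n) (q (n ℕ.∸ i) (ℕₚ.m∸n≤m n i))

⊛-cong : ∀ {f f′ g g′} → f ≋ f′ → g ≋ g′ → f ⊛ g ≋ f′ ⊛ g′
⊛-cong p q .at n = ⊛-cong-at n (λ i _ → p .at i) (λ i _ → q .at i)

-- `⊛-head` peels the term i = 0 off f ⊛ g and `⊛-last` the term i = n + 1 off g ⊛ f. These two
-- agree, and what remains is the case n.
⊛-comm-at : ∀ f g n → (f ⊛ g) n ≡ (g ⊛ f) n
⊛-comm-at f g zero    = ℤₚ.*-comm (f 0) (g 0)
⊛-comm-at f g (suc n) = begin
  (f ⊛ g) (suc n)                    ≡⟨ ⊛-head f g n ⟩
  f 0 * g (suc n) + (tail f ⊛ g) n   ≡⟨ cong₂ _+_ (ℤₚ.*-comm (f 0) _) (⊛-comm-at (tail f) g n) ⟩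
  g (suc n) * f 0 + (g ⊛ tail f) n   ≡⟨ ℤₚ.+-comm (g (suc n) * f 0) _ ⟩
  (g ⊛ tail f) n + g (suc n) * f 0   ≡⟨ ⊛-last g f n ⟨
  (g ⊛ f) (suc n)                    ∎
  where open ≡-Reasoning

⊛-distribʳ-at : ∀ h f g n → ((f ⊕ g) ⊛ h) n ≡ (f ⊛ h) n + (g ⊛ h) n
⊛-distribʳ-at h f g n = trans
  (sumTo-cong n λ i _ → ℤₚ.*-distribʳ-+ (h (n ℕ.∸ i)) (f i) (g i))
  (sumTo-+ _ _ n)

scale-⊛-at : ∀ c f g n → ((λ i → c * f i) ⊛ g) n ≡ c * (f ⊛ g) n
scale-⊛-at c f g n = trans (sumTo-cong n λ i _ → ℤₚ.*-assoc c (f i) _) (sumTo-*ˡ c _ n)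

-- By `⊛-head` the tail of f ⊛ g is f(0)·tail g + tail f ⊛ g, which reduces n + 1 to the case n for
-- `tail f`, g, h.
⊛-assoc-at : ∀ f g h n → ((f ⊛ g) ⊛ h) n ≡ (f ⊛ (g ⊛ h)) n
⊛-assoc-at f g h zero    = ℤₚ.*-assoc (f 0) (g 0) (h 0)
⊛-assoc-at f g h (suc n) = begin
  ((f ⊛ g) ⊛ h) (suc n)
    ≡⟨ ⊛-head (f ⊛ g) h n ⟩
  f 0 * g 0 * h (suc n) + (tail (f ⊛ g) ⊛ h) n
    ≡⟨ cong (λ x → f 0 * g 0 * h (suc n) + x) (⊛-cong-at {g = h} n (λ i _ → ⊛-head f g i) (λ _ _ → refl)) ⟩
  f 0 * g 0 * h (suc n) + (((λ i → f 0 * tail g i) ⊕ (tail f ⊛ g)) ⊛ h) n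
    ≡⟨ cong (λ x → f 0 * g 0 * h (suc n) + x) (⊛-distribʳ-at h (λ i → f 0 * tail g i) (tail f ⊛ g) n) ⟩
  f 0 * g 0 * h (suc n) + (((λ i → f 0 * tail g i) ⊛ h) n + ((tail f ⊛ g) ⊛ h) n)
    ≡⟨ cong (λ x → f 0 * g 0 * h (suc n) + x) (cong₂ _+_ (scale-⊛-at (f 0) (tail g) h n) (⊛-assoc-at (tail f) g h n)) ⟩
  f 0 * g 0 * h (suc n) + (f 0 * (tail g ⊛ h) n + (tail f ⊛ (g ⊛ h)) n)
    ≡⟨ regroup (f 0) (g 0) (h (suc n)) ((tail g ⊛ h) n) _ ⟩
  f 0 * (g 0 * h (suc n) + (tail g ⊛ h) n) + (tail f ⊛ (g ⊛ h)) n
    ≡⟨ cong (λ x → f 0 * x + (tail f ⊛ (g ⊛ h)) n) (⊛-head g h n) ⟨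
  f 0 * (g ⊛ h) (suc n) + (tail f ⊛ (g ⊛ h)) n
    ≡⟨ ⊛-head f (g ⊛ h) n ⟨
  (f ⊛ (g ⊛ h)) (suc n) ∎
  where
  open ≡-Reasoning
  regroup : ∀ a b c d e → a * b * c + (a * d + e) ≡ a * (b * c + d) + e
  regroup = solve-∀

cst-⊛-at : ∀ c f n → (cst c ⊛ f) n ≡ c * f n
cst-⊛-at c f zero    = refl
cst-⊛-at c f (suc n) = begin
  (cst c ⊛ f) (suc n)                        ≡⟨ ⊛-head (cst c) f n ⟩
  c * f (suc n) + sumTo (λ i → 0ℤ * f (n ℕ.∸ i)) n
    ≡⟨ cong (λ x → c * f (suc n) + x) (trans (sumTo-cong n λ i _ → ℤₚ.*-zeroˡ (f (n ℕ.∸ i))) (sumTo-0 n)) ⟩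
  c * f (suc n) + 0ℤ                         ≡⟨ ℤₚ.+-identityʳ _ ⟩
  c * f (suc n)                              ∎
  where open ≡-Reasoning

zeroPS : PS
zeroPS = cst 0ℤ

cst-0 : ∀ n → zeroPS n ≡ 0ℤ
cst-0 zero    = refl
cst-0 (suc n) = refl

PS-ring : CommutativeRing 0ℓ 0ℓ
PS-ring = record
  { Carrier = PS ; _≈_ = _≋_ ; _+_ = _⊕_ ; _*_ = _⊛_ ; -_ = ⊖_ ; 0# = zeroPS ; 1# = one
  ; isCommutativeRing = record
    { isRing = record
      { +-isAbelianGroup = record
        { isGroup = record
          { isMonoid = record
            { isSemigroup = record
              { isMagma = record
                { isEquivalence = record { refl = ≋-refl ; sym = ≋-sym ; trans = ≋-trans }
                ; ∙-cong = λ p q → pointwise λ n → cong₂ _+_ (p .at n) (q .at n) }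
              ; assoc = λ f g h → pointwise λ n → ℤₚ.+-assoc (f n) (g n) (h n) }
            ; identity = (λ f → pointwise λ n → trans (cong (_+ f n) (cst-0 n)) (ℤₚ.+-identityˡ (f n)))
                       , (λ f → pointwise λ n → trans (cong (λ x → f n + x) (cst-0 n)) (ℤₚ.+-identityʳ (f n))) }
          ; inverse = (λ f → pointwise λ n → trans (ℤₚ.+-inverseˡ (f n)) (sym (cst-0 n)))
                    , (λ f → pointwise λ n → trans (ℤₚ.+-inverseʳ (f n)) (sym (cst-0 n)))
          ; ⁻¹-cong = λ p → pointwise λ n → cong -_ (p .at n) }
        ; comm = λ f g → pointwise λ n → ℤₚ.+-comm (f n) (g n) }
      ; *-cong = ⊛-cong
      ; *-assoc = λ f g h → pointwise (⊛-assoc-at f g h)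
      ; *-identity = one-identityˡ , (λ f → ≋-trans (comm f one) (one-identityˡ f))
      ; distrib = (λ h f g → ≋-trans (comm h (f ⊕ g)) (≋-trans (pointwise (⊛-distribʳ-at h f g))
                    (pointwise λ n → cong₂ _+_ (⊛-comm-at f h n) (⊛-comm-at g h n))))
                , (λ h f g → pointwise (⊛-distribʳ-at h f g)) }
    ; *-comm = comm } }
  where
  comm : ∀ f g → f ⊛ g ≋ g ⊛ f
  comm f g = pointwise (⊛-comm-at f g)
  one-identityˡ : ∀ f → one ⊛ f ≋ f
  one-identityˡ f .at n = trans (cst-⊛-at 1ℤ f n) (ℤₚ.*-identityˡ (f n))

open CommutativeRing PS-ring
  using () renaming (+-cong to ⊕-cong; -‿cong to ⊖-cong; setoid to PS-setoid; *-comm to ⊛-comm; *-assoc to ⊛-assoc; distribʳ to ⊛-distribʳ; distribˡ to ⊛-distribˡ;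
                     *-identityˡ to ⊛-identityˡ; *-identityʳ to ⊛-identityʳ; zeroˡ to ⊛-zeroˡ; zeroʳ to ⊛-zeroʳ;
                     +-identityˡ to ⊕-identityˡ; +-identityʳ to ⊕-identityʳ)

⊟-cong : ∀ {f f′ g g′} → f ≋ f′ → g ≋ g′ → f ⊟ g ≋ f′ ⊟ g′
⊟-cong p q .at n = cong₂ _-_ (p .at n) (q .at n)

⊛-congˡ : ∀ u {f g} → f ≋ g → u ⊛ f ≋ u ⊛ g
⊛-congˡ u = ⊛-cong (≋-refl {u})

⊛-congʳ : ∀ u {f g} → f ≋ g → f ⊛ u ≋ g ⊛ u
⊛-congʳ u p = ⊛-cong p (≋-refl {u})

⊕-congˡ : ∀ u {f g} → f ≋ g → u ⊕ f ≋ u ⊕ g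
⊕-congˡ u = ⊕-cong (≋-refl {u})

⊕-congʳ : ∀ u {f g} → f ≋ g → f ⊕ u ≋ g ⊕ u
⊕-congʳ u p = ⊕-cong p (≋-refl {u})

PS-almostRing : AlmostCommutativeRing 0ℓ 0ℓ
PS-almostRing = fromCommutativeRing PS-ring

-- Makes ℤ the coefficient ring of the ring solver: equality of integers is decidable, equality of
-- series is not.
cst-homomorphism : CommutativeRing.rawRing ℤₚ.+-*-commutativeRing -Raw-AlmostCommutative⟶ PS-almostRing
cst-homomorphism = record
  { ⟦_⟧ = cst
  ; +-homo = λ c d → pointwise λ { zero → refl ; (suc n) → refl }
  ; *-homo = λ c d → pointwise λ { zero → refl
                                 ; (suc n) → sym (trans (cst-⊛-at c (cst d) (suc n)) (ℤₚ.*-zeroʳ c)) }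
  ; -‿homo = λ c → pointwise λ { zero → refl ; (suc n) → refl }
  ; 0-homo = ≋-refl
  ; 1-homo = ≋-refl }

module ≋-Reasoning = Relation.Binary.Reasoning.Setoid PS-setoid

-- Multiplication by powers of q

mono-0 : mono 0 ≋ one
mono-0 .at zero    = refl
mono-0 .at (suc n) = refl

mono-⊛-suc : ∀ m f n → (mono (suc m) ⊛ f) (suc n) ≡ (mono m ⊛ f) n
mono-⊛-suc m f n = trans (⊛-head (mono (suc m)) f n)
  (trans (cong (_+ (mono m ⊛ f) n) (ℤₚ.*-zeroˡ (f (suc n)))) (ℤₚ.+-identityˡ _))

mono-0-⊛ : ∀ f n → (mono 0 ⊛ f) n ≡ f n
mono-0-⊛ f n = trans (⊛-congʳ f mono-0 .at n) (⊛-identityˡ f .at n)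

mono-⊛-shift : ∀ m f n → (mono m ⊛ f) (m ℕ.+ n) ≡ f n
mono-⊛-shift zero    f n = mono-0-⊛ f n
mono-⊛-shift (suc m) f n = trans (mono-⊛-suc m f (m ℕ.+ n)) (mono-⊛-shift m f n)

mono-⊛-below : ∀ m f {n} → n ℕ.< m → (mono m ⊛ f) n ≡ 0ℤ
mono-⊛-below (suc m) f {zero}  _         = ℤₚ.*-zeroˡ (f 0)
mono-⊛-below (suc m) f {suc n} (s≤s n<m) = trans (mono-⊛-suc m f n) (mono-⊛-below m f n<m)

mono-cong : ∀ {a b} → a ≡ b → mono a ≋ mono b
mono-cong refl = ≋-refl

mono-+ : ∀ a b → mono (a ℕ.+ b) ≋ mono a ⊛ mono b
mono-+ zero    b .at n       = sym (mono-0-⊛ (mono b) n)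
mono-+ (suc a) b .at zero    = sym (mono-⊛-below (suc a) (mono b) (s≤s z≤n))
mono-+ (suc a) b .at (suc n) = trans (mono-+ a b .at n) (sym (mono-⊛-suc a (mono b) n))

mono-cancel : ∀ m f g → mono m ⊛ f ≋ mono m ⊛ g → f ≋ g
mono-cancel m f g p .at n =
  trans (sym (mono-⊛-shift m f n)) (trans (p .at (m ℕ.+ n)) (mono-⊛-shift m g n))

-- Congruence modulo powers of q, and cancellation

infix 4 _≈[_]_
-- Congruence modulo q^L. Infinite sums and products are compared with their partial sums and
-- products in this relation, and `≈⇒≋` lets L grow.
record _≈[_]_ (f : PS) (L : ℕ) (g : PS) : Set where
  constructor agree
  field below : ∀ i → i ℕ.< L → f i ≡ g i
open _≈[_]_

≈-refl : ∀ {L f} → f ≈[ L ] f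
≈-refl .below i _ = refl

≈-sym : ∀ {L f g} → f ≈[ L ] g → g ≈[ L ] f
≈-sym p .below i l = sym (p .below i l)

≈-trans : ∀ {L f g h} → f ≈[ L ] g → g ≈[ L ] h → f ≈[ L ] h
≈-trans p q .below i l = trans (p .below i l) (q .below i l)

≋⇒≈ : ∀ {L f g} → f ≋ g → f ≈[ L ] g
≋⇒≈ p .below i _ = p .at i

≈⇒≋ : ∀ {f g} → (∀ L → f ≈[ L ] g) → f ≋ g
≈⇒≋ p .at n = p (suc n) .below n ℕₚ.≤-refl

≈-weaken : ∀ {K L f g} → K ℕ.≤ L → f ≈[ L ] g → f ≈[ K ] g
≈-weaken K≤L p .below i i<K = p .below i (ℕₚ.<-≤-trans i<K K≤L)

⊕-≈ : ∀ {L f f′ g g′} → f ≈[ L ] f′ → g ≈[ L ] g′ → f ⊕ g ≈[ L ] f′ ⊕ g′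
⊕-≈ p q .below i l = cong₂ _+_ (p .below i l) (q .below i l)

⊟-≈ : ∀ {L f f′ g g′} → f ≈[ L ] f′ → g ≈[ L ] g′ → f ⊟ g ≈[ L ] f′ ⊟ g′
⊟-≈ p q .below i l = cong₂ _-_ (p .below i l) (q .below i l)

⊛-≈ : ∀ {L f f′ g g′} → f ≈[ L ] f′ → g ≈[ L ] g′ → f ⊛ g ≈[ L ] f′ ⊛ g′
⊛-≈ p q .below i l = ⊛-cong-at i (λ j j≤i → p .below j (ℕₚ.≤-<-trans j≤i l)) (λ j j≤i → q .below j (ℕₚ.≤-<-trans j≤i l))

mono-⊛-≈ : ∀ {L} m f → L ℕ.≤ m → mono m ⊛ f ≈[ L ] zeroPS
mono-⊛-≈ m f L≤m .below i i<L = trans (mono-⊛-below m f (ℕₚ.<-≤-trans i<L L≤m)) (sym (cst-0 i))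

mono-≈ : ∀ {L m} → L ℕ.≤ m → mono m ≈[ L ] zeroPS
mono-≈ {L} {m} L≤m = ≈-trans (≋⇒≈ (≋-sym (⊛-identityʳ (mono m)))) (mono-⊛-≈ m one L≤m)

-- The n-th coefficient of u ⊛ f is u(0)·f(n) plus an expression in lower coefficients of f, so a
-- constant term 1 lets f be recovered one coefficient at a time.
⊛-cancelˡ-at : ∀ u f g n → u 0 ≡ 1ℤ → (∀ i → i ℕ.< n → f i ≡ g i) → (u ⊛ f) n ≡ (u ⊛ g) n → f n ≡ g n
⊛-cancelˡ-at u f g n u₀ lower p = trans (sym (unit (f n))) (trans (head-eq n lower p) (unit (g n)))
  where
  unit : ∀ x → u 0 * x ≡ x
  unit x = trans (cong (_* x) u₀) (ℤₚ.*-identityˡ x)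
  head-eq : ∀ n → (∀ i → i ℕ.< n → f i ≡ g i) → (u ⊛ f) n ≡ (u ⊛ g) n → u 0 * f n ≡ u 0 * g n
  head-eq zero    _     p = p
  head-eq (suc n) lower p = ∙-cancelʳ ((tail u ⊛ f) n) _ _ (begin
    u 0 * f (suc n) + (tail u ⊛ f) n  ≡⟨ ⊛-head u f n ⟨
    (u ⊛ f) (suc n)                   ≡⟨ p ⟩
    (u ⊛ g) (suc n)                   ≡⟨ ⊛-head u g n ⟩
    u 0 * g (suc n) + (tail u ⊛ g) n
      ≡⟨ cong (λ x → u 0 * g (suc n) + x) (⊛-cong-at {f = tail u} n (λ _ _ → refl) (λ j j≤n → lower j (s≤s j≤n))) ⟨
    u 0 * g (suc n) + (tail u ⊛ f) n  ∎)
    where open ≡-Reasoning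

⊛-cancelˡ-≈ : ∀ L u f g → u 0 ≡ 1ℤ → u ⊛ f ≈[ L ] u ⊛ g → f ≈[ L ] g
⊛-cancelˡ-≈ L u f g u₀ p .below = <-rec (λ i → i ℕ.< L → f i ≡ g i) λ i rec i<L →
  ⊛-cancelˡ-at u f g i u₀ (λ j j<i → rec j<i (ℕₚ.<-trans j<i i<L)) (p .below i i<L)

⊛-cancelˡ : ∀ u f g → u 0 ≡ 1ℤ → u ⊛ f ≋ u ⊛ g → f ≋ g
⊛-cancelˡ u f g u₀ p = ≈⇒≋ λ L → ⊛-cancelˡ-≈ L u f g u₀ (≋⇒≈ p)

-- The substitution of q^k for q

module _ (k : ℕ) .{{_ : NonZero k}} where

  dilate-cong : ∀ {f g} → f ≋ g → dilate k f ≋ dilate k g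
  dilate-cong p .at n with does (n % k ℕ.≟ 0)
  ... | true  = p .at (n / k)
  ... | false = refl

  dilate-⊕ : ∀ f g → dilate k (f ⊕ g) ≋ dilate k f ⊕ dilate k g
  dilate-⊕ f g .at n with does (n % k ℕ.≟ 0)
  ... | true  = refl
  ... | false = refl

  dilate-⊟ : ∀ f g → dilate k (f ⊟ g) ≋ dilate k f ⊟ dilate k g
  dilate-⊟ f g .at n with does (n % k ℕ.≟ 0)
  ... | true  = refl
  ... | false = refl

  dilate-scale : ∀ c f → dilate k (cst c ⊛ f) ≋ cst c ⊛ dilate k f
  dilate-scale c f .at n = trans lemma (sym (cst-⊛-at c (dilate k f) n))
    where
    lemma : dilate k (cst c ⊛ f) n ≡ c * dilate k f n
    lemma with does (n % k ℕ.≟ 0)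
    ... | true  = cst-⊛-at c f (n / k)
    ... | false = sym (ℤₚ.*-zeroʳ c)

  dilate-≈ : ∀ {L f g} → f ≈[ L ] g → dilate k f ≈[ L ] dilate k g
  dilate-≈ {L} p .below n n<L with does (n % k ℕ.≟ 0)
  ... | true  = p .below (n / k) (ℕₚ.≤-<-trans (Data.Nat.DivMod.m/n≤m n k) n<L)
  ... | false = refl

  dilate-shift : ∀ f n → dilate k f (k ℕ.+ n) ≡ dilate k (tail f) n
  dilate-shift f n
    rewrite trans (cong (_% k) (ℕₚ.+-comm k n)) ([m+n]%n≡m%n n k)
          | trans (m/n≡1+[m∸n]/n (ℕₚ.m≤m+n k n)) (cong (λ x → suc (x / k)) (ℕₚ.m+n∸m≡n k n))
    = refl

  dilate-below : ∀ f {n} → n ℕ.< k → dilate k f n ≡ cst (f 0) n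
  dilate-below f {n} n<k rewrite m<n⇒m%n≡m n<k with n
  ... | suc _ = refl
  ... | zero  rewrite m<n⇒m/n≡0 n<k = refl

  -- The substitution applied to f = f(0) + q·tail f. Multiplicativity and composition follow from
  -- this recursion by `recursion-unique`, without any arithmetic of `n % k`.
  dilate-unfold : ∀ f → dilate k f ≋ cst (f 0) ⊕ mono k ⊛ dilate k (tail f)
  dilate-unfold f .at n with n ℕ.<? k
  ... | yes n<k = trans (dilate-below f n<k)
    (sym (trans (cong (λ x → cst (f 0) n + x) (mono-⊛-below k (dilate k (tail f)) n<k)) (ℤₚ.+-identityʳ _)))
  ... | no n≮k with n ℕ.∸ k | ℕₚ.m+[n∸m]≡n (ℕₚ.≮⇒≥ n≮k)
  ... | m | refl = trans (dilate-shift f m) (sym (trans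
    (cong₂ _+_ (cst-above (ℕ.>-nonZero⁻¹ k)) (mono-⊛-shift k (dilate k (tail f)) m)) (ℤₚ.+-identityˡ _)))
    where
    cst-above : ∀ {j c} → 0 ℕ.< j → cst c (j ℕ.+ m) ≡ 0ℤ
    cst-above (s≤s _) = refl

tail-unfold : ∀ f → f ≋ cst (f 0) ⊕ mono 1 ⊛ tail f
tail-unfold f .at zero    = sym (trans (cong (λ x → f 0 + x) (mono-⊛-below 1 (tail f) ℕₚ.≤-refl)) (ℤₚ.+-identityʳ (f 0)))
tail-unfold f .at (suc n) = sym (trans (ℤₚ.+-identityˡ _) (mono-⊛-shift 1 (tail f) n))

mono-⊛-≈-suc : ∀ k .{{_ : NonZero k}} {L f g} → f ≈[ L ] g → mono k ⊛ f ≈[ suc L ] mono k ⊛ g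
mono-⊛-≈-suc k {L} {f} {g} p .below i i<L with i ℕ.<? k
... | yes i<k = trans (mono-⊛-below k f i<k) (sym (mono-⊛-below k g i<k))
... | no  i≮k with i ℕ.∸ k | ℕₚ.m+[n∸m]≡n (ℕₚ.≮⇒≥ i≮k)
... | m | refl = trans (mono-⊛-shift k f m)
  (trans (p .below m (ℕₚ.<-≤-trans (ℕₚ.m<n+m m (ℕ.>-nonZero⁻¹ k)) (ℕₚ.≤-pred i<L))) (sym (mono-⊛-shift k g m)))

-- Each unfolding multiplies the unknown part by q^k with k > 0 and thus gains at least one
-- coefficient of agreement. Since f turns into `tail f`, the induction must be uniform in f.
recursion-unique : ∀ k .{{_ : NonZero k}} (A X Y : PS → PS) →
  (∀ f → X f ≋ A f ⊕ mono k ⊛ X (tail f)) → (∀ f → Y f ≋ A f ⊕ mono k ⊛ Y (tail f)) → ∀ f → X f ≋ Y f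
recursion-unique k A X Y X-rec Y-rec f₀ = ≈⇒≋ λ L → go L f₀
  where
  go : ∀ L f → X f ≈[ L ] Y f
  go zero    f .below i ()
  go (suc L) f = ≈-trans (≋⇒≈ (X-rec f)) (≈-trans (⊕-≈ (≈-refl {f = A f}) (mono-⊛-≈-suc k (go L (tail f)))) (≋⇒≈ (≋-sym (Y-rec f))))

module _ (k : ℕ) .{{_ : NonZero k}} where
  open ≋-Reasoning

  dilate-mono-⊛ : ∀ f → dilate k (mono 1 ⊛ f) ≋ mono k ⊛ dilate k f
  dilate-mono-⊛ f = begin
    dilate k (mono 1 ⊛ f)                                              ≈⟨ dilate-unfold k (mono 1 ⊛ f) ⟩
    cst (0ℤ * f 0) ⊕ mono k ⊛ dilate k (tail (mono 1 ⊛ f))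
      ≈⟨ ⊕-cong (pointwise λ n → cong (λ c → cst c n) (ℤₚ.*-zeroˡ (f 0)))
                (⊛-congˡ (mono k) (dilate-cong k (pointwise (mono-⊛-shift 1 f)))) ⟩
    zeroPS ⊕ mono k ⊛ dilate k f                                       ≈⟨ ⊕-identityˡ _ ⟩
    mono k ⊛ dilate k f                                                ∎

  -- For fixed g both sides, as functions of f, solve the recursion with inhomogeneous term
  -- f(0)·`dilate k g`.
  dilate-⊛ : ∀ f g → dilate k (f ⊛ g) ≋ dilate k f ⊛ dilate k g
  dilate-⊛ f₀ g = recursion-unique k (λ f → cst (f 0) ⊛ dilate k g) (λ f → dilate k (f ⊛ g)) (λ f → dilate k f ⊛ dilate k g)
    (λ f → begin
      dilate k (f ⊛ g)
        ≈⟨ dilate-cong k (⊛-congʳ g (tail-unfold f)) ⟩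
      dilate k ((cst (f 0) ⊕ mono 1 ⊛ tail f) ⊛ g)
        ≈⟨ dilate-cong k (⊛-distribʳ g (cst (f 0)) (mono 1 ⊛ tail f)) ⟩
      dilate k (cst (f 0) ⊛ g ⊕ mono 1 ⊛ tail f ⊛ g)
        ≈⟨ dilate-⊕ k (cst (f 0) ⊛ g) (mono 1 ⊛ tail f ⊛ g) ⟩
      dilate k (cst (f 0) ⊛ g) ⊕ dilate k (mono 1 ⊛ tail f ⊛ g)
        ≈⟨ ⊕-cong (dilate-scale k (f 0) g) (≋-trans (dilate-cong k (⊛-assoc (mono 1) (tail f) g)) (dilate-mono-⊛ (tail f ⊛ g))) ⟩
      cst (f 0) ⊛ dilate k g ⊕ mono k ⊛ dilate k (tail f ⊛ g) ∎)
    (λ f → begin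
      dilate k f ⊛ dilate k g
        ≈⟨ ⊛-congʳ (dilate k g) (dilate-unfold k f) ⟩
      (cst (f 0) ⊕ mono k ⊛ dilate k (tail f)) ⊛ dilate k g
        ≈⟨ ⊛-distribʳ (dilate k g) (cst (f 0)) (mono k ⊛ dilate k (tail f)) ⟩
      cst (f 0) ⊛ dilate k g ⊕ mono k ⊛ dilate k (tail f) ⊛ dilate k g
        ≈⟨ ⊕-congˡ (cst (f 0) ⊛ dilate k g) (⊛-assoc (mono k) (dilate k (tail f)) (dilate k g)) ⟩
      cst (f 0) ⊛ dilate k g ⊕ mono k ⊛ (dilate k (tail f) ⊛ dilate k g) ∎)
    f₀

  dilate-mono : ∀ m → dilate k (mono m) ≋ mono (m ℕ.* k)
  dilate-mono zero    = begin
    dilate k (mono 0)                                   ≈⟨ dilate-unfold k (mono 0) ⟩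
    one ⊕ mono k ⊛ dilate k (λ _ → 0ℤ)                  ≈⟨ ⊕-cong (≋-sym mono-0) (⊛-cong {mono k} ≋-refl dilate-zero) ⟩
    mono 0 ⊕ mono k ⊛ zeroPS                            ≈⟨ ⊕-congˡ (mono 0) (⊛-zeroʳ (mono k)) ⟩
    mono 0 ⊕ zeroPS                                     ≈⟨ ⊕-identityʳ (mono 0) ⟩
    mono 0                                              ∎
    where
    dilate-zero : dilate k (λ _ → 0ℤ) ≋ zeroPS
    dilate-zero .at n with does (n % k ℕ.≟ 0)
    ... | true  = sym (cst-0 n)
    ... | false = sym (cst-0 n)
  dilate-mono (suc m) = begin
    dilate k (mono (suc m))                             ≈⟨ dilate-unfold k (mono (suc m)) ⟩
    zeroPS ⊕ mono k ⊛ dilate k (mono m)                 ≈⟨ ⊕-identityˡ _ ⟩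
    mono k ⊛ dilate k (mono m)                          ≈⟨ ⊛-congˡ (mono k) (dilate-mono m) ⟩
    mono k ⊛ mono (m ℕ.* k)                             ≈⟨ mono-+ k (m ℕ.* k) ⟨
    mono (k ℕ.+ m ℕ.* k)                                ∎

dilate-1 : ∀ f → dilate 1 f ≋ f
dilate-1 = recursion-unique 1 (λ f → cst (f 0)) (dilate 1) (λ f → f) (dilate-unfold 1) tail-unfold

dilate-dilate : ∀ j k .{{_ : NonZero j}} .{{_ : NonZero k}} .{{_ : NonZero (k ℕ.* j)}} f →
                dilate j (dilate k f) ≋ dilate (k ℕ.* j) f
dilate-dilate j k = recursion-unique (k ℕ.* j) (λ f → cst (f 0)) (λ f → dilate j (dilate k f)) (dilate (k ℕ.* j))
  (λ f → begin
    dilate j (dilate k f)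
      ≈⟨ dilate-cong j (dilate-unfold k f) ⟩
    dilate j (cst (f 0) ⊕ mono k ⊛ dilate k (tail f))
      ≈⟨ dilate-⊕ j (cst (f 0)) (mono k ⊛ dilate k (tail f)) ⟩
    dilate j (cst (f 0)) ⊕ dilate j (mono k ⊛ dilate k (tail f))
      ≈⟨ ⊕-cong (dilate-cst (f 0)) (dilate-⊛ j (mono k) (dilate k (tail f))) ⟩
    cst (f 0) ⊕ dilate j (mono k) ⊛ dilate j (dilate k (tail f))
      ≈⟨ ⊕-congˡ (cst (f 0)) (⊛-congʳ (dilate j (dilate k (tail f))) (dilate-mono j k)) ⟩
    cst (f 0) ⊕ mono (k ℕ.* j) ⊛ dilate j (dilate k (tail f)) ∎)
  (dilate-unfold (k ℕ.* j))
  where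
  open ≋-Reasoning
  dilate-cst : ∀ c → dilate j (cst c) ≋ cst c
  dilate-cst c = begin
    dilate j (cst c)          ≈⟨ dilate-cong j (⊛-identityʳ (cst c)) ⟨
    dilate j (cst c ⊛ one)    ≈⟨ dilate-scale j c one ⟩
    cst c ⊛ dilate j one      ≈⟨ ⊛-congˡ (cst c) (≋-trans (dilate-cong j (≋-sym mono-0)) (≋-trans (dilate-mono j 0) mono-0)) ⟩
    cst c ⊛ one               ≈⟨ ⊛-identityʳ (cst c) ⟩
    cst c                     ∎

-- Sums of functions with finite support

private variable 𝔸 𝔹 : Set

sumL : (𝔸 → ℤ) → List 𝔸 → ℤ
sumL h []       = 0ℤ
sumL h (x ∷ xs) = h x + sumL h xs

sumL-cong : ∀ {h h′ : 𝔸 → ℤ} → (∀ a → h a ≡ h′ a) → ∀ xs → sumL h xs ≡ sumL h′ xs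
sumL-cong p []       = refl
sumL-cong p (x ∷ xs) = cong₂ _+_ (p x) (sumL-cong p xs)

sumL-0 : ∀ {h : 𝔸 → ℤ} xs → (∀ {a} → a ∈ xs → h a ≡ 0ℤ) → sumL h xs ≡ 0ℤ
sumL-0 []       p = refl
sumL-0 (x ∷ xs) p = cong₂ _+_ (p (here refl)) (sumL-0 xs (p ∘ there))

sumL-+ : ∀ (h h′ : 𝔸 → ℤ) xs → sumL (λ a → h a + h′ a) xs ≡ sumL h xs + sumL h′ xs
sumL-+ h h′ []       = refl
sumL-+ h h′ (x ∷ xs) = trans (cong (λ s → h x + h′ x + s) (sumL-+ h h′ xs)) (interchange (h x) (h′ x) (sumL h xs) (sumL h′ xs))

sumL-swap : ∀ (h : 𝔸 → 𝔹 → ℤ) xs ys → sumL (λ a → sumL (h a) ys) xs ≡ sumL (λ b → sumL (λ a → h a b) xs) ys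
sumL-swap h []       ys = sym (sumL-0 ys λ _ → refl)
sumL-swap h (x ∷ xs) ys = trans (cong (λ s → sumL (h x) ys + s) (sumL-swap h xs ys)) (sym (sumL-+ (h x) _ ys))

sumL-map : ∀ (h : 𝔹 → ℤ) (f : 𝔸 → 𝔹) xs → sumL h (map f xs) ≡ sumL (h ∘ f) xs
sumL-map h f []       = refl
sumL-map h f (x ∷ xs) = cong (λ s → h (f x) + s) (sumL-map h f xs)

sumL-++ : ∀ (h : 𝔸 → ℤ) xs ys → sumL h (xs ++ ys) ≡ sumL h xs + sumL h ys
sumL-++ h []       ys = sym (ℤₚ.+-identityˡ _)
sumL-++ h (x ∷ xs) ys = trans (cong (λ s → h x + s) (sumL-++ h xs ys)) (sym (ℤₚ.+-assoc (h x) _ _))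

sumL-cartesianWith : ∀ {C : Set} (h : C → ℤ) (f : 𝔸 → 𝔹 → C) xs ys →
  sumL h (cartesianProductWith f xs ys) ≡ sumL (λ a → sumL (λ b → h (f a b)) ys) xs
sumL-cartesianWith h f []       ys = refl
sumL-cartesianWith h f (x ∷ xs) ys = trans (sumL-++ h (map (f x) ys) _)
  (cong₂ _+_ (sumL-map h (f x) ys) (sumL-cartesianWith h f xs ys))

module _ (_≟_ : DecidableEquality 𝔸) where

  private
    δ : 𝔸 → 𝔸 → ℤ
    δ x y = if does (x ≟ y) then 1ℤ else 0ℤ

    δ-same : ∀ x → δ x x ≡ 1ℤ
    δ-same x with x ≟ x
    ... | yes _  = refl
    ... | no x≢x = contradiction refl x≢x

    δ-diff : ∀ {x y} → x ≢ y → δ x y ≡ 0ℤ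
    δ-diff {x} {y} x≢y with x ≟ y
    ... | yes x≡y = contradiction x≡y x≢y
    ... | no _    = refl

    δ-sym : ∀ (h : 𝔸 → ℤ) x y → δ x y * h y ≡ δ y x * h x
    δ-sym h x y with x ≟ y
    ... | yes refl = cong (_* h x) (sym (δ-same x))
    ... | no x≢y   = trans (ℤₚ.*-zeroˡ (h y)) (sym (trans (cong (_* h x) (δ-diff (x≢y ∘ sym))) (ℤₚ.*-zeroˡ (h x))))

    pick-∈ : ∀ (h : 𝔸 → ℤ) x {ys} → Unique ys → x ∈ ys → sumL (λ y → δ x y * h y) ys ≡ h x
    pick-∈ h x {_ ∷ ys} (x∉ ∷ _) (here refl) = begin
      δ x x * h x + sumL (λ y → δ x y * h y) ys
        ≡⟨ cong₂ _+_ (trans (cong (_* h x) (δ-same x)) (ℤₚ.*-identityˡ (h x)))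
                     (sumL-0 ys λ {y} y∈ → trans (cong (_* h y) (δ-diff (All.lookup x∉ y∈))) (ℤₚ.*-zeroˡ (h y))) ⟩
      h x + 0ℤ  ≡⟨ ℤₚ.+-identityʳ (h x) ⟩
      h x       ∎
      where open ≡-Reasoning
    pick-∈ h x {y ∷ ys} (y∉ ∷ u) (there x∈) = begin
      δ x y * h y + sumL (λ y → δ x y * h y) ys
        ≡⟨ cong₂ _+_ (trans (cong (_* h y) (δ-diff λ { refl → All.lookup y∉ x∈ refl })) (ℤₚ.*-zeroˡ (h y))) (pick-∈ h x u x∈) ⟩
      0ℤ + h x  ≡⟨ ℤₚ.+-identityˡ (h x) ⟩
      h x       ∎
      where open ≡-Reasoning

    pick : ∀ (h : 𝔸 → ℤ) x {ys} → Unique ys → (h x ≢ 0ℤ → x ∈ ys) → sumL (λ y → δ x y * h y) ys ≡ h x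
    pick h x {ys} u c with h x ℤ.≟ 0ℤ
    ... | no  hx≢0 = pick-∈ h x u (c hx≢0)
    ... | yes hx≡0 = trans (sumL-0 ys λ {y} _ → vanish y) (sym hx≡0)
      where
      vanish : ∀ y → δ x y * h y ≡ 0ℤ
      vanish y = trans (δ-sym h x y) (trans (cong (δ y x *_) hx≡0) (ℤₚ.*-zeroʳ (δ y x)))

  -- Either sum equals the double sum of δ(x,y)·h(y), and the order of summation can be exchanged.
  -- The lists may differ wherever h vanishes, so they need not be permutations of each other.
  sumL-support : ∀ (h : 𝔸 → ℤ) {xs ys} → Unique xs → Unique ys →
    (∀ a → h a ≢ 0ℤ → a ∈ xs) → (∀ a → h a ≢ 0ℤ → a ∈ ys) → sumL h xs ≡ sumL h ys
  sumL-support h {xs} {ys} ux uy cx cy = begin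
    sumL h xs                                    ≡⟨ sumL-cong (λ x → sym (pick h x uy (cy x))) xs ⟩
    sumL (λ x → sumL (λ y → δ x y * h y) ys) xs  ≡⟨ sumL-swap (λ x y → δ x y * h y) xs ys ⟩
    sumL (λ y → sumL (λ x → δ x y * h y) xs) ys  ≡⟨ sumL-cong (λ y → sumL-cong (λ x → δ-sym h x y) xs) ys ⟩
    sumL (λ y → sumL (λ x → δ y x * h x) xs) ys  ≡⟨ sumL-cong (λ y → pick h y ux (cx y)) ys ⟩
    sumL h ys                                    ∎
    where open ≡-Reasoning

-- The sum of h over a possibly infinite type, witnessed by a duplicate-free list containing the
-- support. Zeros of h are allowed in the list, so one list can serve several functions.
record HasSum (h : 𝔸 → ℤ) (s : ℤ) : Set where
  constructor hasSum
  field
    list   : List 𝔸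
    unique : Unique list
    covers : ∀ a → h a ≢ 0ℤ → a ∈ list
    total  : sumL h list ≡ s

HasSum-unique : DecidableEquality 𝔸 → ∀ {h : 𝔸 → ℤ} {s t} → HasSum h s → HasSum h t → s ≡ t
HasSum-unique _≟_ {h} (hasSum xs ux cx px) (hasSum ys uy cy py) =
  trans (sym px) (trans (sumL-support _≟_ h ux uy cx cy) py)

HasSum-cong : ∀ {h h′ : 𝔸 → ℤ} {s} → (∀ a → h a ≡ h′ a) → HasSum h s → HasSum h′ s
HasSum-cong p (hasSum xs u c t) = hasSum xs u (λ a h′a≢0 → c a λ ha≡0 → h′a≢0 (trans (sym (p a)) ha≡0))
  (trans (sumL-cong (λ a → sym (p a)) xs) t)

HasSum-bijection : ∀ {h : 𝔹 → ℤ} {s} (φ : 𝔸 → 𝔹) (ψ : 𝔹 → 𝔸) → (∀ a → ψ (φ a) ≡ a) → (∀ b → φ (ψ b) ≡ b) →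
  HasSum h s → HasSum (h ∘ φ) s
HasSum-bijection {h = h} φ ψ ψφ φψ (hasSum xs u c t) = hasSum (map ψ xs)
  (Uniqueₚ.map⁺ (λ {x} {y} eq → trans (sym (φψ x)) (trans (cong φ eq) (φψ y))) u)
  (λ a ne → subst (_∈ map ψ xs) (ψφ a) (∈-map⁺ ψ (c (φ a) ne)))
  (trans (sumL-map (h ∘ φ) ψ xs) (trans (sumL-cong (λ b → cong h (φψ b)) xs) t))

-- The maps φ r together form a bijection from Fin k × 𝔸 to 𝔹 with inverse (`class`, ψ), so the sum
-- over 𝔹 is a sum over classes.
HasSum-split : DecidableEquality 𝔸 → DecidableEquality 𝔹 → ∀ k (φ : Fin k → 𝔸 → 𝔹) (class : 𝔹 → Fin k) (ψ : 𝔹 → 𝔸) →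
  (∀ b → φ (class b) (ψ b) ≡ b) → (∀ {r r′ a a′} → φ r a ≡ φ r′ a′ → r ≡ r′ × a ≡ a′) →
  ∀ {h : 𝔹 → ℤ} {s} → HasSum h s →
  Σ (Fin k → ℤ) λ t → (∀ r → HasSum (h ∘ φ r) (t r)) × s ≡ sumL t (allFin k)
HasSum-split {𝔸 = 𝔸} _≟𝔸_ _≟𝔹_ k φ class ψ φψ inj {h} S@(hasSum xs u c t) =
  (λ r → sumL (h ∘ φ r) ys) ,
  (λ r → hasSum ys ys! (covers-part r) refl) ,
  HasSum-unique _≟𝔹_ S (hasSum zs (Uniqueₚ.cartesianProductWith⁺ φ inj (Uniqueₚ.allFin⁺ k) ys!)
    (λ b ne → subst (_∈ zs) (φψ b) (∈-cartesianProductWith⁺ φ (∈-allFin (class b)) (∈-deduplicate⁺ _≟𝔸_ (∈-map⁺ ψ (c b ne)))))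
    (sumL-cartesianWith h φ (allFin k) ys))
  where
  -- The 𝔸-coordinates of the whole support, whatever their class: one list for all k sums.
  ys : List 𝔸
  ys = deduplicate _≟𝔸_ (map ψ xs)
  ys! : Unique ys
  ys! = deduplicate-! _≟𝔸_ (map ψ xs)
  zs = cartesianProductWith φ (allFin k) ys
  covers-part : ∀ r a → h (φ r a) ≢ 0ℤ → a ∈ ys
  covers-part r a ne = subst (_∈ ys) (proj₂ (inj (φψ (φ r a)))) (∈-deduplicate⁺ _≟𝔸_ (∈-map⁺ ψ (c (φ r a) ne)))

module _ (k : ℕ) .{{_ : NonZero k}} where

  residue : ℤ → Fin k
  residue x = fromℕ< (n%ℕd<d x k)

  fromResidue : Fin k → ℤ → ℤ
  fromResidue r x = + toℕ r + x * + k

  fromResidue-residue : ∀ x → fromResidue (residue x) (x /ℕ k) ≡ x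
  fromResidue-residue x = trans (cong (λ r → + r + (x /ℕ k) * + k) (Finₚ.toℕ-fromℕ< (n%ℕd<d x k))) (sym (a≡a%ℕn+[a/ℕn]*n x k))

  private
    -- A remainder is less than k and cannot outweigh a difference of the quotients.
    fromResidue-mono : ∀ r r′ {x x′} → x ℤ.< x′ → fromResidue r x ℤ.< fromResidue r′ x′
    fromResidue-mono r r′ {x} {x′} x<x′ = begin-strict
      + toℕ r + x * + k     <⟨ ℤₚ.+-monoˡ-< (x * + k) (ℤ.+<+ (Finₚ.toℕ<n r)) ⟩
      + k + x * + k         ≡⟨ ℤₚ.suc-* x (+ k) ⟨
      ℤ.suc x * + k         ≤⟨ ℤₚ.*-monoʳ-≤-nonNeg (+ k) (ℤₚ.i<j⇒suc[i]≤j x<x′) ⟩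
      x′ * + k              ≤⟨ ℤₚ.i≤j+i (x′ * + k) (+ toℕ r′) ⟩
      + toℕ r′ + x′ * + k   ∎
      where open ℤₚ.≤-Reasoning

  fromResidue-injective : ∀ {r r′ x x′} → fromResidue r x ≡ fromResidue r′ x′ → r ≡ r′ × x ≡ x′
  fromResidue-injective {r} {r′} {x} {x′} eq with ℤₚ.<-cmp x x′
  ... | tri< x<x′ _ _ = contradiction eq (ℤₚ.<⇒≢ (fromResidue-mono r r′ x<x′))
  ... | tri> _ _ x′<x = contradiction (sym eq) (ℤₚ.<⇒≢ (fromResidue-mono r′ r x′<x))
  ... | tri≈ _ refl _ = Finₚ.toℕ-injective (ℤₚ.+-injective (∙-cancelʳ (x * + k) _ _ eq)) , refl

-- Formal linear combinations of indexed series

module Combination {I : Set} (IsSeries : I → PS → Set) where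

  Comb : Set
  Comb = List (ℤ × I)

  scale : ℤ → Comb → Comb
  scale c = map λ (d , i) → c * d , i

  -- f is the value of the combination for some choice of series with the listed indices. The series
  -- are existentially bound, so that all computing is done on integers and indices.
  Sums : Comb → PS → Set
  Sums []            f = f ≋ zeroPS
  Sums ((c , i) ∷ L) f = Σ PS λ g → Σ PS λ h → IsSeries i g × Sums L h × f ≋ cst c ⊛ g ⊕ h

  Sums-cong : ∀ L {f g} → f ≋ g → Sums L g → Sums L f
  Sums-cong []      p q                     = ≋-trans p q
  Sums-cong (_ ∷ _) p (g , h , s , S , q) = g , h , s , S , ≋-trans p q

  Sums-single : ∀ i {f} → IsSeries i f → Sums ((1ℤ , i) ∷ []) f
  Sums-single i {f} s = f , zeroPS , s , ≋-refl , pointwise λ n →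
    sym (trans (cong₂ _+_ (trans (cst-⊛-at 1ℤ f n) (ℤₚ.*-identityˡ (f n))) (cst-0 n)) (ℤₚ.+-identityʳ (f n)))

  Sums-++ : ∀ L M {f g} → Sums L f → Sums M g → Sums (L ++ M) (f ⊕ g)
  Sums-++ []            M {f} {g} p T = Sums-cong M (≋-trans (⊕-congʳ g p) (⊕-identityˡ g)) T
  Sums-++ ((c , i) ∷ L) M {f} {g} (u , v , s , S , p) T = u , v ⊕ g , s , Sums-++ L M S T ,
    ≋-trans (⊕-congʳ g p) (pointwise λ n → ℤₚ.+-assoc ((cst c ⊛ u) n) (v n) (g n))

  Sums-scale : ∀ c L {f} → Sums L f → Sums (scale c L) (cst c ⊛ f)
  Sums-scale c []            p = ≋-trans (⊛-congˡ (cst c) p) (⊛-zeroʳ (cst c))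
  Sums-scale c ((d , i) ∷ L) {f} (u , v , s , S , p) = u , cst c ⊛ v , s , Sums-scale c L S , pointwise λ n → begin
    (cst c ⊛ f) n                            ≡⟨ cst-⊛-at c f n ⟩
    c * f n                                  ≡⟨ cong (c *_) (trans (p .at n) (cong (_+ v n) (cst-⊛-at d u n))) ⟩
    c * (d * u n + v n)                      ≡⟨ arith c d (u n) (v n) ⟩
    c * d * u n + c * v n                    ≡⟨ cong₂ _+_ (cst-⊛-at (c * d) u n) (cst-⊛-at c v n) ⟨
    (cst (c * d) ⊛ u) n + (cst c ⊛ v) n      ∎
    where
    open ≡-Reasoning
    arith : ∀ c d x y → c * (d * x + y) ≡ c * d * x + c * y
    arith = solve-∀

  Sums-⊟ : ∀ L M {f g} → Sums L f → Sums M g → Sums (L ++ scale (- 1ℤ) M) (f ⊟ g)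
  Sums-⊟ L M {f} {g} S T = Sums-cong (L ++ scale (- 1ℤ) M)
    (pointwise λ n → cong (λ x → f n + x) (sym (trans (cst-⊛-at (- 1ℤ) g n) (ℤₚ.-1*i≡-i (g n)))))
    (Sums-++ L (scale (- 1ℤ) M) S (Sums-scale (- 1ℤ) M T))

  -- Once an index determines its series, coefficients of equal indices may be added, and a
  -- combination is recognised as 0 by evaluation.
  module Collect (_≟_ : DecidableEquality I) (unique : ∀ i {f g} → IsSeries i f → IsSeries i g → f ≋ g) where

    insert : ℤ → I → Comb → Comb
    insert c i []            = (c , i) ∷ []
    insert c i ((d , j) ∷ L) with i ≟ j
    ... | yes _ = (c + d , j) ∷ L
    ... | no _  = (d , j) ∷ insert c i L

    collect : Comb → Comb
    collect []            = []
    collect ((c , i) ∷ L) = insert c i (collect L)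

    vanishes : Comb → Bool
    vanishes []            = true
    vanishes ((c , _) ∷ L) = does (c ℤ.≟ 0ℤ) ∧ vanishes L

    Sums-insert : ∀ c i L {u v} → IsSeries i u → Sums L v → Sums (insert c i L) (cst c ⊛ u ⊕ v)
    Sums-insert c i []            {u} {v} s p = u , v , s , p , ≋-refl
    Sums-insert c i ((d , j) ∷ L) {u} {v} s (g , h , t , S , p) with i ≟ j
    ... | yes refl = g , h , t , S , pointwise λ n → begin
      (cst c ⊛ u) n + v n              ≡⟨ cong₂ _+_ (cst-⊛-at c u n) (trans (p .at n) (cong (_+ h n) (cst-⊛-at d g n))) ⟩
      c * u n + (d * g n + h n)        ≡⟨ cong (λ x → c * x + (d * g n + h n)) (unique i s t .at n) ⟩
      c * g n + (d * g n + h n)        ≡⟨ arith c d (g n) (h n) ⟩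
      (c + d) * g n + h n              ≡⟨ cong (_+ h n) (cst-⊛-at (c + d) g n) ⟨
      (cst (c + d) ⊛ g) n + h n        ∎
      where
      open ≡-Reasoning
      arith : ∀ c d x y → c * x + (d * x + y) ≡ (c + d) * x + y
      arith = solve-∀
    ... | no _ = g , cst c ⊛ u ⊕ h , t , Sums-insert c i L s S , pointwise λ n →
      trans (cong (λ x → (cst c ⊛ u) n + x) (p .at n)) (arith ((cst c ⊛ u) n) ((cst d ⊛ g) n) (h n))
      where
      arith : ∀ x y z → x + (y + z) ≡ y + (x + z)
      arith = solve-∀

    Sums-collect : ∀ L {f} → Sums L f → Sums (collect L) f
    Sums-collect []            p = p
    Sums-collect ((c , i) ∷ L) (u , v , s , S , p) =
      Sums-cong (insert c i (collect L)) p (Sums-insert c i (collect L) s (Sums-collect L S))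

    Sums-vanishes : ∀ L {f} → vanishes L ≡ true → Sums L f → f ≋ zeroPS
    Sums-vanishes []            _ p = p
    Sums-vanishes ((c , i) ∷ L) e (u , v , s , S , p) with c ℤ.≟ 0ℤ
    ... | yes refl = ≋-trans p (≋-trans (⊕-congʳ v (⊛-zeroˡ u)) (≋-trans (⊕-identityˡ v) (Sums-vanishes L e S)))

    Sums-cancel : ∀ L {f} → vanishes (collect L) ≡ true → Sums L f → f ≋ zeroPS
    Sums-cancel L e S = Sums-vanishes (collect L) e (Sums-collect L S)

-- Series Σ q^{Q(x,y)} for quadratic polynomials Q

record Quad : Set where
  constructor quad
  field xx xy yy x₁ y₁ c₀ : ℤ

eval : Quad → ℤ × ℤ → ℤ
eval (quad a b c d e f) (x , y) = a * x * x + b * x * y + c * y * y + d * x + e * y + f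

_≟Q_ : DecidableEquality Quad
quad a b c d e f ≟Q quad a′ b′ c′ d′ e′ f′ = map′
  (λ { (refl , refl , refl , refl , refl , refl) → refl })
  (λ { refl → refl , refl , refl , refl , refl , refl })
  (a ℤ.≟ a′ ×-dec b ℤ.≟ b′ ×-dec c ℤ.≟ c′ ×-dec d ℤ.≟ d′ ×-dec e ℤ.≟ e′ ×-dec f ℤ.≟ f′)

_≟ℤ²_ : DecidableEquality (ℤ × ℤ)
_≟ℤ²_ = ≡-dec ℤ._≟_ ℤ._≟_

indicator : ℤ → ℕ → ℤ
indicator z N = if does (z ℤ.≟ + N) then + 1 else + 0

-- f = Σ_{x,y∈ℤ} q^{Q(x,y)}
IsQuadSeries : Quad → PS → Set
IsQuadSeries Q f = ∀ N → HasSum (λ p → indicator (eval Q p) N) (f N)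

IsQuadSeries-unique : ∀ Q {f g} → IsQuadSeries Q f → IsQuadSeries Q g → f ≋ g
IsQuadSeries-unique Q s t .at N = HasSum-unique _≟ℤ²_ (s N) (t N)

record Affine : Set where
  constructor affine
  field p q r s u v : ℤ

apply : Affine → ℤ × ℤ → ℤ × ℤ
apply (affine p q r s u v) (x , y) = p * x + q * y + u , r * x + s * y + v

det : Affine → ℤ
det (affine p q r s u v) = p * s - q * r

substitute : Quad → Affine → Quad
substitute (quad a b c d e f) (affine p q r s u v) = quad
  (a * p * p + b * p * r + c * r * r)
  ((+ 2) * a * p * q + b * (p * s + q * r) + (+ 2) * c * r * s)
  (a * q * q + b * q * s + c * s * s)
  ((+ 2) * a * p * u + b * (p * v + r * u) + (+ 2) * c * r * v + d * p + e * r)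
  ((+ 2) * a * q * u + b * (q * v + s * u) + (+ 2) * c * s * v + d * q + e * s)
  (a * u * u + b * u * v + c * v * v + d * u + e * v + f)

eval-substitute : ∀ Q m z → eval (substitute Q m) z ≡ eval Q (apply m z)
eval-substitute (quad a b c d e f) (affine p q r s u v) (x , y) = lemma a b c d e f p q r s u v x y
  where
  lemma : ∀ a b c d e f p q r s u v x y →
    (a * p * p + b * p * r + c * r * r) * x * x
      + ((+ 2) * a * p * q + b * (p * s + q * r) + (+ 2) * c * r * s) * x * y
      + (a * q * q + b * q * s + c * s * s) * y * y
      + ((+ 2) * a * p * u + b * (p * v + r * u) + (+ 2) * c * r * v + d * p + e * r) * x
      + ((+ 2) * a * q * u + b * (q * v + s * u) + (+ 2) * c * s * v + d * q + e * s) * y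
      + (a * u * u + b * u * v + c * v * v + d * u + e * v + f)
    ≡ a * (p * x + q * y + u) * (p * x + q * y + u) + b * (p * x + q * y + u) * (r * x + s * y + v)
      + c * (r * x + s * y + v) * (r * x + s * y + v) + d * (p * x + q * y + u) + e * (r * x + s * y + v) + f
  lemma = solve-∀

-- The adjugate times `det m`. A determinant with square 1 is its own inverse, which covers both
-- signs without a case distinction.
inverse : Affine → ℤ × ℤ → ℤ × ℤ
inverse m@(affine p q r s u v) (x , y) = det m * (s * (x - u) - q * (y - v)) , det m * (p * (y - v) - r * (x - u))

module _ (m : Affine) (unimodular : det m * det m ≡ 1ℤ) where
  open Affine m

  private
    unit : ∀ z → det m * det m * z ≡ z
    unit z = trans (cong (_* z) unimodular) (ℤₚ.*-identityˡ z)

    left₁ : ∀ p q r s u v x y →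
      (p * s - q * r) * (s * (p * x + q * y + u - u) - q * (r * x + s * y + v - v)) ≡ (p * s - q * r) * (p * s - q * r) * x
    left₁ = solve-∀
    left₂ : ∀ p q r s u v x y →
      (p * s - q * r) * (p * (r * x + s * y + v - v) - r * (p * x + q * y + u - u)) ≡ (p * s - q * r) * (p * s - q * r) * y
    left₂ = solve-∀
    right₁ : ∀ p q r s u v x y →
      p * ((p * s - q * r) * (s * (x - u) - q * (y - v))) + q * ((p * s - q * r) * (p * (y - v) - r * (x - u))) + u
        ≡ (p * s - q * r) * (p * s - q * r) * (x - u) + u
    right₁ = solve-∀
    right₂ : ∀ p q r s u v x y →
      r * ((p * s - q * r) * (s * (x - u) - q * (y - v))) + s * ((p * s - q * r) * (p * (y - v) - r * (x - u))) + v
        ≡ (p * s - q * r) * (p * s - q * r) * (y - v) + v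
    right₂ = solve-∀
    minus-plus : ∀ x u → x - u + u ≡ x
    minus-plus = solve-∀

  inverse-apply : ∀ z → inverse m (apply m z) ≡ z
  inverse-apply (x , y) = cong₂ _,_ (trans (left₁ p q r s u v x y) (unit x)) (trans (left₂ p q r s u v x y) (unit y))

  apply-inverse : ∀ z → apply m (inverse m z) ≡ z
  apply-inverse (x , y) = cong₂ _,_
    (trans (right₁ p q r s u v x y) (trans (cong (_+ u) (unit (x - u))) (minus-plus x u)))
    (trans (right₂ p q r s u v x y) (trans (cong (_+ v) (unit (y - v))) (minus-plus y v)))

  substitute-series : ∀ Q {f} → IsQuadSeries Q f → IsQuadSeries (substitute Q m) f
  substitute-series Q S N = HasSum-cong (λ z → cong (λ e → indicator e N) (sym (eval-substitute Q m z)))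
    (HasSum-bijection (apply m) (inverse m) inverse-apply apply-inverse (S N))

module QuadComb = Combination IsQuadSeries
open QuadComb using () renaming (Comb to QComb; Sums to QSums)

-- The class x ≡ r mod k. Cutting along x is enough, because `move` brings other directions into
-- this position.
residueMap : ∀ k → Fin k → Affine
residueMap k r = affine (+ k) 0ℤ 0ℤ 1ℤ (+ toℕ r) 0ℤ

-- A recipe for cutting Σ q^{Q(x,y)} into series of the same kind.
data Plan : Set where
  done  : Plan
  move  : (m : Affine) → det m * det m ≡ 1ℤ → Plan → Plan
  split : (k : ℕ) .{{_ : NonZero k}} → (Fin k → Plan) → Plan
  adapt : (Quad → Plan) → Plan

parts : Plan → Quad → QComb
parts done          Q = (1ℤ , Q) ∷ []
parts (move m _ P)  Q = parts P (substitute Q m)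
parts (split k P)   Q = concatMap (λ r → parts (P r) (substitute Q (residueMap k r))) (allFin k)
parts (adapt P)     Q = parts (P Q) Q

-- `HasSum-split` is applied to each coefficient N separately; the r-th part series collects the
-- r-th partial sums.
split-series : ∀ k .{{_ : NonZero k}} Q {f} → IsQuadSeries Q f →
  Σ (Fin k → PS) λ g → (∀ r → IsQuadSeries (substitute Q (residueMap k r)) (g r)) × (∀ N → f N ≡ sumL (λ r → g r N) (allFin k))
split-series k Q S = (λ r N → proj₁ (at-N N) r) , (λ r N → HasSum-cong (re r N) (proj₁ (proj₂ (at-N N)) r)) , (λ N → proj₂ (proj₂ (at-N N)))
  where
  φ : Fin k → ℤ × ℤ → ℤ × ℤ
  φ r (x , y) = fromResidue k r x , y
  at-N : ∀ N → _
  at-N N = HasSum-split _≟ℤ²_ _≟ℤ²_ k φ (λ (x , _) → residue k x) (λ (x , y) → x /ℕ k , y)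
    (λ (x , y) → cong (_, y) (fromResidue-residue k x))
    (λ eq → let (r≡ , x≡) = fromResidue-injective k (cong proj₁ eq) in r≡ , cong₂ _,_ x≡ (cong proj₂ eq))
    (S N)
  re : ∀ r N z → indicator (eval Q (φ r z)) N ≡ indicator (eval (substitute Q (residueMap k r)) z) N
  re r N (x , y) = cong (λ e → indicator e N)
    (trans (cong₂ (λ X Y → eval Q (X , Y)) (first (+ k) (+ toℕ r) x y) (second x y)) (sym (eval-substitute Q (residueMap k r) (x , y))))
    where
    first : ∀ k r x y → r + x * k ≡ k * x + 0ℤ * y + r
    first = solve-∀
    second : ∀ x y → y ≡ 0ℤ * x + 1ℤ * y + 0ℤ
    second = solve-∀

parts-sound : ∀ P Q {f} → IsQuadSeries Q f → QSums (parts P Q) f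
parts-sound done         Q S = QuadComb.Sums-single Q S
parts-sound (move m u P) Q S = parts-sound P (substitute Q m) (substitute-series m u Q S)
parts-sound (adapt P)    Q S = parts-sound (P Q) Q S
parts-sound (split k P)  Q S =
  let (g , G , eq) = split-series k Q S in
  QuadComb.Sums-cong (parts (split k P) Q) (pointwise eq) (go g G (allFin k))
  where
  go : ∀ g → (∀ r → IsQuadSeries (substitute Q (residueMap k r)) (g r)) → ∀ rs →
    QSums (concatMap (λ r → parts (P r) (substitute Q (residueMap k r))) rs) (λ N → sumL (λ r → g r N) rs)
  go g G []       = pointwise λ n → sym (cst-0 n)
  go g G (r ∷ rs) = QuadComb.Sums-++ (parts (P r) (substitute Q (residueMap k r))) _
    (parts-sound (P r) (substitute Q (residueMap k r)) (G r)) (go g G rs)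

refine : List Plan → QComb → QComb
refine (P ∷ Ps) ((c , Q) ∷ L) = QuadComb.scale c (parts P Q) ++ refine Ps L
refine _        L             = L

refine-sound : ∀ Ps L {f} → QSums L f → QSums (refine Ps L) f
refine-sound []       L             S = S
refine-sound (P ∷ Ps) []            S = S
refine-sound (P ∷ Ps) ((c , Q) ∷ L) (u , v , s , S , p) = QuadComb.Sums-cong (refine (P ∷ Ps) ((c , Q) ∷ L)) p
  (QuadComb.Sums-++ (QuadComb.scale c (parts P Q)) (refine Ps L) (QuadComb.Sums-scale c (parts P Q) (parts-sound P Q s)) (refine-sound Ps L S))

open QuadComb.Collect _≟Q_ IsQuadSeries-unique using (collect; vanishes; Sums-cancel)

-- The only hypothesis about the plans is a Boolean evaluation, which is `refl` for concrete ones;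
-- the soundness of every cut is already contained in `Plan`.
certify : ∀ Ps L {f} → vanishes (collect (refine Ps L)) ≡ true → QSums L f → f ≋ zeroPS
certify Ps L e S = Sums-cancel (refine Ps L) e (refine-sound Ps L S)

-- Products of one-variable theta series

record Lin : Set where
  constructor lin
  field a b c : ℤ

evalL : Lin → ℤ → ℤ
evalL (lin a b c) x = a * x * x + b * x + c

-- In contrast to `IsQuadSeries` the exponents are required to be natural numbers: a negative value
-- would be dropped from f, although it could contribute to a product.
IsLinSeries : Lin → PS → Set
IsLinSeries T f = Σ (ℤ → ℕ) λ e → (∀ x → evalL T x ≡ + e x) × (∀ N → HasSum (λ x → mono (e x) N) (f N))

module LinComb = Combination IsLinSeries
open LinComb using () renaming (Comb to LComb; Sums to LSums)

HasSum-0 : ∀ {A : Set} {h : A → ℤ} → (∀ a → h a ≡ 0ℤ) → HasSum h 0ℤ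
HasSum-0 z = hasSum [] [] (λ a ne → contradiction (z a) ne) refl

indicator-mono : ∀ m N → indicator (+ m) N ≡ mono m N
indicator-mono m N with m ℕ.≟ N
... | yes refl rewrite dec-true (+ m ℤ.≟ + m) refl = refl
... | no m≢N rewrite dec-false (+ m ℤ.≟ + N) (m≢N ∘ ℤₚ.+-injective) | dec-false (N ℕ.≟ m) (m≢N ∘ sym) = refl

mono-≢0 : ∀ m N → mono m N ≢ 0ℤ → m ≡ N
mono-≢0 m N ne with N ℕ.≟ m
... | yes refl = refl
... | no N≢m   = contradiction (cong (λ b → if b then 1ℤ else 0ℤ) (dec-false (N ℕ.≟ m) N≢m)) ne

mono-diagonal : ∀ m → mono m m ≡ 1ℤ
mono-diagonal m rewrite dec-true (m ℕ.≟ m) refl = refl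

_⊗_ : Lin → Lin → Quad
lin a b c ⊗ lin a′ b′ c′ = quad a 0ℤ a′ b b′ (c + c′)

sumL-⊛ : ∀ {A : Set} (t : A → PS) g xs N → ((λ n → sumL (λ a → t a n) xs) ⊛ g) N ≡ sumL (λ a → (t a ⊛ g) N) xs
sumL-⊛ t g []       N = trans (⊛-congʳ g (pointwise λ n → sym (cst-0 n)) .at N) (trans (⊛-zeroˡ g .at N) (cst-0 N))
sumL-⊛ t g (x ∷ xs) N = trans (⊛-distribʳ-at g (t x) (λ n → sumL (λ a → t a n) xs) N)
  (cong (λ s → (t x ⊛ g) N + s) (sumL-⊛ t g xs N))

-- `HasSum` may use another list for every coefficient, whereas the convolution up to N needs a
-- single list for all coefficients i ≤ N.
commonList : ∀ {f : PS} {e : ℤ → ℕ} → (∀ N → HasSum (λ x → mono (e x) N) (f N)) → ∀ N →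
  Σ (List ℤ) λ xs → Unique xs × (∀ x → e x ℕ.≤ N → x ∈ xs) × (∀ i → i ℕ.≤ N → f i ≡ sumL (λ x → mono (e x) i) xs)
commonList {f} {e} S N = xs , deduplicate-! ℤ._≟_ all , covers , λ i i≤N →
  HasSum-unique ℤ._≟_ (S i) (hasSum xs (deduplicate-! ℤ._≟_ all)
    (λ x ne → covers x (subst (ℕ._≤ N) (sym (mono-≢0 (e x) i ne)) i≤N)) refl)
  where
  lists : ℕ → List ℤ
  lists i = HasSum.list (S i)
  all = concatMap lists (upTo (suc N))
  xs = deduplicate ℤ._≟_ all
  concatMap-∈ : ∀ {x i} is → i ∈ is → x ∈ lists i → x ∈ concatMap lists is
  concatMap-∈ (i ∷ is) (here refl) x∈ = ∈-++⁺ˡ x∈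
  concatMap-∈ (j ∷ is) (there i∈)  x∈ = ∈-++⁺ʳ (lists j) (concatMap-∈ is i∈ x∈)
  covers : ∀ x → e x ℕ.≤ N → x ∈ xs
  -- x occurs in the list belonging to its own exponent e x, where its monomial has coefficient 1.
  covers x le = ∈-deduplicate⁺ ℤ._≟_ (concatMap-∈ (upTo (suc N)) (∈-upTo⁺ (s≤s le))
    (HasSum.covers (S (e x)) x λ eq → contradiction (trans (sym (mono-diagonal (e x))) eq) λ ()))

product-series : ∀ T U {f g} → IsLinSeries T f → IsLinSeries U g → IsQuadSeries (T ⊗ U) (f ⊛ g)
product-series T U {f} {g} (e , ev , S) (e′ , ev′ , S′) N with commonList {f} {e} S N | commonList {g} {e′} S′ N
... | xs , ux , cx , px | ys , uy , cy , py = hasSum (cartesianProduct xs ys) (Uniqueₚ.cartesianProduct⁺ ux uy)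
  (λ (x , y) ne → let eq = mono-≢0 (e x ℕ.+ e′ y) N (λ z → ne (trans (value x y) z)) in
     ∈-cartesianProduct⁺ (cx x (subst (e x ℕ.≤_) eq (ℕₚ.m≤m+n _ _))) (cy y (subst (e′ y ℕ.≤_) eq (ℕₚ.m≤n+m _ _))))
  (begin
    sumL (λ p → indicator (eval (T ⊗ U) p) N) (cartesianProduct xs ys)
      ≡⟨ sumL-cartesianWith (λ p → indicator (eval (T ⊗ U) p) N) _,_ xs ys ⟩
    sumL (λ x → sumL (λ y → indicator (eval (T ⊗ U) (x , y)) N) ys) xs
      ≡⟨ sumL-cong (λ x → sumL-cong (λ y → trans (value x y) (mono-+ (e x) (e′ y) .at N)) ys) xs ⟩
    sumL (λ x → sumL (λ y → (mono (e x) ⊛ mono (e′ y)) N) ys) xs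
      ≡⟨ sumL-cong (λ x → trans (sumL-cong (λ y → ⊛-comm (mono (e x)) (mono (e′ y)) .at N) ys)
                            (trans (sym (sumL-⊛ (mono ∘ e′) (mono (e x)) ys N)) (⊛-comm Σy (mono (e x)) .at N))) xs ⟩
    sumL (λ x → (mono (e x) ⊛ Σy) N) xs
      ≡⟨ sumL-⊛ (mono ∘ e) Σy xs N ⟨
    (Σx ⊛ Σy) N
      ≡⟨ ⊛-cong-at {Σx} {f} {Σy} {g} N (λ i le → sym (px i le)) (λ i le → sym (py i le)) ⟩
    (f ⊛ g) N ∎)
  where
  open ≡-Reasoning
  Σx Σy : PS
  Σx n = sumL (λ x → mono (e x) n) xs
  Σy n = sumL (λ y → mono (e′ y) n) ys
  reassemble : ∀ a b c a′ b′ c′ x y →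
    a * x * x + 0ℤ * x * y + a′ * y * y + b * x + b′ * y + (c + c′) ≡ (a * x * x + b * x + c) + (a′ * y * y + b′ * y + c′)
  reassemble = solve-∀
  value : ∀ x y → indicator (eval (T ⊗ U) (x , y)) N ≡ mono (e x ℕ.+ e′ y) N
  value x y = trans (cong (λ z → indicator z N)
      (trans (reassemble (Lin.a T) (Lin.b T) (Lin.c T) (Lin.a U) (Lin.b U) (Lin.c U) x y) (cong₂ _+_ (ev x) (ev′ y))))
    (indicator-mono (e x ℕ.+ e′ y) N)

_⊗C_ : LComb → LComb → QComb
_⊗C_ = cartesianProductWith λ (c , T) (d , U) → c * d , T ⊗ U

private
  term-⊗ : ∀ c T M {u g} → IsLinSeries T u → LSums M g → QSums (map (λ (d , U) → c * d , T ⊗ U) M) (cst c ⊛ (u ⊛ g))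
  term-⊗ c T []            {u} {g} s p = ≋-trans (⊛-congˡ (cst c) (≋-trans (⊛-congˡ u p) (⊛-zeroʳ u))) (⊛-zeroʳ (cst c))
  term-⊗ c T ((d , U) ∷ M) {u} {g} s (v , h , t , S , p) = u ⊛ v , cst c ⊛ (u ⊛ h) , product-series T U s t , term-⊗ c T M s S ,
    ≋-trans (⊛-congˡ (cst c) (⊛-congˡ u p)) (pointwise λ n → begin
      (cst c ⊛ (u ⊛ (cst d ⊛ v ⊕ h))) n
        ≡⟨ cst-⊛-at c (u ⊛ (cst d ⊛ v ⊕ h)) n ⟩
      c * (u ⊛ (cst d ⊛ v ⊕ h)) n
        ≡⟨ cong (c *_) (⊛-distribˡ u (cst d ⊛ v) h .at n) ⟩
      c * ((u ⊛ (cst d ⊛ v)) n + (u ⊛ h) n)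
        ≡⟨ cong (λ x → c * (x + (u ⊛ h) n)) (trans (⊛-comm u (cst d ⊛ v) .at n) (trans (⊛-assoc (cst d) v u .at n)
             (trans (cst-⊛-at d (v ⊛ u) n) (cong (d *_) (⊛-comm v u .at n))))) ⟩
      c * (d * (u ⊛ v) n + (u ⊛ h) n)
        ≡⟨ arith c d ((u ⊛ v) n) ((u ⊛ h) n) ⟩
      c * d * (u ⊛ v) n + c * (u ⊛ h) n
        ≡⟨ cong₂ _+_ (cst-⊛-at (c * d) (u ⊛ v) n) (cst-⊛-at c (u ⊛ h) n) ⟨
      (cst (c * d) ⊛ (u ⊛ v) ⊕ cst c ⊛ (u ⊛ h)) n ∎)
    where
    open ≡-Reasoning
    arith : ∀ c d x y → c * (d * x + y) ≡ c * d * x + c * y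
    arith = solve-∀

Sums-⊗ : ∀ L M {f g} → LSums L f → LSums M g → QSums (L ⊗C M) (f ⊛ g)
Sums-⊗ []            M {f} {g} p T = ≋-trans (⊛-congʳ g p) (⊛-zeroˡ g)
Sums-⊗ ((c , i) ∷ L) M {f} {g} (u , v , s , S , p) T =
  QuadComb.Sums-cong (((c , i) ∷ L) ⊗C M)
    (≋-trans (⊛-congʳ g p) (≋-trans (⊛-distribʳ g (cst c ⊛ u) v) (⊕-congʳ (v ⊛ g) (⊛-assoc (cst c) u g))))
    (QuadComb.Sums-++ (map (λ (d , U) → c * d , i ⊗ U) M) (L ⊗C M) (term-⊗ c i M s T) (Sums-⊗ L M S T))

dilateL : ℕ → LComb → LComb
dilateL k = map λ (c , lin a b d) → c , lin (a * + k) (b * + k) (d * + k)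

dilate-series : ∀ k .{{_ : NonZero k}} a b c {f} → IsLinSeries (lin a b c) f →
  IsLinSeries (lin (a * + k) (b * + k) (c * + k)) (dilate k f)
dilate-series k a b c {f} (e , ev , S) = (λ x → e x ℕ.* k) ,
  (λ x → trans (arith a b c (+ k) x) (trans (cong (_* + k) (ev x)) (sym (ℤₚ.pos-* (e x) k)))) ,
  (λ N → HasSum-cong (λ x → dilate-mono k (e x) .at N) (dilated N))
  where
  arith : ∀ a b c k x → (a * k) * x * x + (b * k) * x + c * k ≡ (a * x * x + b * x + c) * k
  arith = solve-∀
  dilated : ∀ N → HasSum (λ x → dilate k (mono (e x)) N) (dilate k f N)
  dilated N with does (N % k ℕ.≟ 0)
  ... | true  = S (N / k)
  ... | false = HasSum-0 λ _ → refl

dilate-zero : ∀ k .{{_ : NonZero k}} → dilate k zeroPS ≋ zeroPS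
dilate-zero k .at n with does (n % k ℕ.≟ 0)
... | true  = trans (cst-0 (n / k)) (sym (cst-0 n))
... | false = sym (cst-0 n)

Sums-dilate : ∀ k .{{_ : NonZero k}} L {f} → LSums L f → LSums (dilateL k L) (dilate k f)
Sums-dilate k []                  p = ≋-trans (dilate-cong k p) (dilate-zero k)
Sums-dilate k ((c , lin a b d) ∷ L) (u , v , s , S , p) = dilate k u , dilate k v , dilate-series k a b d s , Sums-dilate k L S ,
  ≋-trans (dilate-cong k p) (≋-trans (dilate-⊕ k (cst c ⊛ u) v) (⊕-congʳ (dilate k v) (dilate-scale k c u)))

shiftL : ℕ → LComb → LComb
shiftL m = map λ (c , lin a b d) → c , lin a b (d + + m)

shift-series : ∀ m a b c {f} → IsLinSeries (lin a b c) f → IsLinSeries (lin a b (c + + m)) (mono m ⊛ f)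
shift-series m a b c {f} (e , ev , S) = (λ x → e x ℕ.+ m) ,
  (λ x → trans (sym (ℤₚ.+-assoc (a * x * x + b * x) c (+ m))) (cong (_+ + m) (ev x))) , shifted
  where
  shifted : ∀ N → HasSum (λ x → mono (e x ℕ.+ m) N) ((mono m ⊛ f) N)
  shifted N = HasSum-cong (λ x → sym (trans (mono-cong (ℕₚ.+-comm (e x) m) .at N) (mono-+ m (e x) .at N))) lemma
    where
    lemma : HasSum (λ x → (mono m ⊛ mono (e x)) N) ((mono m ⊛ f) N)
    lemma with N ℕ.<? m
    ... | yes N<m = subst (HasSum _) (sym (mono-⊛-below m f N<m)) (HasSum-0 λ x → mono-⊛-below m (mono (e x)) N<m)
    ... | no  N≮m with N ℕ.∸ m | ℕₚ.m+[n∸m]≡n (ℕₚ.≮⇒≥ N≮m)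
    ... | j | refl = subst (HasSum _) (sym (mono-⊛-shift m f j)) (HasSum-cong (λ x → sym (mono-⊛-shift m (mono (e x)) j)) (S j))

Sums-shift : ∀ m L {f} → LSums L f → LSums (shiftL m L) (mono m ⊛ f)
Sums-shift m []                  p = ≋-trans (⊛-congˡ (mono m) p) (⊛-zeroʳ (mono m))
Sums-shift m ((c , lin a b d) ∷ L) {f} (u , v , s , S , p) = mono m ⊛ u , mono m ⊛ v , shift-series m a b d s , Sums-shift m L S ,
  ≋-trans (⊛-congˡ (mono m) p) (≋-trans (⊛-distribˡ (mono m) (cst c ⊛ u) v) (⊕-congʳ (mono m ⊛ v)
    (≋-trans (≋-sym (⊛-assoc (mono m) (cst c) u)) (≋-trans (⊛-congʳ u (⊛-comm (mono m) (cst c))) (⊛-assoc (cst c) (mono m) u)))))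

sumL-applyUpTo : ∀ f (g : ℕ → ℕ) n → sumL f (applyUpTo g (suc n)) ≡ sumTo (f ∘ g) n
sumL-applyUpTo f g zero    = ℤₚ.+-identityʳ (f (g 0))
sumL-applyUpTo f g (suc n) = trans (cong (λ s → f (g 0) + s) (sumL-applyUpTo f (g ∘ suc) n)) (sym (sumTo-head (f ∘ g) n))

HasSum-scale : ∀ {A : Set} c {h : A → ℤ} {s} → HasSum h s → HasSum (λ a → c * h a) (c * s)
HasSum-scale c {h} (hasSum xs u cov t) = hasSum xs u
  (λ a ne → cov a λ ha≡0 → ne (trans (cong (c *_) ha≡0) (ℤₚ.*-zeroʳ c)))
  (trans (sumL-* xs) (cong (c *_) t))
  where
  sumL-* : ∀ xs → sumL (λ a → c * h a) xs ≡ c * sumL h xs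
  sumL-* []       = sym (ℤₚ.*-zeroʳ c)
  sumL-* (x ∷ xs) = trans (cong (λ s → c * h x + s) (sumL-* xs)) (sym (ℤₚ.*-distribˡ-+ c (h x) _))

-- Theta series of positive definite binary forms

∈-box : ∀ B z → ∣ z ∣ ℕ.≤ B → z ∈ box B
∈-box B z le = subst (_∈ box B) (recover z le) (∈-map⁺ (λ i → + i - + B) (∈-upTo⁺ (s≤s (bound z le))))
  where
  index : ℤ → ℕ
  index (+ n)    = n ℕ.+ B
  index -[1+ n ] = B ℕ.∸ suc n
  bound : ∀ z → ∣ z ∣ ℕ.≤ B → index z ℕ.≤ B ℕ.+ B
  bound (+ n)    le = ℕₚ.+-monoˡ-≤ B le
  bound -[1+ n ] le = ℕₚ.≤-trans (ℕₚ.m∸n≤m B (suc n)) (ℕₚ.m≤m+n B B)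
  cancel : ∀ x y → x + y - y ≡ x
  cancel = solve-∀
  cancel′ : ∀ x y → y - (x + y) ≡ - x
  cancel′ = solve-∀
  recover : ∀ z → ∣ z ∣ ℕ.≤ B → + index z - + B ≡ z
  recover (+ n)    le = cancel (+ n) (+ B)
  recover -[1+ n ] le = trans (cong (λ b → + (B ℕ.∸ suc n) - + b) (sym (ℕₚ.m+[n∸m]≡n le))) (cancel′ (+ suc n) (+ (B ℕ.∸ suc n)))

box-unique : ∀ B → Unique (box B)
box-unique B = Uniqueₚ.map⁺ (λ {i} {j} eq → ℤₚ.+-injective (∙-cancelʳ (- + B) (+ i) (+ j) eq)) (Uniqueₚ.upTo⁺ (suc (B ℕ.+ B)))

square-abs : ∀ x → x * x ≡ + (∣ x ∣ ℕ.* ∣ x ∣)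
square-abs (+ n)    = sym (ℤₚ.pos-* n n)
square-abs -[1+ n ] = refl

n≤n*n : ∀ n → n ℕ.≤ n ℕ.* n
n≤n*n zero    = z≤n
n≤n*n (suc n) = ℕₚ.m≤m+n (suc n) (n ℕ.* suc n)

-- 4a(an² + bnm + cm²) = (2an + bm)² + (4ac − b²)m²
definite-bound : ∀ a b c n m N → 1ℤ ℤ.≤ a → 1ℤ ℤ.≤ c → 1ℤ ℤ.≤ (+ 4) * a * c - b * b →
  a * n * n + b * n * m + c * m * m ≡ + N → ∣ m ∣ ℕ.≤ 4 ℕ.* ∣ a ∣ ℕ.* ∣ c ∣ ℕ.* N
definite-bound a b c n m N a>0 c>0 definite eq = ℕₚ.≤-trans (ℤ.drop‿+≤+ chain) (ℕₚ.*-monoˡ-≤ N (ℕₚ.m≤m*n (4 ℕ.* ∣ a ∣) ∣ c ∣ {{nonZero c c>0}}))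
  where
  open ℤₚ.≤-Reasoning
  nonZero : ∀ c → 1ℤ ℤ.≤ c → NonZero ∣ c ∣
  nonZero (+ suc c) _ = _
  nonZero (+ zero) (ℤ.+≤+ ())
  positive : ∀ a → 1ℤ ℤ.≤ a → a ≡ + ∣ a ∣
  positive (+ a) _ = refl
  D w : ℤ
  D = (+ 4) * a * c - b * b
  w = (+ 2) * a * n + b * m
  complete-square : ∀ a b c n m → ((+ 4) * a * c - b * b) * (m * m) + ((+ 2) * a * n + b * m) * ((+ 2) * a * n + b * m)
                    ≡ (+ 4) * a * (a * n * n + b * n * m + c * m * m)
  complete-square = solve-∀
  chain : + ∣ m ∣ ℤ.≤ + (4 ℕ.* ∣ a ∣ ℕ.* N)
  chain = begin
    + ∣ m ∣                                       ≤⟨ ℤ.+≤+ (n≤n*n ∣ m ∣) ⟩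
    + (∣ m ∣ ℕ.* ∣ m ∣)                           ≡⟨ ℤₚ.*-identityˡ _ ⟨
    1ℤ * + (∣ m ∣ ℕ.* ∣ m ∣)                      ≤⟨ ℤₚ.*-monoʳ-≤-nonNeg (+ (∣ m ∣ ℕ.* ∣ m ∣)) definite ⟩
    D * + (∣ m ∣ ℕ.* ∣ m ∣)                       ≤⟨ ℤₚ.i≤i+j _ (+ (∣ w ∣ ℕ.* ∣ w ∣)) ⟩
    D * + (∣ m ∣ ℕ.* ∣ m ∣) + + (∣ w ∣ ℕ.* ∣ w ∣) ≡⟨ cong₂ (λ x y → D * x + y) (square-abs m) (square-abs w) ⟨
    D * (m * m) + w * w                           ≡⟨ complete-square a b c n m ⟩
    (+ 4) * a * (a * n * n + b * n * m + c * m * m) ≡⟨ cong₂ (λ x y → (+ 4) * x * y) (positive a a>0) eq ⟩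
    (+ 4) * + ∣ a ∣ * + N                         ≡⟨ cong (_* + N) (ℤₚ.pos-* 4 ∣ a ∣) ⟨
    + (4 ℕ.* ∣ a ∣) * + N                         ≡⟨ ℤₚ.pos-* (4 ℕ.* ∣ a ∣) N ⟨
    + (4 ℕ.* ∣ a ∣ ℕ.* N)                         ∎

theta-series : ∀ a b c → 1ℤ ℤ.≤ a → 1ℤ ℤ.≤ c → 1ℤ ℤ.≤ (+ 4) * a * c - b * b →
  IsQuadSeries (quad a b c 0ℤ 0ℤ 0ℤ) (theta a b c)
theta-series a b c a>0 c>0 definite N = HasSum-cong {h = λ (n , m) → F n m}
  (λ (n , m) → cong (λ e → indicator e N) (pad (a * n * n + b * n * m + c * m * m) n m))
  (hasSum (cartesianProduct (box B) (box B)) (Uniqueₚ.cartesianProduct⁺ (box-unique B) (box-unique B))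
    (λ (n , m) ne → let eq = solution n m ne in ∈-cartesianProduct⁺
      -- Exchanging the two variables turns the bound for m into a bound for n; `B` is symmetric in
      -- a and c.
      (∈-box B n (subst (∣ n ∣ ℕ.≤_) B-swap (definite-bound c b a m n N c>0 a>0 (subst (1ℤ ℤ.≤_) (disc-swap a b c) definite)
                    (trans (form-swap a b c n m) eq))))
      (∈-box B m (definite-bound a b c n m N a>0 c>0 definite eq)))
    (trans (sumL-cartesianWith (λ (n , m) → F n m) _,_ (box B) (box B)) (sym (nested (box B) (box B)))))
  where
  F : ℤ → ℤ → ℤ
  F n m = if does (a * n * n + b * n * m + c * m * m ℤ.≟ + N) then + 1 else + 0
  B : ℕ
  B = 4 ℕ.* ∣ a ∣ ℕ.* ∣ c ∣ ℕ.* N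
  pad : ∀ v n m → v ≡ v + 0ℤ * n + 0ℤ * m + 0ℤ
  pad = solve-∀
  disc-swap : ∀ a b c → (+ 4) * a * c - b * b ≡ (+ 4) * c * a - b * b
  disc-swap = solve-∀
  form-swap : ∀ a b c n m → c * m * m + b * m * n + a * n * n ≡ a * n * n + b * n * m + c * m * m
  form-swap = solve-∀
  B-swap : 4 ℕ.* ∣ c ∣ ℕ.* ∣ a ∣ ℕ.* N ≡ B
  B-swap = cong (ℕ._* N) (trans (ℕₚ.*-assoc 4 ∣ c ∣ ∣ a ∣) (trans (cong (4 ℕ.*_) (ℕₚ.*-comm ∣ c ∣ ∣ a ∣)) (sym (ℕₚ.*-assoc 4 ∣ a ∣ ∣ c ∣))))
  solution : ∀ n m → F n m ≢ 0ℤ → a * n * n + b * n * m + c * m * m ≡ + N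
  solution n m ne with a * n * n + b * n * m + c * m * m ℤ.≟ + N
  ... | yes eq = eq
  ... | no _   = contradiction refl ne
  row : ∀ h xs → foldr _+_ 0ℤ (map h xs) ≡ sumL h xs
  row h []       = refl
  row h (x ∷ xs) = cong (λ s → h x + s) (row h xs)
  foldr-++ : ∀ xs ys → foldr _+_ 0ℤ (xs ++ ys) ≡ foldr _+_ 0ℤ xs + foldr _+_ 0ℤ ys
  foldr-++ []       ys = sym (ℤₚ.+-identityˡ _)
  foldr-++ (x ∷ xs) ys = trans (cong (λ s → x + s) (foldr-++ xs ys)) (sym (ℤₚ.+-assoc x _ _))
  nested : ∀ xs ys → foldr _+_ 0ℤ (concatMap (λ n → map (F n) ys) xs) ≡ sumL (λ n → sumL (F n) ys) xs
  nested []       ys = refl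
  nested (x ∷ xs) ys = trans (foldr-++ (map (F x) ys) _) (cong₂ _+_ (row (F x) ys) (nested xs ys))

-- Alternating theta series in one variable

alt : ℕ → ℤ
alt zero    = 1ℤ
alt (suc n) = - alt n

-- n(n-1)/2, with the shift that the exponents of the triple product carry.
tri : ℕ → ℕ
tri zero    = 0
tri (suc n) = n ℕ.+ tri n

-- Truncating at n ≤ N is harmless for families in which t n is divisible by q^n, see `Rising`. `G`
-- and `H` have this shape by definition.
sum∞ : (ℕ → PS) → PS
sum∞ t N = sumTo (λ n → t n N) N

-- (a+b)·n(n−1)/2 + a·n, which is a natural number for negative n as well.
jacExp : ℕ → ℕ → ℤ → ℕ
jacExp a b (+ n)    = (a ℕ.+ b) ℕ.* tri n ℕ.+ a ℕ.* n
jacExp a b -[1+ n ] = (a ℕ.+ b) ℕ.* tri (suc n) ℕ.+ b ℕ.* suc n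

jacTerm : ℕ → ℕ → ℕ → PS
jacTerm a b n = cst (alt n) ⊛ (mono (jacExp a b (+ n)) ⊟ mono (jacExp a b -[1+ n ]))

-- Σ_{n∈ℤ} (−1)ⁿ q^{(a+b)n(n−1)/2 + an}, the term n ≥ 0 being paired with −1−n.
jac : ℕ → ℕ → PS
jac a b = sum∞ (jacTerm a b)

-- The even n = 2x with sign + and the odd n = 2x+1 with sign -, since a `Lin` series carries no
-- alternating sign. The exponents become 2(a+b)x² + (a-b)x and 2(a+b)x² + (3a+b)x + a.
jacL : ℕ → ℕ → LComb
jacL a b = (1ℤ , lin (+ (2 ℕ.* (a ℕ.+ b))) (+ a - + b) 0ℤ)
         ∷ (- 1ℤ , lin (+ (2 ℕ.* (a ℕ.+ b))) (+ (3 ℕ.* a ℕ.+ b)) (+ a)) ∷ []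

tri-double : ∀ n → (+ 2) * + tri n ≡ + n * (+ n - 1ℤ)
tri-double zero    = refl
tri-double (suc n) = begin
  (+ 2) * (+ n + + tri n)          ≡⟨ ℤₚ.*-distribˡ-+ (+ 2) (+ n) (+ tri n) ⟩
  (+ 2) * + n + (+ 2) * + tri n    ≡⟨ cong (λ x → (+ 2) * + n + x) (tri-double n) ⟩
  (+ 2) * + n + + n * (+ n - 1ℤ)   ≡⟨ arith (+ n) ⟩
  (1ℤ + + n) * (1ℤ + + n - 1ℤ)     ∎
  where
  open ≡-Reasoning
  arith : ∀ n → (+ 2) * n + n * (n - 1ℤ) ≡ (1ℤ + n) * (1ℤ + n - 1ℤ)
  arith = solve-∀

-- Doubling removes the denominator of z(z-1)/2 and yields one polynomial for both signs of z.
jacExp-double : ∀ a b z → (+ 2) * + jacExp a b z ≡ (+ a + + b) * z * (z - 1ℤ) + (+ 2) * + a * z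
jacExp-double a b z = go z
  where
  open ≡-Reasoning
  expand : ∀ k t c n → (+ 2) * + (k ℕ.* t ℕ.+ c ℕ.* n) ≡ + k * ((+ 2) * + t) + (+ 2) * + c * + n
  expand k t c n = trans (cong₂ (λ x y → (+ 2) * (x + y)) (ℤₚ.pos-* k t) (ℤₚ.pos-* c n)) (arith (+ k) (+ t) (+ c) (+ n))
    where
    arith : ∀ k t c n → (+ 2) * (k * t + c * n) ≡ k * ((+ 2) * t) + (+ 2) * c * n
    arith = solve-∀
  go : ∀ z → (+ 2) * + jacExp a b z ≡ (+ a + + b) * z * (z - 1ℤ) + (+ 2) * + a * z
  go (+ n) = trans (expand (a ℕ.+ b) (tri n) a n)
    (cong (_+ (+ 2) * + a * + n) (trans (cong ((+ a + + b) *_) (tri-double n)) (sym (ℤₚ.*-assoc (+ a + + b) (+ n) (+ n - 1ℤ)))))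
  go -[1+ n ] = trans (expand (a ℕ.+ b) (tri (suc n)) b (suc n))
    (trans (cong (λ x → (+ a + + b) * x + (+ 2) * + b * + suc n) (tri-double (suc n))) (arith (+ a) (+ b) (+ suc n)))
    where
    arith : ∀ a b m → (a + b) * (m * (m - 1ℤ)) + (+ 2) * b * m ≡ (a + b) * (- m) * (- m - 1ℤ) + (+ 2) * a * (- m)
    arith = solve-∀

alt-suc : ∀ z → alt ∣ 1ℤ + z ∣ ≡ - alt ∣ z ∣
alt-suc (+ n)          = refl
alt-suc -[1+ zero ]    = refl
alt-suc -[1+ suc n ]   = sym (ℤₚ.neg-involutive (alt (suc n)))

alt-even : ∀ x → alt ∣ 0ℤ + x * + 2 ∣ ≡ 1ℤ
alt-even x = trans (cong (λ z → alt ∣ z ∣) (ℤₚ.+-identityˡ (x * + 2))) (trans (cong alt (ℤₚ.abs-* x (+ 2))) (go ∣ x ∣))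
  where
  go : ∀ m → alt (m ℕ.* 2) ≡ 1ℤ
  go zero    = refl
  go (suc m) = trans (ℤₚ.neg-involutive (alt (m ℕ.* 2))) (go m)

alt-odd : ∀ x → alt ∣ 1ℤ + x * + 2 ∣ ≡ - 1ℤ
alt-odd x = trans (alt-suc (x * + 2)) (cong -_ (trans (cong (λ z → alt ∣ z ∣) (sym (ℤₚ.+-identityˡ (x * + 2)))) (alt-even x)))

module _ (a b : ℕ) .{{_ : NonZero a}} .{{_ : NonZero b}} where

  n≤jacExp⁺ : ∀ n → n ℕ.≤ jacExp a b (+ n)
  n≤jacExp⁺ n = ℕₚ.≤-trans (ℕₚ.m≤n*m n a) (ℕₚ.m≤n+m (a ℕ.* n) _)

  n≤jacExp⁻ : ∀ n → suc n ℕ.≤ jacExp a b -[1+ n ]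
  n≤jacExp⁻ n = ℕₚ.≤-trans (ℕₚ.m≤n*m (suc n) b) (ℕₚ.m≤n+m (b ℕ.* suc n) _)

  jac-hasSum : ∀ N → HasSum (λ z → alt ∣ z ∣ * mono (jacExp a b z) N) (jac a b N)
  jac-hasSum N = hasSum (map +_ (upTo (suc N)) ++ map -[1+_] (upTo (suc N)))
    (Uniqueₚ.++⁺ (Uniqueₚ.map⁺ ℤₚ.+-injective (Uniqueₚ.upTo⁺ (suc N))) (Uniqueₚ.map⁺ (λ { refl → refl }) (Uniqueₚ.upTo⁺ (suc N)))
      λ (p , q) → disjoint p q)
    covers
    (begin
      sumL h (map +_ (upTo (suc N)) ++ map -[1+_] (upTo (suc N)))
        ≡⟨ sumL-++ h (map +_ (upTo (suc N))) (map -[1+_] (upTo (suc N))) ⟩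
      sumL h (map +_ (upTo (suc N))) + sumL h (map -[1+_] (upTo (suc N)))
        ≡⟨ cong₂ _+_ (trans (sumL-map h +_ (upTo (suc N))) (sumL-applyUpTo (h ∘ +_) id N))
                     (trans (sumL-map h -[1+_] (upTo (suc N))) (sumL-applyUpTo (h ∘ -[1+_]) id N)) ⟩
      sumTo (h ∘ +_) N + sumTo (h ∘ -[1+_]) N
        ≡⟨ sumTo-+ (h ∘ +_) (h ∘ -[1+_]) N ⟨
      sumTo (λ n → h (+ n) + h -[1+ n ]) N
        ≡⟨ sumTo-cong N (λ n _ → trans (arith (alt n) (mono (jacExp a b (+ n)) N) (mono (jacExp a b -[1+ n ]) N))
                                   (sym (cst-⊛-at (alt n) (mono (jacExp a b (+ n)) ⊟ mono (jacExp a b -[1+ n ])) N))) ⟩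
      jac a b N ∎)
    where
    open ≡-Reasoning
    h : ℤ → ℤ
    h z = alt ∣ z ∣ * mono (jacExp a b z) N
    arith : ∀ s x y → s * x + (- s) * y ≡ s * (x - y)
    arith = solve-∀
    disjoint : ∀ {z} → z ∈ map +_ (upTo (suc N)) → z ∈ map -[1+_] (upTo (suc N)) → _
    disjoint p q with ∈-map⁻ +_ p | ∈-map⁻ -[1+_] q
    ... | _ , _ , refl | _ , _ , ()
    exponent : ∀ z → h z ≢ 0ℤ → jacExp a b z ≡ N
    exponent z ne = mono-≢0 (jacExp a b z) N λ m≡0 → ne (trans (cong (alt ∣ z ∣ *_) m≡0) (ℤₚ.*-zeroʳ (alt ∣ z ∣)))
    covers : ∀ z → h z ≢ 0ℤ → z ∈ map +_ (upTo (suc N)) ++ map -[1+_] (upTo (suc N))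
    covers (+ n)    ne = ∈-++⁺ˡ (∈-map⁺ +_ (∈-upTo⁺ (s≤s (subst (n ℕ.≤_) (exponent (+ n) ne) (n≤jacExp⁺ n)))))
    covers -[1+ n ] ne = ∈-++⁺ʳ (map +_ (upTo (suc N))) (∈-map⁺ -[1+_] (∈-upTo⁺
      (ℕₚ.m≤n⇒m≤1+n (subst (suc n ℕ.≤_) (exponent -[1+ n ] ne) (n≤jacExp⁻ n)))))

  jac-sums : LSums (jacL a b) (jac a b)
  jac-sums = even , cst (- 1ℤ) ⊛ odd ⊕ zeroPS , (_ , even-exp , λ N → HasSum-cong (even-weight N) (proj₁ (proj₂ (S N)) fzero))
    , (odd , zeroPS , (_ , odd-exp , λ N → HasSum-cong (odd-weight N) (HasSum-scale (- 1ℤ) (proj₁ (proj₂ (S N)) (fsuc fzero)))) , ≋-refl , ≋-refl)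
    , pointwise λ N → trans (proj₂ (proj₂ (S N))) (sym (cong₂ _+_ (trans (cst-⊛-at 1ℤ even N) (ℤₚ.*-identityˡ (even N)))
        (cong₂ _+_ (trans (cst-⊛-at (- 1ℤ) odd N) (neg-neg (proj₁ (S N) (fsuc fzero)))) (cst-0 N))))
    where
    S : ∀ N → _
    S N = HasSum-split ℤ._≟_ ℤ._≟_ 2 (fromResidue 2) (residue 2) (_/ℕ 2) (fromResidue-residue 2) (fromResidue-injective 2) (jac-hasSum N)
    even odd : PS
    even N = proj₁ (S N) fzero
    -- The sign of the odd class moves into the coefficient -1 of `jacL`, so that `odd` has only
    -- monomials with coefficient 1.
    odd  N = - 1ℤ * proj₁ (S N) (fsuc fzero)
    neg-neg : ∀ x → - 1ℤ * (- 1ℤ * x) ≡ x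
    neg-neg = solve-∀
    even-weight : ∀ N x → alt ∣ 0ℤ + x * + 2 ∣ * mono (jacExp a b (0ℤ + x * + 2)) N ≡ mono (jacExp a b (0ℤ + x * + 2)) N
    even-weight N x = trans (cong (_* mono (jacExp a b (0ℤ + x * + 2)) N) (alt-even x)) (ℤₚ.*-identityˡ _)
    odd-weight : ∀ N x → - 1ℤ * (alt ∣ 1ℤ + x * + 2 ∣ * mono (jacExp a b (1ℤ + x * + 2)) N) ≡ mono (jacExp a b (1ℤ + x * + 2)) N
    odd-weight N x = trans (cong (λ s → - 1ℤ * (s * mono (jacExp a b (1ℤ + x * + 2)) N)) (alt-odd x)) (neg-neg _)
    even-exp : ∀ x → + (2 ℕ.* (a ℕ.+ b)) * x * x + (+ a - + b) * x + 0ℤ ≡ + jacExp a b (0ℤ + x * + 2)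
    even-exp x = ℤₚ.*-cancelˡ-≡ (+ 2) _ _ (trans (trans (cong (λ k → (+ 2) * (k * x * x + (+ a - + b) * x + 0ℤ)) (ℤₚ.pos-* 2 (a ℕ.+ b)))
      (arith (+ a) (+ b) x)) (sym (jacExp-double a b (0ℤ + x * + 2))))
      where
      arith : ∀ a b x → (+ 2) * ((+ 2) * (a + b) * x * x + (a - b) * x + 0ℤ)
                        ≡ (a + b) * (0ℤ + x * + 2) * (0ℤ + x * + 2 - 1ℤ) + (+ 2) * a * (0ℤ + x * + 2)
      arith = solve-∀
    odd-exp : ∀ x → + (2 ℕ.* (a ℕ.+ b)) * x * x + + (3 ℕ.* a ℕ.+ b) * x + + a ≡ + jacExp a b (1ℤ + x * + 2)
    odd-exp x = ℤₚ.*-cancelˡ-≡ (+ 2) _ _ (trans (trans (cong₂ (λ k l → (+ 2) * (k * x * x + (l + + b) * x + + a)) (ℤₚ.pos-* 2 (a ℕ.+ b)) (ℤₚ.pos-* 3 a))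
      (arith (+ a) (+ b) x)) (sym (jacExp-double a b (1ℤ + x * + 2))))
      where
      arith : ∀ a b x → (+ 2) * ((+ 2) * (a + b) * x * x + ((+ 3) * a + b) * x + a)
                        ≡ (a + b) * (1ℤ + x * + 2) * (1ℤ + x * + 2 - 1ℤ) + (+ 2) * a * (1ℤ + x * + 2)
      arith = solve-∀

-- The binary identities

-- For a diagonal form, translate and reflect x so that 0 ≤ x₁ ≤ xx.
tidyX : Plan → Plan
tidyX P = adapt go
  where
  reflect : Quad → Plan
  -- For a diagonal form the map x ↦ -1-x replaces x₁ by 2·xx - x₁, which folds the interval (xx,
  -- 2·xx) onto (0, xx).
  reflect Q = if does (Quad.x₁ Q ℤ.≤? Quad.xx Q) then P else move (affine (- 1ℤ) 0ℤ 0ℤ 1ℤ (- 1ℤ) 0ℤ) refl P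
  go : Quad → Plan
  go (quad (+ suc a) _ _ d _ _) = move (affine 1ℤ 0ℤ 0ℤ 1ℤ (- (d /ℕ (2 ℕ.* suc a))) 0ℤ) refl (adapt reflect)
  go _                          = P

swap : Affine
swap = affine 0ℤ 1ℤ 1ℤ 0ℤ 0ℤ 0ℤ

-- A normal form: diagonal polynomials that differ by reflections and translations of the two
-- variables become equal, and `collect` can match them.
tidy : Plan
tidy = tidyX (move swap refl (tidyX (move swap refl done)))

-- The cosets of the sublattice spanned by (a, 0) and (b, d).
cosets : (a b d : ℕ) .{{_ : NonZero a}} .{{_ : NonZero d}} → (Fin a → Fin d → Plan) → Plan
cosets a b d P = move swap refl (split d λ j → move swap refl (move (affine 1ℤ (+ b) 0ℤ 1ℤ 0ℤ 0ℤ) (shear (+ b)) (split a λ i → P i j)))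
  where
  shear : ∀ b → (1ℤ * 1ℤ - b * 0ℤ) * (1ℤ * 1ℤ - b * 0ℤ) ≡ 1ℤ
  shear = solve-∀

linear : (p q r s : ℤ) → det (affine p q r s 0ℤ 0ℤ) * det (affine p q r s 0ℤ 0ℤ) ≡ 1ℤ → Plan → Plan
linear p q r s = move (affine p q r s 0ℤ 0ℤ)

trivialCoset : ∀ {a d} → Plan → Plan → Fin a → Fin d → Plan
trivialCoset P P′ fzero fzero = P
trivialCoset P P′ _     _     = P′

-- The sublattice x ≡ y mod 2 and its coset through (1, 0), each followed by a map of its own.
halves : ∀ m → det m * det m ≡ 1ℤ → ∀ m′ → det m′ * det m′ ≡ 1ℤ → Plan
halves m u m′ u′ = cosets 2 1 1 (trivialCoset (move m u done) (move m′ u′ done))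

-- Each theta series is cut into a sublattice of index 2, which cancels against the one of another theta series,
-- and its complement, which falls into cosets on which the form is diagonal.
plans₁ : List Plan
plans₁ = cosets 2 0 1 (trivialCoset (linear -1ℤ 0ℤ 0ℤ -1ℤ refl done) (cosets 6 1 1 λ _ _ → linear 0ℤ 1ℤ -1ℤ -1ℤ refl tidy))
  ∷ cosets 1 0 2 (trivialCoset (linear -1ℤ 0ℤ 0ℤ -1ℤ refl done) (cosets 6 1 1 λ _ _ → linear 0ℤ 1ℤ -1ℤ -1ℤ refl tidy))
  ∷ replicate 4 tidy

-- The finer sublattices have an orthogonal basis whose norms are the leading coefficients of the
-- product: 6·3 = 18 and 6·117 = 702 here, 6·9 = 54 and 6·39 = 234 in `plans₁`. The map after
-- `cosets` passes to that basis. Each `jac` has two terms, so the product has four.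
plans₂ : List Plan
plans₂ = cosets 2 0 1 (trivialCoset (linear 0ℤ -1ℤ -1ℤ 0ℤ refl done) (cosets 6 0 1 λ _ _ → linear 0ℤ 1ℤ -1ℤ -1ℤ refl tidy))
  ∷ cosets 2 1 1 (trivialCoset (linear 1ℤ 0ℤ -1ℤ -1ℤ refl done) (cosets 6 5 1 λ _ _ → linear 1ℤ (- + 4) -1ℤ (+ 5) refl tidy))
  ∷ replicate 4 tidy

-- The orthogonal norms are 270 = 30·9 = 6·45 and 1170 = 30·39 = 6·195, common to all three products
-- on the right. From 4·270·1170 = 351·60² the total index is 60, that is 2·30. The copies of
-- (9,3,10) are cut differently: one shares 16x²+2xy+22y² with (4,1,22), the other 10x²+6xy+36y²
-- with (10,7,10). The products have 16 + 4 + 16 = 36 terms.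
plans₃ : List Plan
plans₃ = cosets 2 0 1 (trivialCoset (linear -1ℤ 0ℤ 0ℤ -1ℤ refl done) (cosets 30 26 1 λ _ _ → linear 1ℤ (- + 6) -1ℤ (+ 7) refl tidy))
  ∷ cosets 2 1 1 (trivialCoset (linear 1ℤ 0ℤ -1ℤ -1ℤ refl done) (cosets 10 6 3 λ _ _ → linear 1ℤ (- + 2) -1ℤ (+ 3) refl tidy))
  ∷ cosets 2 0 1 (trivialCoset (linear 0ℤ -1ℤ -1ℤ 0ℤ refl done) (cosets 10 2 3 λ _ _ → linear 0ℤ 1ℤ -1ℤ (- + 3) refl tidy))
  ∷ cosets 2 0 1 (trivialCoset (linear 0ℤ 1ℤ -1ℤ -1ℤ refl done) (cosets 6 4 5 λ _ _ → linear 1ℤ 0ℤ -1ℤ 1ℤ refl tidy))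
  ∷ replicate 36 tidy

-- Orthogonal norms 90 = 30·3 and 3510 = 30·117, again of total index 60. Here (4,1,22) shares
-- 4x²+2xy+88y² with (1,1,88) and 16x²+2xy+22y² with (9,3,10).
plans₄ : List Plan
plans₄ = cosets 2 0 1 (trivialCoset (linear -1ℤ 0ℤ 0ℤ -1ℤ refl done) (cosets 30 29 1 λ _ _ → linear 1ℤ 0ℤ -1ℤ 1ℤ refl tidy))
  ∷ cosets 1 0 2 (trivialCoset (linear -1ℤ 0ℤ 0ℤ -1ℤ refl done) (cosets 30 29 1 λ _ _ → linear 1ℤ 0ℤ -1ℤ 1ℤ refl tidy))
  ∷ cosets 2 0 1 (trivialCoset (linear -1ℤ 0ℤ 0ℤ -1ℤ refl done) (cosets 30 2 1 λ _ _ → linear 0ℤ 1ℤ -1ℤ (- + 11) refl tidy))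
  ∷ cosets 2 1 1 (trivialCoset (linear 1ℤ 0ℤ -1ℤ -1ℤ refl done) (cosets 10 8 3 λ _ _ → linear 1ℤ 0ℤ -1ℤ 1ℤ refl tidy))
  ∷ replicate 36 tidy

-- The same two forms of discriminant -39 admit orthogonal sublattices with norms 10 and 390, and in
-- `plans-G₂` with norms 30 and 130. Both have total index 20, as 4·10·390 = 4·30·130 = 39·20².
plans-G₁ : List Plan
plans-G₁ = cosets 2 0 1 (trivialCoset (linear -1ℤ 0ℤ 0ℤ -1ℤ refl done) (cosets 10 0 1 λ _ _ → linear 0ℤ 1ℤ -1ℤ -1ℤ refl tidy))
  ∷ cosets 2 0 1 (trivialCoset (linear 0ℤ 1ℤ -1ℤ -1ℤ refl done) (cosets 10 9 1 λ _ _ → linear 1ℤ (- + 8) -1ℤ (+ 9) refl tidy))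
  ∷ replicate 8 tidy

plans-G₂ : List Plan
plans-G₂ = cosets 2 0 1 (trivialCoset (linear -1ℤ 0ℤ 0ℤ -1ℤ refl done) (cosets 10 2 1 λ _ _ → linear 0ℤ 1ℤ -1ℤ (- + 3) refl tidy))
  ∷ cosets 2 0 1 (trivialCoset (linear 0ℤ 1ℤ -1ℤ -1ℤ refl done) (cosets 10 3 1 λ _ _ → linear 1ℤ 0ℤ (- + 3) 1ℤ refl tidy))
  ∷ replicate 8 tidy

-- On the sublattices of index 2 used here the form is 40(x² + xy + y²), and the rotations of order 6 match the cosets.
plans-quintG : List Plan
plans-quintG = halves (affine 0ℤ -1ℤ 1ℤ (+ 2) 1ℤ (- + 3)) refl (affine 1ℤ 1ℤ -1ℤ (- + 2) (- + 2) (+ 2)) refl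
  ∷ halves (affine 0ℤ -1ℤ 1ℤ (+ 2) 1ℤ (- + 3)) refl (affine 1ℤ 1ℤ -1ℤ (- + 2) (- + 2) (+ 2)) refl
  ∷ halves (affine 1ℤ 0ℤ -1ℤ 1ℤ -1ℤ 0ℤ) refl (affine 0ℤ -1ℤ -1ℤ 1ℤ 0ℤ 0ℤ) refl
  ∷ halves (affine -1ℤ 0ℤ 1ℤ -1ℤ 1ℤ -1ℤ) refl (affine 0ℤ 1ℤ 1ℤ -1ℤ -1ℤ -1ℤ) refl
  ∷ halves (affine 1ℤ 0ℤ -1ℤ 1ℤ -1ℤ 0ℤ) refl (affine 1ℤ 1ℤ -1ℤ (- + 2) (- + 2) (+ 2)) refl
  ∷ halves (affine 0ℤ -1ℤ 1ℤ (+ 2) 1ℤ (- + 3)) refl (affine 1ℤ 1ℤ (- + 2) -1ℤ (- + 2) (+ 2)) refl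
  ∷ halves (affine 1ℤ 0ℤ (- + 2) -1ℤ -1ℤ (+ 2)) refl (affine 0ℤ -1ℤ -1ℤ 1ℤ 0ℤ 0ℤ) refl
  ∷ halves (affine 1ℤ 0ℤ (- + 2) -1ℤ -1ℤ (+ 2)) refl (affine -1ℤ -1ℤ (+ 2) 1ℤ 1ℤ (- + 3)) refl
  ∷ halves (affine 1ℤ 0ℤ -1ℤ 1ℤ -1ℤ 0ℤ) refl (affine 1ℤ 1ℤ -1ℤ (- + 2) (- + 2) (+ 2)) refl
  ∷ halves (affine 0ℤ -1ℤ 1ℤ (+ 2) 1ℤ (- + 3)) refl (affine 1ℤ 1ℤ -1ℤ (- + 2) (- + 2) (+ 2)) refl
  ∷ halves (affine 1ℤ 0ℤ -1ℤ 1ℤ -1ℤ 0ℤ) refl (affine 0ℤ -1ℤ -1ℤ 1ℤ 0ℤ 0ℤ) refl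
  ∷ halves (affine 1ℤ 0ℤ (- + 2) -1ℤ -1ℤ (+ 2)) refl (affine -1ℤ -1ℤ (+ 2) 1ℤ 1ℤ (- + 3)) refl
  ∷ []

plans-quintH : List Plan
plans-quintH = halves (affine 1ℤ 0ℤ -1ℤ 1ℤ -1ℤ 0ℤ) refl (affine 1ℤ 1ℤ -1ℤ (- + 2) (- + 2) (+ 2)) refl
  ∷ halves (affine 0ℤ -1ℤ 1ℤ (+ 2) 1ℤ (- + 3)) refl (affine 1ℤ 1ℤ -1ℤ (- + 2) (- + 2) (+ 2)) refl
  ∷ halves (affine 1ℤ 0ℤ -1ℤ 1ℤ -1ℤ 0ℤ) refl (affine 0ℤ -1ℤ -1ℤ 1ℤ 0ℤ 0ℤ) refl
  ∷ halves (affine 1ℤ 0ℤ (- + 2) -1ℤ -1ℤ (+ 2)) refl (affine -1ℤ -1ℤ (+ 2) 1ℤ 1ℤ (- + 3)) refl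
  ∷ halves (affine 1ℤ 0ℤ -1ℤ 1ℤ -1ℤ 0ℤ) refl (affine 1ℤ 1ℤ -1ℤ (- + 2) (- + 2) (+ 2)) refl
  ∷ halves (affine -1ℤ 0ℤ (+ 2) 1ℤ 1ℤ (- + 3)) refl (affine 1ℤ 1ℤ (- + 2) -1ℤ (- + 2) (+ 2)) refl
  ∷ halves (affine 0ℤ 1ℤ -1ℤ (- + 2) -1ℤ (+ 2)) refl (affine 0ℤ -1ℤ -1ℤ 1ℤ 0ℤ 0ℤ) refl
  ∷ halves (affine 1ℤ 0ℤ (- + 2) -1ℤ -1ℤ (+ 2)) refl (affine -1ℤ -1ℤ (+ 2) 1ℤ 1ℤ (- + 3)) refl
  ∷ halves (affine -1ℤ 0ℤ (+ 2) 1ℤ 1ℤ (- + 3)) refl (affine 1ℤ 1ℤ -1ℤ (- + 2) (- + 2) (+ 2)) refl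
  ∷ halves (affine 0ℤ -1ℤ 1ℤ (+ 2) 1ℤ (- + 3)) refl (affine 1ℤ 1ℤ -1ℤ (- + 2) (- + 2) (+ 2)) refl
  ∷ halves (affine 1ℤ 0ℤ -1ℤ 1ℤ -1ℤ 0ℤ) refl (affine 0ℤ -1ℤ -1ℤ 1ℤ 0ℤ 0ℤ) refl
  ∷ halves (affine -1ℤ 0ℤ 1ℤ -1ℤ 1ℤ -1ℤ) refl (affine -1ℤ -1ℤ (+ 2) 1ℤ 1ℤ (- + 3)) refl
  ∷ []

-- Series together with their expansions

-- Indexed by the series, so that an expression in the operations below builds the expansion and its
-- proof at once, in the shape of the series itself.
record QRep (f : PS) : Set where
  constructor _,_
  field
    comb : QComb
    sums : QSums comb f

record LRep (f : PS) : Set where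
  constructor _,_
  field
    comb : LComb
    sums : LSums comb f

infixl 6 _⊕ʳ_ _⊟ʳ_ _⊕ˡ_ _⊟ˡ_
infixr 8 _·ʳ_ _⇑_ _↑_
infixl 7 _⊗ʳ_

_⊕ʳ_ : ∀ {f g} → QRep f → QRep g → QRep (f ⊕ g)
(L , S) ⊕ʳ (M , T) = _ , QuadComb.Sums-++ L M S T

_⊟ʳ_ : ∀ {f g} → QRep f → QRep g → QRep (f ⊟ g)
(L , S) ⊟ʳ (M , T) = _ , QuadComb.Sums-⊟ L M S T

_·ʳ_ : ∀ c {f} → QRep f → QRep (cst c ⊛ f)
c ·ʳ (L , S) = _ , QuadComb.Sums-scale c L S

_⊗ʳ_ : ∀ {f g} → LRep f → LRep g → QRep (f ⊛ g)
(L , S) ⊗ʳ (M , T) = _ , Sums-⊗ L M S T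

_⊕ˡ_ : ∀ {f g} → LRep f → LRep g → LRep (f ⊕ g)
(L , S) ⊕ˡ (M , T) = _ , LinComb.Sums-++ L M S T

_⊟ˡ_ : ∀ {f g} → LRep f → LRep g → LRep (f ⊟ g)
(L , S) ⊟ˡ (M , T) = _ , LinComb.Sums-⊟ L M S T

_⇑_ : ∀ k .{{_ : NonZero k}} {f} → LRep f → LRep (dilate k f)
k ⇑ (L , S) = _ , Sums-dilate k L S

_↑_ : ∀ m {f} → LRep f → LRep (mono m ⊛ f)
m ↑ (L , S) = _ , Sums-shift m L S

jacR : ∀ a b .{{_ : NonZero a}} .{{_ : NonZero b}} → LRep (jac a b)
jacR a b = jacL a b , jac-sums a b

thetaR : ∀ a b c {_ : True (1ℤ ℤ.≤? a)} {_ : True (1ℤ ℤ.≤? c)} {_ : True (1ℤ ℤ.≤? (+ 4) * a * c - b * b)} → QRep (theta a b c)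
thetaR a b c {p} {q} {r} = (1ℤ , quad a b c 0ℤ 0ℤ 0ℤ) ∷ [] , QuadComb.Sums-single (quad a b c 0ℤ 0ℤ 0ℤ) (theta-series a b c (toWitness p) (toWitness q) (toWitness r))

-- For a concrete `R` the last hypothesis is closed by `refl`: type checking runs the plans and
-- cancels the parts.
certified : ∀ Ps {f} (R : QRep f) → vanishes (collect (refine Ps (QRep.comb R))) ≡ true → f ≋ zeroPS
certified Ps (L , S) e = certify Ps L e S

difference : ∀ f g → f ⊟ g ≋ zeroPS → f ≋ g
difference f g p .at n = ℤₚ.i-j≡0⇒i≡j (f n) (g n) (trans (p .at n) (cst-0 n))

-- quintG and quintH are E·G² and E·H² as given by the quintuple product (q⁵;q⁵)θ(z²;q⁵)/θ(−z;q⁵) at z = −q and z = −q².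
jacEG jacEH jacE quintG quintH : PS
jacE = jac 2 1
jacEG = jac 3 2
jacEH = jac 4 1
quintG = jac 8 7 ⊕ mono 1 ⊛ jac 13 2
quintH = jac 11 4 ⊟ mono 1 ⊛ jac 14 1

jacEG-rep : LRep jacEG
jacEG-rep = jacR 3 2

jacEH-rep : LRep jacEH
jacEH-rep = jacR 4 1

jacE-rep : LRep jacE
jacE-rep = jacR 2 1

quintG-rep : LRep quintG
quintG-rep = jacR 8 7 ⊕ˡ 1 ↑ jacR 13 2

quintH-rep : LRep quintH
quintH-rep = jacR 11 4 ⊟ˡ 1 ↑ jacR 14 1

-- The types of these expansions are left to inference, which reads the series off the expression.
rep-quintG = quintG-rep ⊗ʳ jacEH-rep ⊟ʳ (5 ⇑ jacE-rep) ⊗ʳ jacEG-rep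

rep-quintH = quintH-rep ⊗ʳ jacEG-rep ⊟ʳ (5 ⇑ jacE-rep) ⊗ʳ jacEH-rep

rep₁ = thetaR (+ 2) (+ 1) (+ 44) ⊟ʳ thetaR (+ 8) (+ 1) (+ 11) ⊟ʳ (+ 2) ·ʳ ((2 ↑ 9 ⇑ jacE-rep) ⊗ʳ (39 ⇑ jacE-rep))

rep₂ = thetaR (+ 5) (+ 3) (+ 18) ⊟ʳ thetaR (+ 8) (+ 1) (+ 11) ⊟ʳ (+ 2) ·ʳ ((5 ↑ 3 ⇑ jacE-rep) ⊗ʳ (117 ⇑ jacE-rep))

rep₃ = thetaR (+ 4) (+ 1) (+ 22) ⊟ʳ thetaR (+ 9) (+ 3) (+ 10) ⊕ʳ (thetaR (+ 9) (+ 3) (+ 10) ⊟ʳ thetaR (+ 10) (+ 7) (+ 10)) ⊟ʳ (+ 2) ·ʳ ((4 ↑ 9 ⇑ quintH-rep) ⊗ʳ (39 ⇑ quintG-rep) ⊟ʳ (+ 2) ·ʳ ((10 ↑ 45 ⇑ jacE-rep) ⊗ʳ (195 ⇑ jacE-rep)) ⊕ʳ (16 ↑ 9 ⇑ quintG-rep) ⊗ʳ (39 ⇑ quintH-rep))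

rep₄ = thetaR (+ 1) (+ 1) (+ 88) ⊟ʳ thetaR (+ 4) (+ 1) (+ 22) ⊕ʳ (thetaR (+ 4) (+ 1) (+ 22) ⊟ʳ thetaR (+ 9) (+ 3) (+ 10)) ⊟ʳ (+ 2) ·ʳ ((1 ↑ 3 ⇑ quintG-rep) ⊗ʳ (117 ⇑ quintG-rep) ⊕ʳ (+ 2) ·ʳ ((25 ↑ 15 ⇑ jacE-rep) ⊗ʳ (585 ⇑ jacE-rep)) ⊕ʳ (49 ↑ 3 ⇑ quintH-rep) ⊗ʳ (117 ⇑ quintH-rep))

rep-G₁ = thetaR (+ 1) (+ 1) (+ 10) ⊟ʳ thetaR (+ 3) (+ 3) (+ 4) ⊟ʳ (+ 2) ·ʳ ((1 ↑ jacEG-rep) ⊗ʳ (39 ⇑ jacEG-rep) ⊕ʳ (9 ↑ jacEH-rep) ⊗ʳ (39 ⇑ jacEH-rep))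

rep-G₂ = thetaR (+ 1) (+ 1) (+ 10) ⊟ʳ thetaR (+ 3) (+ 3) (+ 4) ⊟ʳ (+ 2) ·ʳ ((1 ↑ 3 ⇑ jacEH-rep) ⊗ʳ (13 ⇑ jacEG-rep) ⊟ʳ (3 ↑ 3 ⇑ jacEG-rep) ⊗ʳ (13 ⇑ jacEH-rep))

-- The quintuple product with its denominator cleared: both sides are products of two one-variable
-- series and fall under the certificates.
quintG-quotient : quintG ⊛ jacEH ≋ dilate 5 jacE ⊛ jacEG
quintG-quotient = difference _ _ (certified plans-quintG rep-quintG refl)

quintH-quotient : quintH ⊛ jacEG ≋ dilate 5 jacE ⊛ jacEH
quintH-quotient = difference _ _ (certified plans-quintH rep-quintH refl)

theta₁ : theta (+ 2) (+ 1) (+ 44) ⊟ theta (+ 8) (+ 1) (+ 11) ≋ cst (+ 2) ⊛ (mono 2 ⊛ dilate 9 jacE ⊛ dilate 39 jacE)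
theta₁ = difference _ _ (certified plans₁ rep₁ refl)

theta₂ : theta (+ 5) (+ 3) (+ 18) ⊟ theta (+ 8) (+ 1) (+ 11) ≋ cst (+ 2) ⊛ (mono 5 ⊛ dilate 3 jacE ⊛ dilate 117 jacE)
theta₂ = difference _ _ (certified plans₂ rep₂ refl)

insert-middle : ∀ f g h → f ⊟ h ≋ (f ⊟ g) ⊕ (g ⊟ h)
insert-middle f g h .at n = arith (f n) (g n) (h n)
  where
  arith : ∀ x y z → x - z ≡ (x - y) + (y - z)
  arith = solve-∀

-- The three products are those in the expansion of U(3,13,q³)²; `jacE` dilated by 45 and by 195
-- stands for E·G·H at q⁹ and at q³⁹.
theta₃ : theta (+ 4) (+ 1) (+ 22) ⊟ theta (+ 10) (+ 7) (+ 10) ≋ cst (+ 2) ⊛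
  (mono 4 ⊛ dilate 9 quintH ⊛ dilate 39 quintG ⊟ cst (+ 2) ⊛ (mono 10 ⊛ dilate 45 jacE ⊛ dilate 195 jacE) ⊕ mono 16 ⊛ dilate 9 quintG ⊛ dilate 39 quintH)
theta₃ = ≋-trans (insert-middle (theta (+ 4) (+ 1) (+ 22)) (theta (+ 9) (+ 3) (+ 10)) (theta (+ 10) (+ 7) (+ 10)))
  (difference (theta (+ 4) (+ 1) (+ 22) ⊟ theta (+ 9) (+ 3) (+ 10) ⊕ (theta (+ 9) (+ 3) (+ 10) ⊟ theta (+ 10) (+ 7) (+ 10))) _ (certified plans₃ rep₃ refl))

theta₄ : theta (+ 1) (+ 1) (+ 88) ⊟ theta (+ 9) (+ 3) (+ 10) ≋ cst (+ 2) ⊛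
  (mono 1 ⊛ dilate 3 quintG ⊛ dilate 117 quintG ⊕ cst (+ 2) ⊛ (mono 25 ⊛ dilate 15 jacE ⊛ dilate 585 jacE) ⊕ mono 49 ⊛ dilate 3 quintH ⊛ dilate 117 quintH)
theta₄ = ≋-trans (insert-middle (theta (+ 1) (+ 1) (+ 88)) (theta (+ 4) (+ 1) (+ 22)) (theta (+ 9) (+ 3) (+ 10)))
  (difference (theta (+ 1) (+ 1) (+ 88) ⊟ theta (+ 4) (+ 1) (+ 22) ⊕ (theta (+ 4) (+ 1) (+ 22) ⊟ theta (+ 9) (+ 3) (+ 10))) _ (certified plans₄ rep₄ refl))

-- The two sides involve different diagonal forms and are compared through the difference of
-- (1,1,10) and (3,3,4), which equals both.
theta-39 : cst (+ 2) ⊛ (mono 1 ⊛ jacEG ⊛ dilate 39 jacEG ⊕ mono 9 ⊛ jacEH ⊛ dilate 39 jacEH)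
         ≋ cst (+ 2) ⊛ (mono 1 ⊛ dilate 3 jacEH ⊛ dilate 13 jacEG ⊟ mono 3 ⊛ dilate 3 jacEG ⊛ dilate 13 jacEH)
theta-39 = ≋-trans {g = theta (+ 1) (+ 1) (+ 10) ⊟ theta (+ 3) (+ 3) (+ 4)}
  (≋-sym (difference _ _ (certified plans-G₁ rep-G₁ refl)))
  (difference _ _ (certified plans-G₂ rep-G₂ refl))

-- Stated over an arbitrary ring, so that the solver does not unfold the operations on power series.
module RingIdentities (A : AlmostCommutativeRing 0ℓ 0ℓ) (φ : CommutativeRing.rawRing ℤₚ.+-*-commutativeRing -Raw-AlmostCommutative⟶ A) where
  open AlmostCommutativeRing A using (Carrier; _≈_) renaming (_+_ to _⊞_; _*_ to _⊠_; -_ to ⊟_; refl to ≈-reflexive)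
  open _-Raw-AlmostCommutative⟶_ φ using () renaming (⟦_⟧ to ι)

  decide : WeaklyDecidable (Induced-equivalence φ)
  decide c d with c ℤ.≟ d
  ... | yes refl = just ≈-reflexive
  ... | no _     = nothing

  open Algebra.Solver.Ring (CommutativeRing.rawRing ℤₚ.+-*-commutativeRing) A φ decide

  private
    infixl 6 _∔_ _∸_
    infixl 7 _·_
    _∔_ _∸_ _·_ : Carrier → Carrier → Carrier
    x ∔ y = x ⊞ y
    x ∸ y = x ⊞ (⊟ y)
    x · y = x ⊠ y
    𝟙 : Carrier
    𝟙 = ι 1ℤ
    𝟏 : ∀ {n} → Polynomial n
    𝟏 = con 1ℤ

  -- To be read with y = qⁿ, z = q^{K+1}, e = `rsign (suc K) n` and p = `rising K n`. The trailing
  -- units come from folding lists of exponents with `one` at the end.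
  rogers-step : ∀ e p y q z →
    e · (𝟙 ∸ z · (y · (y · 𝟙))) · p ∸ e · (y · (y · 𝟙)) · (𝟙 ∸ q · (z · (y · (y · 𝟙)))) · (p · (𝟙 ∸ y · z))
      ∸ q · z · (e · (y · (y · (y · (y · 𝟙)))) · (𝟙 ∸ q · (q · (z · (y · (y · 𝟙))))) · (p · (𝟙 ∸ y · z) · (𝟙 ∸ y · (q · z))))
    ≈ e · p · (𝟙 ∸ y) · (𝟙 ∔ y ∸ z · y · y)
      ∸ ⊟ (e · (y · (y · (y · (y · (y · (q · (q · (z · (z · 𝟙)))))))))) · (p · (𝟙 ∸ y · z)) · (𝟙 ∔ q · y ∸ z · (q · y) · (q · y))
  rogers-step = solve 5 (λ e p y q z →
    e :* (𝟏 :- z :* (y :* (y :* 𝟏))) :* p :- e :* (y :* (y :* 𝟏)) :* (𝟏 :- q :* (z :* (y :* (y :* 𝟏)))) :* (p :* (𝟏 :- y :* z))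
      :- q :* z :* (e :* (y :* (y :* (y :* (y :* 𝟏)))) :* (𝟏 :- q :* (q :* (z :* (y :* (y :* 𝟏))))) :* (p :* (𝟏 :- y :* z) :* (𝟏 :- y :* (q :* z))))
    := e :* p :* (𝟏 :- y) :* (𝟏 :+ y :- z :* y :* y)
      :- :- (e :* (y :* (y :* (y :* (y :* (y :* (q :* (q :* (z :* (z :* 𝟏)))))))))) :* (p :* (𝟏 :- y :* z)) :* (𝟏 :+ q :* y :- z :* (q :* y) :* (q :* y)))
    ≈-reflexive

  -- The counterpart for k = 0, where the first two products are the terms of `jac 3 2` with indices
  -- n and -1-n.
  rogers-step₀ : ∀ e y q →
    e · (y · 𝟙) ∸ e · (y · (y · (y · (y · (y · (q · (q · 𝟙))))))) ∸ e · (y · (y · 𝟙)) · (𝟙 ∸ q · (y · (y · 𝟙))) · 𝟙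
      ∸ q · (e · (y · (y · (y · (y · 𝟙)))) · (𝟙 ∸ q · (q · (y · (y · 𝟙)))) · (𝟙 · (𝟙 ∸ y · q)))
    ≈ e · (y ∸ y · y) ∸ ⊟ (e · (y · (y · (y · (y · (y · (q · (q · 𝟙)))))))) · (q · y ∸ q · y · (q · y))
  rogers-step₀ = solve 3 (λ e y q →
    e :* (y :* 𝟏) :- e :* (y :* (y :* (y :* (y :* (y :* (q :* (q :* 𝟏))))))) :- e :* (y :* (y :* 𝟏)) :* (𝟏 :- q :* (y :* (y :* 𝟏))) :* 𝟏
      :- q :* (e :* (y :* (y :* (y :* (y :* 𝟏)))) :* (𝟏 :- q :* (q :* (y :* (y :* 𝟏)))) :* (𝟏 :* (𝟏 :- y :* q)))
    := e :* (y :- y :* y) :- :- (e :* (y :* (y :* (y :* (y :* (y :* (q :* (q :* 𝟏)))))))) :* (q :* y :- q :* y :* (q :* y)))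
    ≈-reflexive

  *-rotate : ∀ a b c → a · b · c ≈ a · (c · b)
  *-rotate = solve 3 (λ a b c → a :* b :* c := a :* (c :* b)) ≈-reflexive

  neg-*ˡ : ∀ a b → ⊟ a · b ≈ ⊟ (a · b)
  neg-*ˡ = solve 2 (λ a b → :- a :* b := :- (a :* b)) ≈-reflexive

  vanish-*ʳ : ∀ a b → a · (𝟙 ∸ 𝟙) · b ≈ ι 0ℤ
  vanish-*ʳ = solve 2 (λ a b → a :* (𝟏 :- 𝟏) :* b := con 0ℤ) ≈-reflexive

  telescope-sum : ∀ x y z → x ≈ y ∔ z ∔ (x ∸ y ∸ z)
  telescope-sum = solve 3 (λ x y z → x := y :+ z :+ (x :- y :- z)) ≈-reflexive

  expand : ∀ x g → (𝟙 ∸ x) · (𝟙 ∔ x · g) ≈ 𝟙 ∔ x · (g ∸ (𝟙 ∔ x · g))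
  expand = solve 2 (λ x g → (𝟏 :- x) :* (𝟏 :+ x :* g) := 𝟏 :+ x :* (g :- (𝟏 :+ x :* g))) ≈-reflexive

  cancel-self : ∀ x → x ∸ x ≈ ι 0ℤ
  cancel-self = solve 1 (λ x → x :- x := con 0ℤ) ≈-reflexive

  factor : ∀ x y i g → x · (i · g) ∸ x · y · (i · g) ≈ x · i · ((𝟙 ∸ y) · g)
  factor = solve 4 (λ x y i g → x :* (i :* g) :- x :* y :* (i :* g) := x :* i :* ((𝟏 :- y) :* g)) ≈-reflexive

  add-sub : ∀ x y → x ≈ y ∔ (x ∸ y)
  add-sub = solve 2 (λ x y → x := y :+ (x :- y)) ≈-reflexive

  e·[a+m·b] : ∀ e a m b → e · (a ∔ m · b) ≈ e · a ∔ m · (e · b)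
  e·[a+m·b] = solve 4 (λ e a m b → e :* (a :+ m :* b) := e :* a :+ m :* (e :* b)) ≈-reflexive

  jac-factor : ∀ c m x → c · (m ∸ m · x) ≈ c · m · (𝟙 ∸ x) · 𝟙
  jac-factor = solve 3 (λ c m x → c :* (m :- m :* x) := c :* m :* (𝟏 :- x) :* 𝟏) ≈-reflexive

  distribˡ-∸ : ∀ c x y → c · (x ∸ y) ≈ c · x ∸ c · y
  distribˡ-∸ = solve 3 (λ c x y → c :* (x :- y) := c :* x :- c :* y) ≈-reflexive

  vanish₂ : ∀ a → a · (𝟙 ∸ 𝟙 · 𝟙) ≈ ι 0ℤ
  vanish₂ = solve 1 (λ a → a :* (𝟏 :- 𝟏 :* 𝟏) := con 0ℤ) ≈-reflexive

  unit-rearrange : ∀ x p → 𝟙 · 𝟙 · x · p ≈ p · x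
  unit-rearrange = solve 2 (λ x p → 𝟏 :* 𝟏 :* x :* p := p :* x) ≈-reflexive

  qb-step : ∀ A B m Pᵢ x Pⱼ → (A ∔ m · B) · (Pᵢ · (𝟙 ∸ x)) · (Pⱼ · (𝟙 ∸ m))
    ≈ A · (Pᵢ · (𝟙 ∸ x)) · Pⱼ · (𝟙 ∸ m) ∔ m · (B · Pᵢ · (Pⱼ · (𝟙 ∸ m)) · (𝟙 ∸ x))
  qb-step = solve 6 (λ A B m Pᵢ x Pⱼ → (A :+ m :* B) :* (Pᵢ :* (𝟏 :- x)) :* (Pⱼ :* (𝟏 :- m))
    := A :* (Pᵢ :* (𝟏 :- x)) :* Pⱼ :* (𝟏 :- m) :+ m :* (B :* Pᵢ :* (Pⱼ :* (𝟏 :- m)) :* (𝟏 :- x))) ≈-reflexive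

  qb-merge : ∀ S m x → S · (𝟙 ∸ m) ∔ m · (S · (𝟙 ∸ x)) ≈ S · (𝟙 ∸ m · x)
  qb-merge = solve 3 (λ S m x → S :* (𝟏 :- m) :+ m :* (S :* (𝟏 :- x)) := S :* (𝟏 :- m :* x)) ≈-reflexive

  unit-leftˡ : ∀ p → 𝟙 · 𝟙 · p ≈ p
  unit-leftˡ = solve 1 (λ p → 𝟏 :* 𝟏 :* p := p) ≈-reflexive

  unit-middle : ∀ p → 𝟙 · p · 𝟙 ≈ p
  unit-middle = solve 1 (λ p → 𝟏 :* p :* 𝟏 := p) ≈-reflexive

  pascal-term : ∀ s t Q A B Xi X Yj Y q → ⊟ s · (t · Q) · (A ∔ q · Q · B) · (X · Xi) · (Y · Yj)
    ≈ X · (⊟ s · (t · Q) · B · Xi · (q · Q · (Y · Yj))) ∔ ⊟ (Y · (s · t · A · (X · Xi) · (Q · Yj)))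
  pascal-term = solve 10 (λ s t Q A B Xi X Yj Y q → :- s :* (t :* Q) :* (A :+ q :* Q :* B) :* (X :* Xi) :* (Y :* Yj)
    := X :* (:- s :* (t :* Q) :* B :* Xi :* (q :* Q :* (Y :* Yj))) :+ :- (Y :* (s :* t :* A :* (X :* Xi) :* (Q :* Yj)))) ≈-reflexive

  pascal-left : ∀ c X Xi → c · 𝟙 · (X · Xi) · 𝟙 ≈ X · (c · 𝟙 · Xi · 𝟙)
  pascal-left = solve 3 (λ c X Xi → c :* 𝟏 :* (X :* Xi) :* 𝟏 := X :* (c :* 𝟏 :* Xi :* 𝟏)) ≈-reflexive

  pascal-right : ∀ s t Q Y Yj → ⊟ s · (t · Q) · 𝟙 · 𝟙 · (Y · Yj) ≈ ⊟ (Y · (s · t · 𝟙 · 𝟙 · (Q · Yj)))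
  pascal-right = solve 5 (λ s t Q Y Yj → :- s :* (t :* Q) :* 𝟏 :* 𝟏 :* (Y :* Yj) := :- (Y :* (s :* t :* 𝟏 :* 𝟏 :* (Q :* Yj)))) ≈-reflexive

  distribʳ-∸ : ∀ x y s → (x ∸ y) · s ≈ x · s ∔ ⊟ (y · s)
  distribʳ-∸ = solve 3 (λ x y s → (x :- y) :* s := x :* s :+ :- (y :* s)) ≈-reflexive

  scale-pair : ∀ c X Y p b → (c · X ∸ c · Y) · (p · b) ≈ c · p · ((X ∸ Y) · b)
  scale-pair = solve 5 (λ c X Y p b → (c :* X :- c :* Y) :* (p :* b) := c :* p :* ((X :- Y) :* b)) ≈-reflexive

  reflect-factor : ∀ a x c s t F → (a · x ∸ a) · (c · (s · t · F)) ≈ ⊟ s · (t · (c · a)) · (F · (𝟙 ∸ x))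
  reflect-factor = solve 6 (λ a x c s t F → (a :* x :- a) :* (c :* (s :* t :* F)) := :- s :* (t :* (c :* a)) :* (F :* (𝟏 :- x))) ≈-reflexive

  regroup₄ : ∀ s t F p F′ → s · t · F · (p · F′) ≈ s · (t · p · (F · F′))
  regroup₄ = solve 5 (λ s t F p F′ → s :* t :* F :* (p :* F′) := s :* (t :* p :* (F :* F′))) ≈-reflexive

  gather-monos : ∀ s t q x y → s · t · q · x · y ≈ s · (t · x · y) · q
  gather-monos = solve 5 (λ s t q x y → s :* t :* q :* x :* y := s :* (t :* x :* y) :* q) ≈-reflexive

  split-constant : ∀ s r c t q → s · r · (c · t) · q ≈ s · (c · (r · t · q))
  split-constant = solve 5 (λ s r c t q → s :* r :* (c :* t) :* q := s :* (c :* (r :* t :* q))) ≈-reflexive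

  regroup : ∀ a b y p → a · b · (y · p) ≈ a · y · (b · p)
  regroup = solve 4 (λ a b y p → a :* b :* (y :* p) := a :* y :* (b :* p)) ≈-reflexive

  signed-pair : ∀ c x y → c · (x ∸ y) ≈ c · x ∔ ⊟ c · y
  signed-pair = solve 3 (λ c x y → c :* (x :- y) := c :* x :+ :- c :* y) ≈-reflexive

  merge₃ : ∀ P F G x y z → P · z · (F · x · (G · y)) ≈ P · (F · G) · x · y · z
  merge₃ = solve 6 (λ P F G x y z → P :* z :* (F :* x :* (G :* y)) := P :* (F :* G) :* x :* y :* z) ≈-reflexive

  merge₅ : ∀ P F₁ F₂ F₃ F₄ x y z u v → P · v · (F₂ · y · (F₃ · z) · (F₁ · x · (F₄ · u))) ≈ P · (F₂ · F₃ · (F₁ · F₄)) · x · y · z · u · v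
  merge₅ = solve 10 (λ P F₁ F₂ F₃ F₄ x y z u v →
    P :* v :* (F₂ :* y :* (F₃ :* z) :* (F₁ :* x :* (F₄ :* u))) := P :* (F₂ :* F₃ :* (F₁ :* F₄)) :* x :* y :* z :* u :* v) ≈-reflexive

  pair-products : ∀ e f g → e · f · (e · g) ≈ e · (e · (f · g))
  pair-products = solve 3 (λ e f g → e :* f :* (e :* g) := e :* (e :* (f :* g))) ≈-reflexive

  rotate₃ : ∀ a b c → a · (b · c) ≈ b · (c · a)
  rotate₃ = solve 3 (λ a b c → a :* (b :* c) := b :* (c :* a)) ≈-reflexive

  square-factor : ∀ e g h → e · g · (e · h) ≈ e · (e · g · h)
  square-factor = solve 3 (λ e g h → e :* g :* (e :* h) := e :* (e :* g :* h)) ≈-reflexive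

  -- The factors e and e′ are distributed so that the left side contains only E·G², E·G·H and E·H²
  -- at two arguments, each of them a one-variable theta series.
  U₂-square : ∀ c m n e e′ g g′ h h′ →
    c · (m · (e · h · h) · (e′ · g′ · g′) ∸ ι (+ 2) · (m · n · (e · g · h) · (e′ · g′ · h′)) ∔ m · (n · n) · (e · g · g) · (e′ · h′ · h′))
    ≈ c · m · e · e′ · ((h · g′ ∸ n · (g · h′)) · (h · g′ ∸ n · (g · h′)))
  U₂-square = solve 9 (λ c m n e e′ g g′ h h′ →
    c :* (m :* (e :* h :* h) :* (e′ :* g′ :* g′) :- con (+ 2) :* (m :* n :* (e :* g :* h) :* (e′ :* g′ :* h′)) :+ m :* (n :* n) :* (e :* g :* g) :* (e′ :* h′ :* h′))
    := c :* m :* e :* e′ :* ((h :* g′ :- n :* (g :* h′)) :* (h :* g′ :- n :* (g :* h′)))) ≈-reflexive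

  U₁-square : ∀ c m n e e′ g g′ h h′ →
    c · (m · (e · g · g) · (e′ · g′ · g′) ∔ ι (+ 2) · (m · n · (e · g · h) · (e′ · g′ · h′)) ∔ m · (n · n) · (e · h · h) · (e′ · h′ · h′))
    ≈ c · m · e · e′ · ((g · g′ ∔ n · (h · h′)) · (g · g′ ∔ n · (h · h′)))
  U₁-square = solve 9 (λ c m n e e′ g g′ h h′ →
    c :* (m :* (e :* g :* g) :* (e′ :* g′ :* g′) :+ con (+ 2) :* (m :* n :* (e :* g :* h) :* (e′ :* g′ :* h′)) :+ m :* (n :* n) :* (e :* h :* h) :* (e′ :* h′ :* h′))
    := c :* m :* e :* e′ :* ((g :* g′ :+ n :* (h :* h′)) :* (g :* g′ :+ n :* (h :* h′)))) ≈-reflexive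

  U₁-linear : ∀ m n e e′ g g′ h h′ →
    m · (e · g) · (e′ · g′) ∔ m · n · (e · h) · (e′ · h′) ≈ m · (e · e′ · (g · g′ ∔ n · (h · h′)))
  U₁-linear = solve 8 (λ m n e e′ g g′ h h′ →
    m :* (e :* g) :* (e′ :* g′) :+ m :* n :* (e :* h) :* (e′ :* h′) := m :* (e :* e′ :* (g :* g′ :+ n :* (h :* h′)))) ≈-reflexive

  U₂-linear : ∀ m n e e′ g g′ h h′ →
    m · (e · h) · (e′ · g′) ∸ m · n · (e · g) · (e′ · h′) ≈ m · (e · e′ · (h · g′ ∸ n · (g · h′)))
  U₂-linear = solve 8 (λ m n e e′ g g′ h h′ →
    m :* (e :* h) :* (e′ :* g′) :- m :* n :* (e :* g) :* (e′ :* h′) := m :* (e :* e′ :* (h :* g′ :- n :* (g :* h′)))) ≈-reflexive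

  *-assoc₄ : ∀ a b c d → a · (b · c · d) ≈ a · b · c · d
  *-assoc₄ = solve 4 (λ a b c d → a :* (b :* c :* d) := a :* b :* c :* d) ≈-reflexive

  gather-left : ∀ c m m′ e e′ u → c · m · e · e′ · (u · u) · (c · m′ · e · e′) ≈ c · c · (m · m′) · (e · e′ · u · (e · e′ · u))
  gather-left = solve 6 (λ c m m′ e e′ u → c :* m :* e :* e′ :* (u :* u) :* (c :* m′ :* e :* e′) := c :* c :* (m :* m′) :* (e :* e′ :* u :* (e :* e′ :* u))) ≈-reflexive

  gather-right : ∀ c m m′ e e′ u → c · m · e · e′ · (c · m′ · e · e′ · (u · u)) ≈ c · c · (m · m′) · (e · e′ · u · (e · e′ · u))
  gather-right = solve 6 (λ c m m′ e e′ u → c :* m :* e :* e′ :* (c :* m′ :* e :* e′ :* (u :* u)) := c :* c :* (m :* m′) :* (e :* e′ :* u :* (e :* e′ :* u))) ≈-reflexive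

  cross-ratio : ∀ c m m′ e e′ f f′ → c · (m · m′) · e · e′ · (f · f′) ≈ m · (e · e′) · (c · m′ · f · f′)
  cross-ratio = solve 7 (λ c m m′ e e′ f f′ → c :* (m :* m′) :* e :* e′ :* (f :* f′) := m :* (e :* e′) :* (c :* m′ :* f :* f′)) ≈-reflexive

  rotate₂ : ∀ e g → e · (e · g) ≈ g · e · e
  rotate₂ = solve 2 (λ e g → e :* (e :* g) := g :* e :* e) ≈-reflexive

  *-swap : ∀ a b c → a · (b · c) ≈ b · (a · c)
  *-swap = solve 3 (λ a b c → a :* (b :* c) := b :* (a :* c)) ≈-reflexive

  +-rearrange : ∀ v x y z → v ∔ x ∔ (y ∔ z) ≈ v ∔ (y ∔ x) ∔ z
  +-rearrange = solve 4 (λ v x y z → v :+ x :+ (y :+ z) := v :+ (y :+ x) :+ z) ≈-reflexive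

open RingIdentities PS-almostRing cst-homomorphism

-- The Rogers–Ramanujan identities

-- Exponents are written as lists of summands, so that a power of q becomes a product of the few
-- atoms that the ring solver treats as variables.
mono-sum : ∀ ms → mono (sum ms) ≋ foldr (λ m f → mono m ⊛ f) one ms
mono-sum []       = mono-0
mono-sum (m ∷ ms) = ≋-trans (mono-+ m (sum ms)) (⊛-congˡ (mono m) (mono-sum ms))

psum : (ℕ → PS) → ℕ → PS
psum t zero    = t 0
psum t (suc M) = psum t M ⊕ t (suc M)

psum-at : ∀ t M n → psum t M n ≡ sumTo (λ i → t i n) M
psum-at t zero    n = refl
psum-at t (suc M) n = cong (_+ t (suc M) n) (psum-at t M n)

psum-cong : ∀ {t u} → (∀ n → t n ≋ u n) → ∀ M → psum t M ≋ psum u M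
psum-cong p zero    = p 0
psum-cong p (suc M) = ⊕-cong (psum-cong p M) (p (suc M))

psum-⊟ : ∀ t u M → psum (λ n → t n ⊟ u n) M ≋ psum t M ⊟ psum u M
psum-⊟ t u zero    = ≋-refl
psum-⊟ t u (suc M) .at n = trans (cong (_+ (t (suc M) n - u (suc M) n)) (psum-⊟ t u M .at n)) (arith (psum t M n) (psum u M n) (t (suc M) n) (u (suc M) n))
  where
  arith : ∀ a b c d → a - b + (c - d) ≡ a + c - (b + d)
  arith = solve-∀

psum-⊛ : ∀ f t M → psum (λ n → f ⊛ t n) M ≋ f ⊛ psum t M
psum-⊛ f t zero    = ≋-refl
psum-⊛ f t (suc M) = ≋-trans (⊕-congʳ (f ⊛ t (suc M)) (psum-⊛ f t M)) (≋-sym (⊛-distribˡ f (psum t M) (t (suc M))))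

psum-head : ∀ t M → psum t (suc M) ≋ t 0 ⊕ psum (λ n → t (suc n)) M
psum-head t M .at n = trans (psum-at t (suc M) n) (trans (sumTo-head (λ i → t i n) M) (cong (λ x → t 0 n + x) (sym (psum-at (λ i → t (suc i)) M n))))

psum-telescope : ∀ (w : ℕ → PS) M → psum (λ n → w n ⊟ w (suc n)) M ≋ w 0 ⊟ w (suc M)
psum-telescope w zero    = ≋-refl
psum-telescope w (suc M) .at n = trans (cong (_+ (w (suc M) n - w (suc (suc M)) n)) (psum-telescope w M .at n)) (arith (w 0 n) (w (suc M) n) (w (suc (suc M)) n))
  where
  arith : ∀ a b c → a - b + (b - c) ≡ a - c
  arith = solve-∀

Rising : (ℕ → PS) → Set
Rising t = ∀ n → t n ≈[ n ] zeroPS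

sum∞-at : ∀ {t} → Rising t → ∀ M n → n ℕ.≤ M → sum∞ t n ≡ psum t M n
sum∞-at {t} rising zero    zero    z≤n = refl
sum∞-at {t} rising (suc M) n n≤1+M with ℕₚ.m≤n⇒m<n∨m≡n n≤1+M
... | inj₂ refl      = sym (psum-at t (suc M) (suc M))
... | inj₁ (s≤s n≤M) = trans (sum∞-at rising M n n≤M)
  (sym (trans (cong (λ x → psum t M n + x) (trans (rising (suc M) .below n (s≤s n≤M)) (cst-0 n))) (ℤₚ.+-identityʳ _)))

sum∞-≈ : ∀ {t} → Rising t → ∀ {L M} → L ℕ.≤ suc M → sum∞ t ≈[ L ] psum t M
sum∞-≈ rising {M = M} L≤ .below n n<L = sum∞-at rising M n (ℕₚ.≤-pred (ℕₚ.<-≤-trans n<L L≤))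

sum∞-cong : ∀ {t u} → (∀ n → t n ≋ u n) → sum∞ t ≋ sum∞ u
sum∞-cong p .at N = sumTo-cong N λ n _ → p n .at N

pochPoly-≈ : ∀ {M N} → M ℕ.≤ N → pochPoly N ≈[ suc M ] pochPoly M
pochPoly-≈ {M} {N} M≤N with ℕₚ.m≤n⇒m<n∨m≡n M≤N
... | inj₂ refl = ≈-refl
... | inj₁ (s≤s {n = N′} M≤N′) = ≈-trans (⊛-≈ (pochPoly-≈ M≤N′) last-factor) (≋⇒≈ (⊛-identityʳ (pochPoly M)))
  where
  last-factor : one ⊟ mono (suc N′) ≈[ suc M ] one
  last-factor = ≈-trans (⊟-≈ (≈-refl {f = one}) (mono-≈ (s≤s M≤N′))) (≋⇒≈ (pointwise λ n → trans (cong (λ x → one n - x) (cst-0 n)) (ℤₚ.+-identityʳ (one n))))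

E-≈ : ∀ M → E ≈[ suc M ] pochPoly M
E-≈ M .below i (s≤s i≤M) = sym (pochPoly-≈ i≤M .below i ℕₚ.≤-refl)

1⊟-cong : ∀ {f g} → f ≋ g → one ⊟ f ≋ one ⊟ g
1⊟-cong = ⊟-cong (≋-refl {one})

cst-neg : ∀ c → cst (- c) ≋ ⊖ cst c
cst-neg c .at zero    = refl
cst-neg c .at (suc n) = refl

-- n(5n-1)/2 + 2kn, the exponent in Rogers' series.
rexp : ℕ → ℕ → ℕ
rexp k n = 5 ℕ.* tri n ℕ.+ 2 ℕ.* n ℕ.+ 2 ℕ.* (k ℕ.* n)

rsign : ℕ → ℕ → PS
rsign k n = cst (alt n) ⊛ mono (rexp k n)

-- The product (q^{n+1};q)_K.
rising : ℕ → ℕ → PS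
rising zero    n = one
rising (suc K) n = rising K n ⊛ (one ⊟ mono (n ℕ.+ suc K))

-- Σ_n rogers K n is Rogers' expansion of E·Σ_n q^{n²+kn}/(q;q)_n, where k = K+1.
rogers : ℕ → ℕ → PS
rogers K n = rsign (suc K) n ⊛ (one ⊟ mono (sum (suc K ∷ n ∷ n ∷ []))) ⊛ rising K n

-- Absorbs the factor 1 - q^{n+1} of `telescoper K (suc n)`, so that this term too becomes a
-- multiple of `rising K n`.
rising-front : ∀ K n → (one ⊟ mono (suc n)) ⊛ rising K (suc n) ≋ rising (suc K) n
rising-front zero    n = begin
  (one ⊟ mono (suc n)) ⊛ one       ≈⟨ ⊛-comm (one ⊟ mono (suc n)) one ⟩
  one ⊛ (one ⊟ mono (suc n))       ≈⟨ ⊛-congˡ one (1⊟-cong (mono-cong (ℕₚ.+-comm 1 n))) ⟩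
  one ⊛ (one ⊟ mono (n ℕ.+ 1))     ∎
  where open ≋-Reasoning
rising-front (suc K) n = begin
  (one ⊟ mono (suc n)) ⊛ (rising K (suc n) ⊛ (one ⊟ mono (suc n ℕ.+ suc K)))
    ≈⟨ ⊛-assoc (one ⊟ mono (suc n)) (rising K (suc n)) (one ⊟ mono (suc n ℕ.+ suc K)) ⟨
  (one ⊟ mono (suc n)) ⊛ rising K (suc n) ⊛ (one ⊟ mono (suc n ℕ.+ suc K))
    ≈⟨ ⊛-cong (rising-front K n) (1⊟-cong (mono-cong (sym (ℕₚ.+-suc n (suc K))))) ⟩
  rising (suc K) n ⊛ (one ⊟ mono (n ℕ.+ suc (suc K))) ∎
  where open ≋-Reasoning

signed-shift : ∀ k x n ms → x ≡ rexp k n ℕ.+ sum ms → cst (alt n) ⊛ mono x ≋ rsign k n ⊛ foldr (λ m f → mono m ⊛ f) one ms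
signed-shift k x n ms eq = begin
  cst (alt n) ⊛ mono x                              ≈⟨ ⊛-congˡ (cst (alt n)) (mono-cong eq) ⟩
  cst (alt n) ⊛ mono (rexp k n ℕ.+ sum ms)          ≈⟨ ⊛-congˡ (cst (alt n)) (mono-+ (rexp k n) (sum ms)) ⟩
  cst (alt n) ⊛ (mono (rexp k n) ⊛ mono (sum ms))   ≈⟨ ⊛-assoc (cst (alt n)) (mono (rexp k n)) (mono (sum ms)) ⟨
  rsign k n ⊛ mono (sum ms)                         ≈⟨ ⊛-congˡ (rsign k n) (mono-sum ms) ⟩
  rsign k n ⊛ foldr (λ m f → mono m ⊛ f) one ms     ∎
  where open ≋-Reasoning

rsign-suc : ∀ k n ms → rexp k (suc n) ≡ rexp k n ℕ.+ sum ms → rsign k (suc n) ≋ ⊖ (rsign k n ⊛ foldr (λ m f → mono m ⊛ f) one ms)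
rsign-suc k n ms eq = begin
  cst (- alt n) ⊛ mono (rexp k (suc n))                ≈⟨ ⊛-cong (cst-neg (alt n)) (mono-cong eq) ⟩
  (⊖ cst (alt n)) ⊛ mono (rexp k n ℕ.+ sum ms)         ≈⟨ neg-*ˡ (cst (alt n)) (mono (rexp k n ℕ.+ sum ms)) ⟩
  ⊖ (cst (alt n) ⊛ mono (rexp k n ℕ.+ sum ms))         ≈⟨ ⊖-cong (⊛-congˡ (cst (alt n)) (mono-+ (rexp k n) (sum ms))) ⟩
  ⊖ (cst (alt n) ⊛ (mono (rexp k n) ⊛ mono (sum ms)))  ≈⟨ ⊖-cong (⊛-assoc (cst (alt n)) (mono (rexp k n)) (mono (sum ms))) ⟨
  ⊖ (rsign k n ⊛ mono (sum ms))                        ≈⟨ ⊖-cong (⊛-congˡ (rsign k n) (mono-sum ms)) ⟩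
  ⊖ (rsign k n ⊛ foldr (λ m f → mono m ⊛ f) one ms)    ∎
  where open ≋-Reasoning

-- e·p·(1−y)·s(y) with y = qⁿ, where s(y) = 1 + y − q^{K+1}y² solves the telescoping equation; the factor 1−y kills the term n = 0.
telescoper : ℕ → ℕ → PS
telescoper K n = rsign (suc K) n ⊛ rising K n ⊛ (one ⊟ mono n) ⊛ (one ⊕ mono n ⊟ mono (suc K) ⊛ mono n ⊛ mono n)

-- Written in terms of `rsign (suc K) n` and `rising K n`, this is a polynomial identity in qⁿ, q
-- and q^{K+1}, namely `rogers-step`.
rogers-telescope : ∀ K n →
  rogers K n ⊟ rogers (suc K) n ⊟ mono 1 ⊛ mono (suc K) ⊛ rogers (suc (suc K)) n ≋ telescoper K n ⊟ telescoper K (suc n)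
rogers-telescope K n = ≋-trans
  (⊟-cong (⊟-cong
    (⊛-congʳ p (⊛-congˡ e (1⊟-cong (mono-sum (suc K ∷ n ∷ n ∷ [])))))
    (⊛-cong (⊛-cong (signed-shift (suc K) (rexp (suc (suc K)) n) n (n ∷ n ∷ []) (shift₁ K n (tri n))) (1⊟-cong (mono-sum (1 ∷ suc K ∷ n ∷ n ∷ []))))
            (⊛-congˡ p (1⊟-cong (mono-+ n (suc K))))))
    (⊛-congˡ (mono 1 ⊛ mono (suc K))
      (⊛-cong (⊛-cong (signed-shift (suc K) (rexp (suc (suc (suc K))) n) n (n ∷ n ∷ n ∷ n ∷ []) (shift₂ K n (tri n))) (1⊟-cong (mono-sum (1 ∷ 1 ∷ suc K ∷ n ∷ n ∷ []))))
              (⊛-cong (⊛-congˡ p (1⊟-cong (mono-+ n (suc K)))) (1⊟-cong (≋-trans (mono-+ n (suc (suc K))) (⊛-congˡ (mono n) (mono-+ 1 (suc K)))))))))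
  (≋-trans (rogers-step e p (mono n) (mono 1) (mono (suc K)))
    (⊟-cong (≋-refl {telescoper K n}) (≋-sym next)))
  where
  open ≋-Reasoning
  e = rsign (suc K) n
  p = rising K n
  shift₁ : ∀ K n t → 5 ℕ.* t ℕ.+ 2 ℕ.* n ℕ.+ 2 ℕ.* (suc (suc K) ℕ.* n) ≡ 5 ℕ.* t ℕ.+ 2 ℕ.* n ℕ.+ 2 ℕ.* (suc K ℕ.* n) ℕ.+ (n ℕ.+ (n ℕ.+ 0))
  shift₁ = ℕ-Solver.solve-∀
  shift₂ : ∀ K n t → 5 ℕ.* t ℕ.+ 2 ℕ.* n ℕ.+ 2 ℕ.* (suc (suc (suc K)) ℕ.* n)
                     ≡ 5 ℕ.* t ℕ.+ 2 ℕ.* n ℕ.+ 2 ℕ.* (suc K ℕ.* n) ℕ.+ (n ℕ.+ (n ℕ.+ (n ℕ.+ (n ℕ.+ 0))))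
  shift₂ = ℕ-Solver.solve-∀
  shift₃ : ∀ K n t → 5 ℕ.* (n ℕ.+ t) ℕ.+ 2 ℕ.* suc n ℕ.+ 2 ℕ.* (suc K ℕ.* suc n)
    ≡ 5 ℕ.* t ℕ.+ 2 ℕ.* n ℕ.+ 2 ℕ.* (suc K ℕ.* n) ℕ.+ (n ℕ.+ (n ℕ.+ (n ℕ.+ (n ℕ.+ (n ℕ.+ (1 ℕ.+ (1 ℕ.+ (suc K ℕ.+ (suc K ℕ.+ 0)))))))))
  shift₃ = ℕ-Solver.solve-∀
  e′ = foldr (λ m f → mono m ⊛ f) one (n ∷ n ∷ n ∷ n ∷ n ∷ 1 ∷ 1 ∷ suc K ∷ suc K ∷ [])
  tail-factor : ∀ {y y′} → y ≋ y′ → one ⊕ y ⊟ mono (suc K) ⊛ y ⊛ y ≋ one ⊕ y′ ⊟ mono (suc K) ⊛ y′ ⊛ y′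
  tail-factor p = ⊟-cong (⊕-congˡ one p) (⊛-cong (⊛-congˡ (mono (suc K)) p) p)
  next : telescoper K (suc n) ≋ ⊖ (e ⊛ e′) ⊛ (p ⊛ (one ⊟ mono n ⊛ mono (suc K)))
           ⊛ (one ⊕ mono 1 ⊛ mono n ⊟ mono (suc K) ⊛ (mono 1 ⊛ mono n) ⊛ (mono 1 ⊛ mono n))
  next = ⊛-cong
    (≋-trans (*-rotate (rsign (suc K) (suc n)) (rising K (suc n)) (one ⊟ mono (suc n)))
      (⊛-cong (rsign-suc (suc K) n (n ∷ n ∷ n ∷ n ∷ n ∷ 1 ∷ 1 ∷ suc K ∷ suc K ∷ []) (shift₃ K n (tri n)))
              (≋-trans (rising-front K n) (⊛-congˡ p (1⊟-cong (mono-+ n (suc K)))))))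
    (tail-factor (mono-+ 1 n))

rsign-≈ : ∀ k n f g → rsign k n ⊛ f ⊛ g ≈[ 2 ℕ.* n ℕ.+ 2 ℕ.* (k ℕ.* n) ] zeroPS
rsign-≈ k n f g = ≈-trans (≋⇒≈ (≋-trans (⊛-congʳ g (≋-trans (⊛-congʳ f (⊛-comm (cst (alt n)) (mono (rexp k n)))) (⊛-assoc (mono (rexp k n)) (cst (alt n)) f)))
                                  (⊛-assoc (mono (rexp k n)) (cst (alt n) ⊛ f) g)))
  (mono-⊛-≈ (rexp k n) (cst (alt n) ⊛ f ⊛ g) (ℕₚ.+-monoˡ-≤ (2 ℕ.* (k ℕ.* n)) (ℕₚ.m≤n+m (2 ℕ.* n) (5 ℕ.* tri n))))

n≤2n+ : ∀ n m → n ℕ.≤ 2 ℕ.* n ℕ.+ m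
n≤2n+ n m = ℕₚ.≤-trans (ℕₚ.m≤m+n n (n ℕ.+ 0)) (ℕₚ.m≤m+n (2 ℕ.* n) m)

rogers-rising : ∀ K → Rising (rogers K)
rogers-rising K n = ≈-weaken (n≤2n+ n (2 ℕ.* (suc K ℕ.* n)))
  (rsign-≈ (suc K) n (one ⊟ mono (sum (suc K ∷ n ∷ n ∷ []))) (rising K n))

-- The partial sums up to L differ by w(0) - w(L+1), where w(0) is 0 and w(L+1) vanishes modulo q^L.
sum∞-telescope : ∀ {t u v w} f → Rising t → Rising u → Rising v → Rising w → w 0 ≋ zeroPS →
  (∀ n → t n ⊟ u n ⊟ f ⊛ v n ≋ w n ⊟ w (suc n)) → sum∞ t ≋ sum∞ u ⊕ f ⊛ sum∞ v
sum∞-telescope {t} {u} {v} {w} f rt ru rv rw w₀ step = ≈⇒≋ λ L → begin-≈ L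
  where
  open ≋-Reasoning
  defect : ∀ L → psum t L ⊟ psum u L ⊟ f ⊛ psum v L ≋ w 0 ⊟ w (suc L)
  defect L = begin
    psum t L ⊟ psum u L ⊟ f ⊛ psum v L
      ≈⟨ ⊟-cong (psum-⊟ t u L) (psum-⊛ f v L) ⟨
    psum (λ n → t n ⊟ u n) L ⊟ psum (λ n → f ⊛ v n) L
      ≈⟨ psum-⊟ (λ n → t n ⊟ u n) (λ n → f ⊛ v n) L ⟨
    psum (λ n → t n ⊟ u n ⊟ f ⊛ v n) L
      ≈⟨ psum-cong step L ⟩
    psum (λ n → w n ⊟ w (suc n)) L
      ≈⟨ psum-telescope w L ⟩
    w 0 ⊟ w (suc L) ∎
  small : ∀ L → psum t L ⊟ psum u L ⊟ f ⊛ psum v L ≈[ L ] zeroPS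
  small L = ≈-trans (≋⇒≈ (defect L)) (≈-trans (⊟-≈ (≋⇒≈ w₀) (≈-weaken (ℕₚ.n≤1+n L) (rw (suc L))))
    (≋⇒≈ (pointwise λ n → trans (cong (λ x → x - x) (cst-0 n)) (sym (cst-0 n)))))
  begin-≈ : ∀ L → sum∞ t ≈[ L ] sum∞ u ⊕ f ⊛ sum∞ v
  begin-≈ L = ≈-trans (sum∞-≈ rt (ℕₚ.n≤1+n L)) (≈-trans (≋⇒≈ (telescope-sum (psum t L) (psum u L) (f ⊛ psum v L)))
    (≈-trans (⊕-≈ (⊕-≈ (≈-sym (sum∞-≈ ru (ℕₚ.n≤1+n L))) (⊛-≈ (≈-refl {f = f}) (≈-sym (sum∞-≈ rv (ℕₚ.n≤1+n L))))) (small L))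
      (≋⇒≈ (⊕-identityʳ (sum∞ u ⊕ f ⊛ sum∞ v)))))

rogersSum : ℕ → PS
rogersSum K = sum∞ (rogers K)

telescoper-rising : ∀ K → Rising (telescoper K)
telescoper-rising K n = ≈-weaken (n≤2n+ n (2 ℕ.* (suc K ℕ.* n))) (≈-trans
  (≋⇒≈ (⊛-assoc (rsign (suc K) n ⊛ rising K n) (one ⊟ mono n) (one ⊕ mono n ⊟ mono (suc K) ⊛ mono n ⊛ mono n)))
  (rsign-≈ (suc K) n (rising K n) ((one ⊟ mono n) ⊛ (one ⊕ mono n ⊟ mono (suc K) ⊛ mono n ⊛ mono n))))

telescoper-0 : ∀ K → telescoper K 0 ≋ zeroPS
telescoper-0 K = ≋-trans (⊛-congʳ s (⊛-congˡ (rsign (suc K) 0 ⊛ rising K 0) (1⊟-cong mono-0))) (vanish-*ʳ (rsign (suc K) 0 ⊛ rising K 0) s)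
  where s = one ⊕ mono 0 ⊟ mono (suc K) ⊛ mono 0 ⊛ mono 0

rogersSum-recurrence : ∀ K → rogersSum K ≋ rogersSum (suc K) ⊕ mono (suc (suc K)) ⊛ rogersSum (suc (suc K))
rogersSum-recurrence K = ≋-trans
  (sum∞-telescope (mono 1 ⊛ mono (suc K)) (rogers-rising K) (rogers-rising (suc K)) (rogers-rising (suc (suc K)))
    (telescoper-rising K) (telescoper-0 K) (rogers-telescope K))
  (⊕-congˡ (rogersSum (suc K)) (⊛-congʳ (rogersSum (suc (suc K))) (≋-sym (mono-+ 1 (suc K)))))

geom-inverse : ∀ k .{{_ : NonZero k}} → (one ⊟ mono k) ⊛ geom k ≋ one
geom-inverse k = ≋-trans (⊛-congˡ (one ⊟ mono k) unfold) (≋-trans (expand (mono k) (geom k))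
  (≋-trans (⊕-congˡ one (⊛-congˡ (mono k) (≋-trans (⊟-cong unfold (≋-refl {one ⊕ mono k ⊛ geom k})) (cancel-self (one ⊕ mono k ⊛ geom k)))))
    (≋-trans (⊕-congˡ one (⊛-zeroʳ (mono k))) (⊕-identityʳ one))))
  where
  unfold : geom k ≋ one ⊕ mono k ⊛ geom k
  unfold = dilate-unfold k (λ _ → 1ℤ)

ramanujan : ℕ → ℕ → PS
ramanujan k n = mono (n ℕ.* n ℕ.+ k ℕ.* n) ⊛ invPoch n

ramanujanSum : ℕ → PS
ramanujanSum k = sum∞ (ramanujan k)

n≤n*n+ : ∀ n m → n ℕ.≤ n ℕ.* n ℕ.+ m
n≤n*n+ n m = ℕₚ.≤-trans (n≤n*n n) (ℕₚ.m≤m+n (n ℕ.* n) m)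

ramanujan-rising : ∀ k → Rising (ramanujan k)
ramanujan-rising k n = mono-⊛-≈ (n ℕ.* n ℕ.+ k ℕ.* n) (invPoch n) (n≤n*n+ n (k ℕ.* n))

-- The factor 1 - q^{n+1} cancels the last factor of (q;q)_{n+1}. Summed over n, this becomes the
-- recurrence of G_k.
ramanujan-difference : ∀ k n → ramanujan k (suc n) ⊟ ramanujan (suc k) (suc n) ≋ mono (suc k) ⊛ ramanujan (suc (suc k)) n
ramanujan-difference k n = begin
  mono x ⊛ (invPoch n ⊛ geom (suc n)) ⊟ mono x′ ⊛ (invPoch n ⊛ geom (suc n))
    ≈⟨ ⊟-cong (≋-refl {mono x ⊛ (invPoch n ⊛ geom (suc n))}) (⊛-congʳ (invPoch n ⊛ geom (suc n)) (≋-trans (mono-cong (x′-eq k n)) (mono-+ x (suc n)))) ⟩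
  mono x ⊛ (invPoch n ⊛ geom (suc n)) ⊟ mono x ⊛ mono (suc n) ⊛ (invPoch n ⊛ geom (suc n))
    ≈⟨ factor (mono x) (mono (suc n)) (invPoch n) (geom (suc n)) ⟩
  mono x ⊛ invPoch n ⊛ ((one ⊟ mono (suc n)) ⊛ geom (suc n))
    ≈⟨ ⊛-congˡ (mono x ⊛ invPoch n) (geom-inverse (suc n)) ⟩
  mono x ⊛ invPoch n ⊛ one
    ≈⟨ ⊛-identityʳ (mono x ⊛ invPoch n) ⟩
  mono x ⊛ invPoch n
    ≈⟨ ⊛-congʳ (invPoch n) (≋-trans (mono-cong (x-eq k n)) (mono-+ (suc k) (n ℕ.* n ℕ.+ suc (suc k) ℕ.* n))) ⟩
  mono (suc k) ⊛ mono (n ℕ.* n ℕ.+ suc (suc k) ℕ.* n) ⊛ invPoch n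
    ≈⟨ ⊛-assoc (mono (suc k)) (mono (n ℕ.* n ℕ.+ suc (suc k) ℕ.* n)) (invPoch n) ⟩
  mono (suc k) ⊛ ramanujan (suc (suc k)) n ∎
  where
  open ≋-Reasoning
  x x′ : ℕ
  x  = suc n ℕ.* suc n ℕ.+ k ℕ.* suc n
  x′ = suc n ℕ.* suc n ℕ.+ suc k ℕ.* suc n
  x′-eq : ∀ k n → suc n ℕ.* suc n ℕ.+ suc k ℕ.* suc n ≡ suc n ℕ.* suc n ℕ.+ k ℕ.* suc n ℕ.+ suc n
  x′-eq = ℕ-Solver.solve-∀
  x-eq : ∀ k n → suc n ℕ.* suc n ℕ.+ k ℕ.* suc n ≡ suc k ℕ.+ (n ℕ.* n ℕ.+ suc (suc k) ℕ.* n)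
  x-eq = ℕ-Solver.solve-∀

ramanujan-0 : ∀ k → ramanujan k 0 ≋ one
ramanujan-0 k = ≋-trans (⊛-identityʳ (mono (k ℕ.* 0))) (≋-trans (mono-cong (ℕₚ.*-zeroʳ k)) mono-0)

ramanujanSum-recurrence : ∀ k → ramanujanSum k ≋ ramanujanSum (suc k) ⊕ mono (suc k) ⊛ ramanujanSum (suc (suc k))
ramanujanSum-recurrence k = ≈⇒≋ λ L → ≈-trans (sum∞-≈ (ramanujan-rising k) (ℕₚ.m≤n⇒m≤1+n (ℕₚ.n≤1+n L)))
  (≈-trans (≋⇒≈ (partial-sums L))
    (⊕-≈ (≈-sym (sum∞-≈ (ramanujan-rising (suc k)) (ℕₚ.m≤n⇒m≤1+n (ℕₚ.n≤1+n L))))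
         (⊛-≈ (≈-refl {f = mono (suc k)}) (≈-sym (sum∞-≈ (ramanujan-rising (suc (suc k))) (ℕₚ.n≤1+n L))))))
  where
  open ≋-Reasoning
  r r′ r″ : ℕ → PS
  r = ramanujan k
  r′ = ramanujan (suc k)
  r″ = ramanujan (suc (suc k))
  partial-sums : ∀ L → psum r (suc L) ≋ psum r′ (suc L) ⊕ mono (suc k) ⊛ psum r″ L
  partial-sums L = begin
    psum r (suc L)
      ≈⟨ add-sub (psum r (suc L)) (psum r′ (suc L)) ⟩
    psum r′ (suc L) ⊕ (psum r (suc L) ⊟ psum r′ (suc L))
      ≈⟨ ⊕-congˡ (psum r′ (suc L)) (psum-⊟ r r′ (suc L)) ⟨
    psum r′ (suc L) ⊕ psum (λ n → r n ⊟ r′ n) (suc L)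
      ≈⟨ ⊕-congˡ (psum r′ (suc L)) (psum-head (λ n → r n ⊟ r′ n) L) ⟩
    psum r′ (suc L) ⊕ ((r 0 ⊟ r′ 0) ⊕ psum (λ n → r (suc n) ⊟ r′ (suc n)) L)
      ≈⟨ ⊕-congˡ (psum r′ (suc L)) (⊕-cong (≋-trans (⊟-cong (ramanujan-0 k) (ramanujan-0 (suc k))) (cancel-self one))
           (≋-trans (psum-cong (ramanujan-difference k) L) (psum-⊛ (mono (suc k)) r″ L))) ⟩
    psum r′ (suc L) ⊕ (zeroPS ⊕ mono (suc k) ⊛ psum r″ L)
      ≈⟨ ⊕-congˡ (psum r′ (suc L)) (⊕-identityˡ (mono (suc k) ⊛ psum r″ L)) ⟩
    psum r′ (suc L) ⊕ mono (suc k) ⊛ psum r″ L ∎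

sum∞-first : ∀ {t L} → Rising t → (∀ n → t (suc n) ≈[ L ] zeroPS) → sum∞ t ≈[ L ] t 0
sum∞-first {t} {L} rt small = ≈-trans (sum∞-≈ rt (ℕₚ.n≤1+n L)) (go L)
  where
  go : ∀ M → psum t M ≈[ L ] t 0
  go zero    = ≈-refl
  go (suc M) = ≈-trans (⊕-≈ (go M) (small M)) (≋⇒≈ (⊕-identityʳ (t 0)))

ramanujanSum-≈ : ∀ K → ramanujanSum (suc K) ≈[ suc K ] one
ramanujanSum-≈ K = ≈-trans (sum∞-first (ramanujan-rising (suc K)) λ n → mono-⊛-≈ _ (invPoch (suc n))
    (ℕₚ.≤-trans (ℕₚ.m≤m*n (suc K) (suc n)) (ℕₚ.m≤n+m (suc K ℕ.* suc n) (suc n ℕ.* suc n))))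
  (≋⇒≈ (ramanujan-0 (suc K)))

rising-pochPoly : ∀ K → rising K 0 ≋ pochPoly K
rising-pochPoly zero    = ≋-refl
rising-pochPoly (suc K) = ⊛-congʳ (one ⊟ mono (suc K)) (rising-pochPoly K)

rogers-0 : ∀ K → rogers K 0 ≋ pochPoly (suc K)
rogers-0 K = ≋-trans
  (⊛-cong (⊛-cong (⊛-congˡ one (≋-trans (mono-cong (cong (2 ℕ.*_) (ℕₚ.*-zeroʳ (suc K)))) mono-0))
                  (1⊟-cong (mono-cong (ℕₚ.+-identityʳ (suc K)))))
          (rising-pochPoly K))
  (unit-rearrange (one ⊟ mono (suc K)) (pochPoly K))

rogersSum-≈ : ∀ K → rogersSum K ≈[ suc K ] E
rogersSum-≈ K = ≈-trans
  (sum∞-first (rogers-rising K) λ n → ≈-weaken (bound n) (rsign-≈ (suc K) (suc n) (one ⊟ mono (sum (suc K ∷ suc n ∷ suc n ∷ []))) (rising K (suc n))))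
  (≈-trans (≋⇒≈ (rogers-0 K)) (≈-weaken (ℕₚ.n≤1+n (suc K)) (≈-sym (E-≈ (suc K)))))
  where
  bound : ∀ n → suc K ℕ.≤ 2 ℕ.* suc n ℕ.+ 2 ℕ.* (suc K ℕ.* suc n)
  bound n = ℕₚ.≤-trans (ℕₚ.m≤m*n (suc K) (suc n)) (ℕₚ.≤-trans (ℕₚ.m≤m+n _ _) (ℕₚ.m≤n+m (2 ℕ.* (suc K ℕ.* suc n)) (2 ℕ.* suc n)))

-- Both sides at K are expressed in the same way through K + 1 and K + 2, and both are congruent to
-- E modulo q^{K+1}. Raising the index until it reaches L therefore settles the congruence modulo
-- q^L.
rogers-ramanujan : ∀ K → E ⊛ ramanujanSum (suc K) ≋ rogersSum K
rogers-ramanujan K = ≈⇒≋ λ L → descend L L K (ℕₚ.m≤n+m L K)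
  where
  descend : ∀ L d K → L ℕ.≤ K ℕ.+ d → E ⊛ ramanujanSum (suc K) ≈[ L ] rogersSum K
  descend L zero K le = ≈-weaken (ℕₚ.≤-trans le (ℕₚ.≤-trans (ℕₚ.≤-reflexive (ℕₚ.+-identityʳ K)) (ℕₚ.n≤1+n K)))
    (≈-trans (⊛-≈ (≈-refl {f = E}) (ramanujanSum-≈ K)) (≈-trans (≋⇒≈ (⊛-identityʳ E)) (≈-sym (rogersSum-≈ K))))
  descend L (suc d) K le = ≈-trans (≋⇒≈ (≋-trans (⊛-congˡ E (ramanujanSum-recurrence (suc K)))
      (e·[a+m·b] E (ramanujanSum (suc (suc K))) (mono (suc (suc K))) (ramanujanSum (suc (suc (suc K)))))))
    (≈-trans (⊕-≈ (descend L d (suc K) le′) (⊛-≈ (≈-refl {f = mono (suc (suc K))}) (descend L d (suc (suc K)) (ℕₚ.m≤n⇒m≤1+n le′))))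
      (≋⇒≈ (≋-sym (rogersSum-recurrence K))))
    where
    le′ : L ℕ.≤ suc K ℕ.+ d
    le′ = ℕₚ.≤-trans le (ℕₚ.≤-reflexive (ℕₚ.+-suc K d))

jacTerm-rising : ∀ a b .{{_ : NonZero a}} .{{_ : NonZero b}} → Rising (jacTerm a b)
jacTerm-rising a b n = ≈-trans (⊛-≈ (≈-refl {f = cst (alt n)})
    (≈-trans (⊟-≈ (mono-≈ (n≤jacExp⁺ a b n)) (mono-≈ (ℕₚ.≤-trans (ℕₚ.n≤1+n n) (n≤jacExp⁻ a b n)))) (≋⇒≈ (cancel-self zeroPS))))
  (≋⇒≈ (⊛-zeroʳ (cst (alt n))))

-- For K = 0 the product `rising` is empty, and Rogers' series is term by term the theta series with
-- n paired with -1-n.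
rogers-ramanujan-H : E ⊛ H ≋ jac 4 1
rogers-ramanujan-H = ≋-trans (⊛-congˡ E (sum∞-cong λ n → ⊛-congʳ (invPoch n) (mono-cong (exponent n))))
  (≋-trans (rogers-ramanujan 0) (sum∞-cong λ n → ≋-sym (term n)))
  where
  exponent : ∀ n → n ℕ.* suc n ≡ n ℕ.* n ℕ.+ 1 ℕ.* n
  exponent = ℕ-Solver.solve-∀
  left : ∀ n t → 5 ℕ.* t ℕ.+ 4 ℕ.* n ≡ 5 ℕ.* t ℕ.+ 2 ℕ.* n ℕ.+ 2 ℕ.* (1 ℕ.* n)
  left = ℕ-Solver.solve-∀
  right : ∀ n t → 5 ℕ.* (n ℕ.+ t) ℕ.+ 1 ℕ.* suc n ≡ 5 ℕ.* t ℕ.+ 2 ℕ.* n ℕ.+ 2 ℕ.* (1 ℕ.* n) ℕ.+ (1 ℕ.+ (n ℕ.+ (n ℕ.+ 0)))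
  right = ℕ-Solver.solve-∀
  term : ∀ n → jacTerm 4 1 n ≋ rogers 0 n
  term n = ≋-trans (⊛-congˡ (cst (alt n)) (⊟-cong (mono-cong (left n (tri n)))
      (≋-trans (mono-cong (right n (tri n))) (mono-+ (rexp 1 n) (sum (1 ∷ n ∷ n ∷ []))))))
    (jac-factor (cst (alt n)) (mono (rexp 1 n)) (mono (sum (1 ∷ n ∷ n ∷ []))))

-- `rogers K` covers G_k only for k = K + 1 ≥ 1. The case k = 0 is reached by one more use of the
-- recurrence, G_0 = G_1 + q·G_2, and a telescoping of its own.
rogers-ramanujan-G : E ⊛ G ≋ jac 3 2
rogers-ramanujan-G = ≋-trans (⊛-congˡ E (≋-trans (sum∞-cong λ n → ⊛-congʳ (invPoch n) (mono-cong (sym (ℕₚ.+-identityʳ (n ℕ.* n))))) (ramanujanSum-recurrence 0)))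
  (≋-trans (e·[a+m·b] E (ramanujanSum 1) (mono 1) (ramanujanSum 2))
    (≋-trans (⊕-cong (rogers-ramanujan 0) (⊛-congˡ (mono 1) (rogers-ramanujan 1)))
      (≋-sym (sum∞-telescope (mono 1) (jacTerm-rising 3 2) (rogers-rising 0) (rogers-rising 1) w-rising w-0 step))))
  where
  w : ℕ → PS
  w n = rsign 0 n ⊛ (mono n ⊟ mono n ⊛ mono n)
  w-rising : Rising w
  w-rising n = ≈-weaken (n≤2n+ n (2 ℕ.* (0 ℕ.* n))) (≈-trans (≋⇒≈ (≋-sym (⊛-identityʳ (w n)))) (rsign-≈ 0 n (mono n ⊟ mono n ⊛ mono n) one))
  w-0 : w 0 ≋ zeroPS
  w-0 = ≋-trans (⊛-congˡ (rsign 0 0) (⊟-cong mono-0 (⊛-cong mono-0 mono-0))) (vanish₂ (rsign 0 0))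
  exp₁ : ∀ n t → 5 ℕ.* t ℕ.+ 3 ℕ.* n ≡ 5 ℕ.* t ℕ.+ 2 ℕ.* n ℕ.+ 0 ℕ.+ (n ℕ.+ 0)
  exp₁ = ℕ-Solver.solve-∀
  exp₂ : ∀ n t → 5 ℕ.* (n ℕ.+ t) ℕ.+ 2 ℕ.* suc n ≡ 5 ℕ.* t ℕ.+ 2 ℕ.* n ℕ.+ 0 ℕ.+ (n ℕ.+ (n ℕ.+ (n ℕ.+ (n ℕ.+ (n ℕ.+ (1 ℕ.+ (1 ℕ.+ 0)))))))
  exp₂ = ℕ-Solver.solve-∀
  exp₃ : ∀ n t → 5 ℕ.* t ℕ.+ 2 ℕ.* n ℕ.+ 2 ℕ.* (1 ℕ.* n) ≡ 5 ℕ.* t ℕ.+ 2 ℕ.* n ℕ.+ 0 ℕ.+ (n ℕ.+ (n ℕ.+ 0))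
  exp₃ = ℕ-Solver.solve-∀
  exp₄ : ∀ n t → 5 ℕ.* t ℕ.+ 2 ℕ.* n ℕ.+ 2 ℕ.* (2 ℕ.* n) ≡ 5 ℕ.* t ℕ.+ 2 ℕ.* n ℕ.+ 0 ℕ.+ (n ℕ.+ (n ℕ.+ (n ℕ.+ (n ℕ.+ 0))))
  exp₄ = ℕ-Solver.solve-∀
  exp₅ : ∀ n t → 5 ℕ.* (n ℕ.+ t) ℕ.+ 2 ℕ.* suc n ℕ.+ 0 ≡ 5 ℕ.* t ℕ.+ 2 ℕ.* n ℕ.+ 0 ℕ.+ (n ℕ.+ (n ℕ.+ (n ℕ.+ (n ℕ.+ (n ℕ.+ (1 ℕ.+ (1 ℕ.+ 0)))))))
  exp₅ = ℕ-Solver.solve-∀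
  step : ∀ n → jacTerm 3 2 n ⊟ rogers 0 n ⊟ mono 1 ⊛ rogers 1 n ≋ w n ⊟ w (suc n)
  step n = ≋-trans
    (⊟-cong (⊟-cong
      (≋-trans (distribˡ-∸ (cst (alt n)) (mono (jacExp 3 2 (+ n))) (mono (jacExp 3 2 -[1+ n ])))
        (⊟-cong (signed-shift 0 (jacExp 3 2 (+ n)) n (n ∷ []) (exp₁ n (tri n)))
                (signed-shift 0 (jacExp 3 2 -[1+ n ]) n (n ∷ n ∷ n ∷ n ∷ n ∷ 1 ∷ 1 ∷ []) (exp₂ n (tri n)))))
      (⊛-congʳ one (⊛-cong (signed-shift 0 (rexp 1 n) n (n ∷ n ∷ []) (exp₃ n (tri n))) (1⊟-cong (mono-sum (1 ∷ n ∷ n ∷ []))))))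
      (⊛-congˡ (mono 1) (⊛-cong
        (⊛-cong (signed-shift 0 (rexp 2 n) n (n ∷ n ∷ n ∷ n ∷ []) (exp₄ n (tri n))) (1⊟-cong (mono-sum (1 ∷ 1 ∷ n ∷ n ∷ []))))
        (⊛-congˡ one (1⊟-cong (mono-+ n 1))))))
    (≋-trans (rogers-step₀ (rsign 0 n) (mono n) (mono 1)) (⊟-cong (≋-refl {w n}) (≋-sym
      (⊛-cong (rsign-suc 0 n (n ∷ n ∷ n ∷ n ∷ n ∷ 1 ∷ 1 ∷ []) (exp₅ n (tri n)))
              (⊟-cong (mono-+ 1 n) (⊛-cong (mono-+ 1 n) (mono-+ 1 n)))))))

open ≋-Reasoning

-- The Jacobi triple product

power : PS → ℕ → PS
power X zero    = one
power X (suc i) = X ⊛ power X i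

power-mono : ∀ x i → power (mono x) i ≋ mono (i ℕ.* x)
power-mono x zero    = ≋-sym mono-0
power-mono x (suc i) = ≋-trans (⊛-congˡ (mono x) (power-mono x i)) (≋-sym (mono-+ x (i ℕ.* x)))

-- The sum over i + j = M with both indices kept, which avoids subtraction in the q-binomial
-- theorem.
antidiagonal : (ℕ → ℕ → PS) → ℕ → PS
antidiagonal f zero    = f 0 0
antidiagonal f (suc M) = f (suc M) 0 ⊕ antidiagonal (λ i j → f i (suc j)) M

antidiagonal-cong : ∀ {f g} → (∀ i j → f i j ≋ g i j) → ∀ M → antidiagonal f M ≋ antidiagonal g M
antidiagonal-cong p zero    = p 0 0
antidiagonal-cong p (suc M) = ⊕-cong (p (suc M) 0) (antidiagonal-cong (λ i j → p i (suc j)) M)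

antidiagonal-⊕ : ∀ f g M → antidiagonal (λ i j → f i j ⊕ g i j) M ≋ antidiagonal f M ⊕ antidiagonal g M
antidiagonal-⊕ f g zero    = ≋-refl
antidiagonal-⊕ f g (suc M) = ≋-trans (⊕-congˡ (f (suc M) 0 ⊕ g (suc M) 0) (antidiagonal-⊕ (λ i j → f i (suc j)) (λ i j → g i (suc j)) M))
  (pointwise λ n → interchange (f (suc M) 0 n) (g (suc M) 0 n) (antidiagonal (λ i j → f i (suc j)) M n) (antidiagonal (λ i j → g i (suc j)) M n))

antidiagonal-⊛ : ∀ u f M → antidiagonal (λ i j → u ⊛ f i j) M ≋ u ⊛ antidiagonal f M
antidiagonal-⊛ u f zero    = ≋-refl
antidiagonal-⊛ u f (suc M) = ≋-trans (⊕-congˡ (u ⊛ f (suc M) 0) (antidiagonal-⊛ u (λ i j → f i (suc j)) M))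
  (≋-sym (⊛-distribˡ u (f (suc M) 0) (antidiagonal (λ i j → f i (suc j)) M)))

antidiagonal-⊖ : ∀ f M → antidiagonal (λ i j → ⊖ f i j) M ≋ ⊖ antidiagonal f M
antidiagonal-⊖ f zero    = ≋-refl
antidiagonal-⊖ f (suc M) = ≋-trans (⊕-congˡ (⊖ f (suc M) 0) (antidiagonal-⊖ (λ i j → f i (suc j)) M))
  (pointwise λ n → sym (ℤₚ.neg-distrib-+ (f (suc M) 0 n) (antidiagonal (λ i j → f i (suc j)) M n)))

antidiagonal-last : ∀ f M → antidiagonal f (suc M) ≋ antidiagonal (λ i j → f (suc i) j) M ⊕ f 0 (suc M)
antidiagonal-last f zero    = ≋-refl
antidiagonal-last f (suc M) = begin
  f (suc (suc M)) 0 ⊕ antidiagonal (λ i j → f i (suc j)) (suc M)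
    ≈⟨ ⊕-congˡ (f (suc (suc M)) 0) (antidiagonal-last (λ i j → f i (suc j)) M) ⟩
  f (suc (suc M)) 0 ⊕ (antidiagonal (λ i j → f (suc i) (suc j)) M ⊕ f 0 (suc (suc M)))
    ≈⟨ pointwise (λ n → sym (ℤₚ.+-assoc (f (suc (suc M)) 0 n) (antidiagonal (λ i j → f (suc i) (suc j)) M n) (f 0 (suc (suc M)) n))) ⟩
  f (suc (suc M)) 0 ⊕ antidiagonal (λ i j → f (suc i) (suc j)) M ⊕ f 0 (suc (suc M)) ∎

-- Along i + j = M + 1 an interior entry splits into contributions of its two neighbours on i + j =
-- M, and an end has one neighbour only: Pascal's rule for whole rows.
antidiagonal-pascal : ∀ f A B → (∀ i j → f (suc i) (suc j) ≋ A i (suc j) ⊕ B (suc i) j) → (∀ i → f (suc i) 0 ≋ A i 0) →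
  (∀ j → f 0 (suc j) ≋ B 0 j) → ∀ M → antidiagonal f (suc M) ≋ antidiagonal A M ⊕ antidiagonal B M
antidiagonal-pascal f A B inner left right zero    = ⊕-cong (left 0) (right 0)
antidiagonal-pascal f A B inner left right (suc M) = begin
  f (2 ℕ.+ M) 0 ⊕ antidiagonal (λ i j → f i (suc j)) (suc M)
    ≈⟨ ⊕-cong (left (suc M)) (antidiagonal-last (λ i j → f i (suc j)) M) ⟩
  A (suc M) 0 ⊕ (antidiagonal (λ i j → f (suc i) (suc j)) M ⊕ f 0 (2 ℕ.+ M))
    ≈⟨ ⊕-congˡ (A (suc M) 0) (⊕-cong (≋-trans (antidiagonal-cong inner M) (antidiagonal-⊕ (λ i j → A i (suc j)) (λ i j → B (suc i) j) M)) (right (suc M))) ⟩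
  A (suc M) 0 ⊕ ((antidiagonal (λ i j → A i (suc j)) M ⊕ antidiagonal (λ i j → B (suc i) j) M) ⊕ B 0 (suc M))
    ≈⟨ pointwise (λ n → arith (A (suc M) 0 n) (antidiagonal (λ i j → A i (suc j)) M n) (antidiagonal (λ i j → B (suc i) j) M n) (B 0 (suc M) n)) ⟩
  antidiagonal A (suc M) ⊕ (antidiagonal (λ i j → B (suc i) j) M ⊕ B 0 (suc M))
    ≈⟨ ⊕-congˡ (antidiagonal A (suc M)) (antidiagonal-last B M) ⟨
  antidiagonal A (suc M) ⊕ antidiagonal B (suc M) ∎
  where
  arith : ∀ a x y b → a + ((x + y) + b) ≡ (a + x) + (y + b)
  arith = solve-∀

-- A bilateral sum over -N ≤ n ≤ N: f gives the terms n ≥ 0 and g those with n < 0.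
centred : (ℕ → PS) → (ℕ → PS) → ℕ → PS
centred f g zero    = f 0
centred f g (suc N) = centred f g N ⊕ (f (suc N) ⊕ g (suc N))

-- Reindexes the row i + j = 2N by n = j - N. The induction removes both ends at once, and d = N - n
-- is passed as an argument instead of a difference.
antidiagonal-centred : ∀ f h⁺ h⁻ N → (∀ d n → d ℕ.+ n ≡ N → f d (d ℕ.+ n ℕ.+ n) ≋ h⁺ n) → (∀ d n → d ℕ.+ n ≡ N → f (d ℕ.+ n ℕ.+ n) d ≋ h⁻ n) →
  antidiagonal f (N ℕ.+ N) ≋ centred h⁺ h⁻ N
antidiagonal-centred f h⁺ h⁻ zero    p q = p 0 0 refl
antidiagonal-centred f h⁺ h⁻ (suc N) p q rewrite ℕₚ.+-suc N N = begin
  f (2 ℕ.+ (N ℕ.+ N)) 0 ⊕ antidiagonal (λ i j → f i (suc j)) (suc (N ℕ.+ N))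
    ≈⟨ ⊕-congˡ (f (2 ℕ.+ (N ℕ.+ N)) 0) (antidiagonal-last (λ i j → f i (suc j)) (N ℕ.+ N)) ⟩
  f (2 ℕ.+ (N ℕ.+ N)) 0 ⊕ (antidiagonal (λ i j → f (suc i) (suc j)) (N ℕ.+ N) ⊕ f 0 (2 ℕ.+ (N ℕ.+ N)))
    ≈⟨ ⊕-cong (outer (λ i j → f j i) h⁻ q) (⊕-cong (antidiagonal-centred (λ i j → f (suc i) (suc j)) h⁺ h⁻ N (λ d n e → p (suc d) n (cong suc e)) (λ d n e → q (suc d) n (cong suc e))) (outer f h⁺ p)) ⟩
  h⁻ (suc N) ⊕ (centred h⁺ h⁻ N ⊕ h⁺ (suc N))
    ≈⟨ pointwise (λ n → arith (h⁻ (suc N) n) (centred h⁺ h⁻ N n) (h⁺ (suc N) n)) ⟩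
  centred h⁺ h⁻ N ⊕ (h⁺ (suc N) ⊕ h⁻ (suc N)) ∎
  where
  arith : ∀ x y z → x + (y + z) ≡ y + (z + x)
  arith = solve-∀
  outer : ∀ (g : ℕ → ℕ → PS) (h : ℕ → PS) → (∀ d n → d ℕ.+ n ≡ suc N → g d (d ℕ.+ n ℕ.+ n) ≋ h n) → g 0 (2 ℕ.+ (N ℕ.+ N)) ≋ h (suc N)
  outer g h r = subst (λ m → g 0 m ≋ h (suc N)) (cong suc (ℕₚ.+-suc N N)) (r 0 (suc N) refl)

module _ (k : ℕ) where

  -- The Gaussian binomial [i+j; j] in base q^k.
  gauss : ℕ → ℕ → PS
  gauss zero    j       = one
  gauss (suc i) zero    = one
  gauss (suc i) (suc j) = gauss (suc i) j ⊕ mono (suc j ℕ.* k) ⊛ gauss i (suc j)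

  poch : ℕ → PS
  poch zero    = one
  poch (suc N) = poch N ⊛ (one ⊟ mono (suc N ℕ.* k))

  -- The closed form of the Gaussian binomial without division, by the q-Pascal rule.
  gauss-poch : ∀ i j → gauss i j ⊛ poch i ⊛ poch j ≋ poch (i ℕ.+ j)
  gauss-poch zero    j    = unit-leftˡ (poch j)
  gauss-poch (suc i) zero = ≋-trans (unit-middle (poch (suc i))) (pointwise λ n → cong (λ m → poch (suc m) n) (sym (ℕₚ.+-identityʳ i)))
  gauss-poch (suc i) (suc j) = begin
    (gauss (suc i) j ⊕ m ⊛ gauss i (suc j)) ⊛ poch (suc i) ⊛ poch (suc j)
      ≈⟨ qb-step (gauss (suc i) j) (gauss i (suc j)) m (poch i) (mono (suc i ℕ.* k)) (poch j) ⟩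
    gauss (suc i) j ⊛ poch (suc i) ⊛ poch j ⊛ (one ⊟ m) ⊕ m ⊛ (gauss i (suc j) ⊛ poch i ⊛ poch (suc j) ⊛ (one ⊟ mono (suc i ℕ.* k)))
      ≈⟨ ⊕-cong (⊛-congʳ (one ⊟ m) (≋-trans (gauss-poch (suc i) j) same))
                (⊛-congˡ m (⊛-congʳ (one ⊟ mono (suc i ℕ.* k)) (gauss-poch i (suc j)))) ⟩
    S ⊛ (one ⊟ m) ⊕ m ⊛ (S ⊛ (one ⊟ mono (suc i ℕ.* k)))
      ≈⟨ qb-merge S m (mono (suc i ℕ.* k)) ⟩
    S ⊛ (one ⊟ m ⊛ mono (suc i ℕ.* k))
      ≈⟨ ⊛-congˡ S (1⊟-cong (≋-trans (≋-sym (mono-+ (suc j ℕ.* k) (suc i ℕ.* k))) (mono-cong (exponent i j k)))) ⟩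
    S ⊛ (one ⊟ mono (suc (i ℕ.+ suc j) ℕ.* k)) ∎
    where
    m S : PS
    m = mono (suc j ℕ.* k)
    S = poch (i ℕ.+ suc j)
    same : poch (suc i ℕ.+ j) ≋ S
    same = pointwise λ n → cong (λ m → poch m n) (sym (ℕₚ.+-suc i j))
    exponent : ∀ i j k → suc j ℕ.* k ℕ.+ suc i ℕ.* k ≡ suc (i ℕ.+ suc j) ℕ.* k
    exponent = ℕ-Solver.solve-∀

  -- The product of X - q^{km}·Y over 0 ≤ m < M. Being homogeneous in X and Y, it lets the triple
  -- product be centred without negative powers of q.
  binom : ℕ → PS → PS → PS
  binom zero    X Y = one
  binom (suc M) X Y = (X ⊟ Y) ⊛ binom M X (mono k ⊛ Y)

  power-dilated : ∀ Y j → power (mono k ⊛ Y) j ≋ mono (j ℕ.* k) ⊛ power Y j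
  power-dilated Y zero    = ≋-trans (≋-sym mono-0) (≋-sym (⊛-identityʳ (mono 0)))
  power-dilated Y (suc j) = ≋-trans (⊛-congˡ (mono k ⊛ Y) (power-dilated Y j))
    (≋-trans (≋-sym (regroup (mono k) (mono (j ℕ.* k)) Y (power Y j))) (⊛-congʳ (Y ⊛ power Y j) (≋-sym (mono-+ k (j ℕ.* k)))))

  binomTerm : PS → PS → ℕ → ℕ → PS
  binomTerm X Y i j = cst (alt j) ⊛ mono (k ℕ.* tri j) ⊛ gauss i j ⊛ power X i ⊛ power Y j

  gauss-0ʳ : ∀ i → gauss i 0 ≋ one
  gauss-0ʳ zero    = ≋-refl
  gauss-0ʳ (suc i) = ≋-refl

  mono-tri : ∀ j → mono (k ℕ.* tri (suc j)) ≋ mono (k ℕ.* tri j) ⊛ mono (j ℕ.* k)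
  mono-tri j = ≋-trans (mono-cong (exponent k j (tri j))) (mono-+ (k ℕ.* tri j) (j ℕ.* k))
    where
    exponent : ∀ k j t → k ℕ.* (j ℕ.+ t) ≡ k ℕ.* t ℕ.+ j ℕ.* k
    exponent = ℕ-Solver.solve-∀

  -- The factor X - Y is multiplied into the row for M, taken with q^k·Y for Y; the q-Pascal rule
  -- merges the two resulting rows.
  q-binomial : ∀ M X Y → binom M X Y ≋ antidiagonal (binomTerm X Y) M
  q-binomial zero    X Y = ≋-sym (≋-trans (⊛-congʳ one (⊛-congʳ one (⊛-congʳ one (⊛-congˡ one (≋-trans (mono-cong (ℕₚ.*-zeroʳ k)) mono-0)))))
    (≋-trans (⊛-identityʳ _) (≋-trans (⊛-identityʳ _) (≋-trans (⊛-identityʳ _) (⊛-identityʳ one)))))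
  q-binomial (suc M) X Y = begin
    (X ⊟ Y) ⊛ binom M X Y′
      ≈⟨ ⊛-congˡ (X ⊟ Y) (q-binomial M X Y′) ⟩
    (X ⊟ Y) ⊛ antidiagonal (binomTerm X Y′) M
      ≈⟨ distribʳ-∸ X Y (antidiagonal (binomTerm X Y′) M) ⟩
    X ⊛ antidiagonal (binomTerm X Y′) M ⊕ ⊖ (Y ⊛ antidiagonal (binomTerm X Y′) M)
      ≈⟨ ⊕-cong (antidiagonal-⊛ X (binomTerm X Y′) M)
                (≋-trans (antidiagonal-⊖ (λ i j → Y ⊛ binomTerm X Y′ i j) M) (⊖-cong (antidiagonal-⊛ Y (binomTerm X Y′) M))) ⟨
    antidiagonal (λ i j → X ⊛ binomTerm X Y′ i j) M ⊕ antidiagonal (λ i j → ⊖ (Y ⊛ binomTerm X Y′ i j)) M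
      ≈⟨ antidiagonal-pascal (binomTerm X Y) (λ i j → X ⊛ binomTerm X Y′ i j) (λ i j → ⊖ (Y ⊛ binomTerm X Y′ i j)) inner left right M ⟨
    antidiagonal (binomTerm X Y) (suc M) ∎
    where
    Y′ : PS
    Y′ = mono k ⊛ Y
    inner : ∀ i j → binomTerm X Y (suc i) (suc j) ≋ X ⊛ binomTerm X Y′ i (suc j) ⊕ ⊖ (Y ⊛ binomTerm X Y′ (suc i) j)
    inner i j = begin
      cst (alt (suc j)) ⊛ mono (k ℕ.* tri (suc j)) ⊛ (gauss (suc i) j ⊕ mono (suc j ℕ.* k) ⊛ gauss i (suc j)) ⊛ (X ⊛ power X i) ⊛ (Y ⊛ power Y j)
        ≈⟨ ⊛-congʳ (Y ⊛ power Y j) (⊛-congʳ (X ⊛ power X i) (⊛-cong (⊛-cong (cst-neg (alt j)) (mono-tri j))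
             (⊕-congˡ (gauss (suc i) j) (⊛-congʳ (gauss i (suc j)) (mono-+ k (j ℕ.* k)))))) ⟩
      (⊖ s) ⊛ (t ⊛ Q) ⊛ (gauss (suc i) j ⊕ mono k ⊛ Q ⊛ gauss i (suc j)) ⊛ (X ⊛ power X i) ⊛ (Y ⊛ power Y j)
        ≈⟨ pascal-term s t Q (gauss (suc i) j) (gauss i (suc j)) (power X i) X (power Y j) Y (mono k) ⟩
      X ⊛ ((⊖ s) ⊛ (t ⊛ Q) ⊛ gauss i (suc j) ⊛ power X i ⊛ (mono k ⊛ Q ⊛ (Y ⊛ power Y j))) ⊕ ⊖ (Y ⊛ (s ⊛ t ⊛ gauss (suc i) j ⊛ (X ⊛ power X i) ⊛ (Q ⊛ power Y j)))
        ≈⟨ ⊕-cong (⊛-congˡ X (⊛-cong (⊛-congʳ (power X i) (⊛-congʳ (gauss i (suc j)) (⊛-cong (cst-neg (alt j)) (mono-tri j))))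
                                     (≋-trans (power-dilated Y (suc j)) (⊛-congʳ (Y ⊛ power Y j) (mono-+ k (j ℕ.* k))))))
                  (⊖-cong (⊛-congˡ Y (⊛-congˡ (s ⊛ t ⊛ gauss (suc i) j ⊛ (X ⊛ power X i)) (power-dilated Y j)))) ⟨
      X ⊛ binomTerm X Y′ i (suc j) ⊕ ⊖ (Y ⊛ binomTerm X Y′ (suc i) j) ∎
      where
      s t Q : PS
      s = cst (alt j)
      t = mono (k ℕ.* tri j)
      Q = mono (j ℕ.* k)
    left : ∀ i → binomTerm X Y (suc i) 0 ≋ X ⊛ binomTerm X Y′ i 0
    left i = ≋-trans (pascal-left c X (power X i)) (⊛-congˡ X (⊛-congʳ one (⊛-congʳ (power X i) (⊛-congˡ c (≋-sym (gauss-0ʳ i))))))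
      where
      c : PS
      c = cst (alt 0) ⊛ mono (k ℕ.* tri 0)
    right : ∀ j → binomTerm X Y 0 (suc j) ≋ ⊖ (Y ⊛ binomTerm X Y′ 0 j)
    right j = ≋-trans (⊛-congʳ (Y ⊛ power Y j) (⊛-congʳ one (⊛-congʳ one (⊛-cong (cst-neg (alt j)) (mono-tri j)))))
      (≋-trans (pascal-right (cst (alt j)) (mono (k ℕ.* tri j)) (mono (j ℕ.* k)) Y (power Y j))
        (⊖-cong (⊛-congˡ Y (⊛-congˡ (cst (alt j) ⊛ mono (k ℕ.* tri j) ⊛ one ⊛ one) (≋-sym (power-dilated Y j))))))

  binom-cong : ∀ N {X X′ Y Y′} → X ≋ X′ → Y ≋ Y′ → binom N X Y ≋ binom N X′ Y′
  binom-cong zero    p q = ≋-refl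
  binom-cong (suc N) p q = ⊛-cong (⊟-cong p q) (binom-cong N p (⊛-congˡ (mono k) q))

  binom-scale : ∀ N c X Y → binom N (c ⊛ X) (c ⊛ Y) ≋ power c N ⊛ binom N X Y
  binom-scale zero    c X Y = ≋-sym (⊛-identityʳ one)
  binom-scale (suc N) c X Y = begin
    (c ⊛ X ⊟ c ⊛ Y) ⊛ binom N (c ⊛ X) (mono k ⊛ (c ⊛ Y))
      ≈⟨ ⊛-congˡ (c ⊛ X ⊟ c ⊛ Y) (≋-trans (binom-cong N (≋-refl {c ⊛ X}) (*-swap (mono k) c Y)) (binom-scale N c X (mono k ⊛ Y))) ⟩
    (c ⊛ X ⊟ c ⊛ Y) ⊛ (power c N ⊛ binom N X (mono k ⊛ Y))
      ≈⟨ scale-pair c X Y (power c N) (binom N X (mono k ⊛ Y)) ⟩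
    c ⊛ power c N ⊛ ((X ⊟ Y) ⊛ binom N X (mono k ⊛ Y)) ∎

  power-shift : ∀ M Y → power (mono k) M ⊛ (mono k ⊛ Y) ≋ power (mono k) (suc M) ⊛ Y
  power-shift M Y = ≋-trans (*-swap (power (mono k) M) (mono k) Y) (≋-sym (⊛-assoc (mono k) (power (mono k) M) Y))

  binom-append : ∀ M N X Y → binom (M ℕ.+ N) X Y ≋ binom M X Y ⊛ binom N X (power (mono k) M ⊛ Y)
  binom-append zero    N X Y = ≋-trans (binom-cong N (≋-refl {X}) (≋-sym (⊛-identityˡ Y))) (≋-sym (⊛-identityˡ (binom N X (one ⊛ Y))))
  binom-append (suc M) N X Y = begin
    (X ⊟ Y) ⊛ binom (M ℕ.+ N) X (mono k ⊛ Y)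
      ≈⟨ ⊛-congˡ (X ⊟ Y) (≋-trans (binom-append M N X (mono k ⊛ Y)) (⊛-congˡ (binom M X (mono k ⊛ Y)) (binom-cong N (≋-refl {X}) (power-shift M Y)))) ⟩
    (X ⊟ Y) ⊛ (binom M X (mono k ⊛ Y) ⊛ binom N X (power (mono k) (suc M) ⊛ Y))
      ≈⟨ ⊛-assoc (X ⊟ Y) (binom M X (mono k ⊛ Y)) (binom N X (power (mono k) (suc M) ⊛ Y)) ⟨
    (X ⊟ Y) ⊛ binom M X (mono k ⊛ Y) ⊛ binom N X (power (mono k) (suc M) ⊛ Y) ∎

  binom-snoc : ∀ N X Y → binom (suc N) X Y ≋ binom N X Y ⊛ (X ⊟ power (mono k) N ⊛ Y)
  binom-snoc zero    X Y = ≋-trans (⊛-comm (X ⊟ Y) one) (⊛-congˡ one (⊟-cong (≋-refl {X}) (≋-sym (⊛-identityˡ Y))))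
  binom-snoc (suc N) X Y = begin
    (X ⊟ Y) ⊛ binom (suc N) X (mono k ⊛ Y)
      ≈⟨ ⊛-congˡ (X ⊟ Y) (≋-trans (binom-snoc N X (mono k ⊛ Y)) (⊛-congˡ (binom N X (mono k ⊛ Y)) (⊟-cong (≋-refl {X}) (power-shift N Y)))) ⟩
    (X ⊟ Y) ⊛ (binom N X (mono k ⊛ Y) ⊛ (X ⊟ power (mono k) (suc N) ⊛ Y))
      ≈⟨ ⊛-assoc (X ⊟ Y) (binom N X (mono k ⊛ Y)) (X ⊟ power (mono k) (suc N) ⊛ Y) ⟨
    (X ⊟ Y) ⊛ binom N X (mono k ⊛ Y) ⊛ (X ⊟ power (mono k) (suc N) ⊛ Y) ∎

  -- The product (q^c;q^k)_N.
  factors : ℕ → ℕ → PS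
  factors c zero    = one
  factors c (suc N) = factors c N ⊛ (one ⊟ mono (c ℕ.+ N ℕ.* k))

  binom-one : ∀ c N → binom N one (mono c) ≋ factors c N
  binom-one c zero    = ≋-refl
  binom-one c (suc N) = ≋-trans (binom-snoc N one (mono c)) (⊛-cong (binom-one c N) (1⊟-cong
    (≋-trans (⊛-congʳ (mono c) (power-mono k N)) (≋-trans (⊛-comm (mono (N ℕ.* k)) (mono c)) (≋-sym (mono-+ c (N ℕ.* k)))))))

  binomTerm-mono : ∀ x a i j → binomTerm (mono x) (mono a) i j ≋ cst (alt j) ⊛ mono (k ℕ.* tri j ℕ.+ i ℕ.* x ℕ.+ j ℕ.* a) ⊛ gauss i j
  binomTerm-mono x a i j = begin
    cst (alt j) ⊛ mono (k ℕ.* tri j) ⊛ gauss i j ⊛ power (mono x) i ⊛ power (mono a) j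
      ≈⟨ gather-monos (cst (alt j)) (mono (k ℕ.* tri j)) (gauss i j) (power (mono x) i) (power (mono a) j) ⟩
    cst (alt j) ⊛ (mono (k ℕ.* tri j) ⊛ power (mono x) i ⊛ power (mono a) j) ⊛ gauss i j
      ≈⟨ ⊛-congʳ (gauss i j) (⊛-congˡ (cst (alt j)) (⊛-cong (⊛-congˡ (mono (k ℕ.* tri j)) (power-mono x i)) (power-mono a j))) ⟩
    cst (alt j) ⊛ (mono (k ℕ.* tri j) ⊛ mono (i ℕ.* x) ⊛ mono (j ℕ.* a)) ⊛ gauss i j
      ≈⟨ ⊛-congʳ (gauss i j) (⊛-congˡ (cst (alt j)) (≋-trans (mono-+ (k ℕ.* tri j ℕ.+ i ℕ.* x) (j ℕ.* a))
           (⊛-congʳ (mono (j ℕ.* a)) (mono-+ (k ℕ.* tri j) (i ℕ.* x))))) ⟨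
    cst (alt j) ⊛ mono (k ℕ.* tri j ℕ.+ i ℕ.* x ℕ.+ j ℕ.* a) ⊛ gauss i j ∎

alt-+ : ∀ m n → alt (m ℕ.+ n) ≡ alt m * alt n
alt-+ zero    n = sym (ℤₚ.*-identityˡ (alt n))
alt-+ (suc m) n = trans (cong -_ (alt-+ m n)) (ℤₚ.neg-distribˡ-* (alt m) (alt n))

alt-square : ∀ n → alt n * alt n ≡ 1ℤ
alt-square zero    = refl
alt-square (suc n) = trans (neg-square (alt n)) (alt-square n)
  where
  neg-square : ∀ x → (- x) * (- x) ≡ x * x
  neg-square = solve-∀

cst-* : ∀ c d → cst (c * d) ≋ cst c ⊛ cst d
cst-* = _-Raw-AlmostCommutative⟶_.*-homo cst-homomorphism

tri-+ : ∀ m n → tri (m ℕ.+ n) ≡ tri m ℕ.+ tri n ℕ.+ m ℕ.* n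
tri-+ zero    n = sym (ℕₚ.+-identityʳ (tri n))
tri-+ (suc m) n = trans (cong (m ℕ.+ n ℕ.+_) (tri-+ m n)) (arith m n (tri m) (tri n))
  where
  arith : ∀ m n x y → m ℕ.+ n ℕ.+ (x ℕ.+ y ℕ.+ m ℕ.* n) ≡ m ℕ.+ x ℕ.+ y ℕ.+ (n ℕ.+ m ℕ.* n)
  arith = ℕ-Solver.solve-∀

tri-square : ∀ n → tri n ℕ.+ tri n ℕ.+ n ≡ n ℕ.* n
tri-square zero    = refl
tri-square (suc n) = trans (arith₁ n (tri n)) (trans (cong (λ x → x ℕ.+ n ℕ.+ n ℕ.+ 1) (tri-square n)) (arith₂ n))
  where
  arith₁ : ∀ n t → n ℕ.+ t ℕ.+ (n ℕ.+ t) ℕ.+ suc n ≡ t ℕ.+ t ℕ.+ n ℕ.+ n ℕ.+ n ℕ.+ 1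
  arith₁ = ℕ-Solver.solve-∀
  arith₂ : ∀ n → n ℕ.* n ℕ.+ n ℕ.+ n ℕ.+ 1 ≡ suc n ℕ.* suc n
  arith₂ = ℕ-Solver.solve-∀

centred-⊛ : ∀ u f g N → centred (λ n → u ⊛ f n) (λ n → u ⊛ g n) N ≋ u ⊛ centred f g N
centred-⊛ u f g zero    = ≋-refl
centred-⊛ u f g (suc N) = ≋-trans (⊕-cong (centred-⊛ u f g N) (≋-sym (⊛-distribˡ u (f (suc N)) (g (suc N)))))
  (≋-sym (⊛-distribˡ u (centred f g N) (f (suc N) ⊕ g (suc N))))

centred-≈ : ∀ {L f f′ g g′} N → (∀ n → n ℕ.≤ N → f n ≈[ L ] f′ n) → (∀ n → n ℕ.≤ N → g n ≈[ L ] g′ n) →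
  centred f g N ≈[ L ] centred f′ g′ N
centred-≈ zero    p q = p 0 z≤n
centred-≈ (suc N) p q = ⊕-≈ (centred-≈ N (λ n le → p n (ℕₚ.m≤n⇒m≤1+n le)) (λ n le → q n (ℕₚ.m≤n⇒m≤1+n le)))
  (⊕-≈ (p (suc N) ℕₚ.≤-refl) (q (suc N) ℕₚ.≤-refl))

module _ (a b : ℕ) where
  private
    k : ℕ
    k = a ℕ.+ b
    -- `T N` is the sum of km + a over m < N, the power of q taken out of the lower N factors of the
    -- product of length 2N; N·(N·k) comes out of the upper N.
    T C : ℕ → ℕ
    T N = k ℕ.* tri N ℕ.+ a ℕ.* N
    C N = T N ℕ.+ N ℕ.* (N ℕ.* k)
    X : ℕ → PS
    X N = mono (N ℕ.* k)

  -- For m < N the factor q^{Nk} - q^{km+a} equals -q^{km+a}·(1 - q^{b+(N-1-m)k}), because k = a +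
  -- b. This is where b enters.
  lower-half : ∀ N → binom k N (X N) (mono a) ≋ cst (alt N) ⊛ mono (T N) ⊛ factors k b N
  lower-half zero    = ≋-sym (≋-trans (⊛-identityʳ _) (≋-trans (⊛-identityˡ _) (≋-trans (mono-cong (T-0 k a)) mono-0)))
    where
    T-0 : ∀ k a → k ℕ.* 0 ℕ.+ a ℕ.* 0 ≡ 0
    T-0 = ℕ-Solver.solve-∀
  lower-half (suc N) = begin
    (X (suc N) ⊟ mono a) ⊛ binom k N (X (suc N)) (mono k ⊛ mono a)
      ≈⟨ ⊛-cong (⊟-cong (≋-trans (mono-cong (ℕₚ.+-assoc a b (N ℕ.* k))) (mono-+ a (b ℕ.+ N ℕ.* k))) (≋-refl {mono a}))
                (≋-trans (binom-cong k N (mono-+ k (N ℕ.* k)) (≋-refl {mono k ⊛ mono a})) (binom-scale k N (mono k) (X N) (mono a))) ⟩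
    (mono a ⊛ mono (b ℕ.+ N ℕ.* k) ⊟ mono a) ⊛ (power (mono k) N ⊛ binom k N (X N) (mono a))
      ≈⟨ ⊛-congˡ (mono a ⊛ mono (b ℕ.+ N ℕ.* k) ⊟ mono a) (⊛-cong (power-mono k N) (lower-half N)) ⟩
    (mono a ⊛ mono (b ℕ.+ N ℕ.* k) ⊟ mono a) ⊛ (X N ⊛ (cst (alt N) ⊛ mono (T N) ⊛ factors k b N))
      ≈⟨ reflect-factor (mono a) (mono (b ℕ.+ N ℕ.* k)) (X N) (cst (alt N)) (mono (T N)) (factors k b N) ⟩
    (⊖ cst (alt N)) ⊛ (mono (T N) ⊛ (X N ⊛ mono a)) ⊛ factors k b (suc N)
      ≈⟨ ⊛-congʳ (factors k b (suc N)) (⊛-cong (cst-neg (alt N)) (≋-trans (mono-cong (T-suc k a N (tri N)))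
           (≋-trans (mono-+ (T N) (N ℕ.* k ℕ.+ a)) (⊛-congˡ (mono (T N)) (mono-+ (N ℕ.* k) a))))) ⟨
    cst (alt (suc N)) ⊛ mono (T (suc N)) ⊛ factors k b (suc N) ∎
    where
    T-suc : ∀ k a N t → k ℕ.* (N ℕ.+ t) ℕ.+ a ℕ.* suc N ≡ k ℕ.* t ℕ.+ a ℕ.* N ℕ.+ (N ℕ.* k ℕ.+ a)
    T-suc = ℕ-Solver.solve-∀

  -- Each factor q^{Nk} - q^{(N+m)k+a} releases q^{Nk} and leaves 1 - q^{a+mk}.
  upper-half : ∀ N → binom k N (X N) (power (mono k) N ⊛ mono a) ≋ mono (N ℕ.* (N ℕ.* k)) ⊛ factors k a N
  upper-half N = begin
    binom k N (X N) (power (mono k) N ⊛ mono a)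
      ≈⟨ binom-cong k N (≋-sym (⊛-identityʳ (X N))) (⊛-congʳ (mono a) (power-mono k N)) ⟩
    binom k N (X N ⊛ one) (X N ⊛ mono a)
      ≈⟨ binom-scale k N (X N) one (mono a) ⟩
    power (X N) N ⊛ binom k N one (mono a)
      ≈⟨ ⊛-cong (power-mono (N ℕ.* k) N) (binom-one k a N) ⟩
    mono (N ℕ.* (N ℕ.* k)) ⊛ factors k a N ∎

  binom-factors : ∀ N → binom k (N ℕ.+ N) (X N) (mono a) ≋ cst (alt N) ⊛ (mono (C N) ⊛ (factors k b N ⊛ factors k a N))
  binom-factors N = begin
    binom k (N ℕ.+ N) (X N) (mono a)
      ≈⟨ binom-append k N N (X N) (mono a) ⟩
    binom k N (X N) (mono a) ⊛ binom k N (X N) (power (mono k) N ⊛ mono a)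
      ≈⟨ ⊛-cong (lower-half N) (upper-half N) ⟩
    cst (alt N) ⊛ mono (T N) ⊛ factors k b N ⊛ (mono (N ℕ.* (N ℕ.* k)) ⊛ factors k a N)
      ≈⟨ regroup₄ (cst (alt N)) (mono (T N)) (factors k b N) (mono (N ℕ.* (N ℕ.* k))) (factors k a N) ⟩
    cst (alt N) ⊛ (mono (T N) ⊛ mono (N ℕ.* (N ℕ.* k)) ⊛ (factors k b N ⊛ factors k a N))
      ≈⟨ ⊛-congˡ (cst (alt N)) (⊛-congʳ (factors k b N ⊛ factors k a N) (mono-+ (T N) (N ℕ.* (N ℕ.* k)))) ⟨
    cst (alt N) ⊛ (mono (C N) ⊛ (factors k b N ⊛ factors k a N)) ∎

  bareTerm : ℕ → ℕ → PS
  bareTerm c n = cst (alt n) ⊛ mono (k ℕ.* tri n ℕ.+ c ℕ.* n)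

  positiveTerm negativeTerm : ℕ → ℕ → PS
  positiveTerm N n = bareTerm a n ⊛ gauss k (N ℕ.∸ n) (N ℕ.∸ n ℕ.+ n ℕ.+ n)
  negativeTerm N n = bareTerm b n ⊛ gauss k (N ℕ.∸ n ℕ.+ n ℕ.+ n) (N ℕ.∸ n)

  private
    factor-out : ∀ N n i j x → alt j ≡ alt N * alt n → k ℕ.* tri j ℕ.+ i ℕ.* (N ℕ.* k) ℕ.+ j ℕ.* a ≡ C N ℕ.+ x →
      binomTerm k (X N) (mono a) i j ≋ cst (alt N) ⊛ (mono (C N) ⊛ (cst (alt n) ⊛ mono x ⊛ gauss k i j))
    factor-out N n i j x sign exponent = begin
      binomTerm k (X N) (mono a) i j
        ≈⟨ binomTerm-mono k (N ℕ.* k) a i j ⟩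
      cst (alt j) ⊛ mono (k ℕ.* tri j ℕ.+ i ℕ.* (N ℕ.* k) ℕ.+ j ℕ.* a) ⊛ gauss k i j
        ≈⟨ ⊛-congʳ (gauss k i j) (⊛-cong (≋-trans (pointwise λ m → cong (λ c → cst c m) sign) (cst-* (alt N) (alt n)))
                                         (≋-trans (mono-cong exponent) (mono-+ (C N) x))) ⟩
      cst (alt N) ⊛ cst (alt n) ⊛ (mono (C N) ⊛ mono x) ⊛ gauss k i j
        ≈⟨ split-constant (cst (alt N)) (cst (alt n)) (mono (C N)) (mono x) (gauss k i j) ⟩
      cst (alt N) ⊛ (mono (C N) ⊛ (cst (alt n) ⊛ mono x ⊛ gauss k i j)) ∎

    sign⁻ : ∀ d n → alt d ≡ alt (d ℕ.+ n) * alt n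
    sign⁻ d n = sym (trans (cong (_* alt n) (alt-+ d n)) (trans (ℤₚ.*-assoc (alt d) (alt n) (alt n))
      (trans (cong (alt d *_) (alt-square n)) (ℤₚ.*-identityʳ (alt d)))))

    exponent⁺ : ∀ d n → k ℕ.* tri (d ℕ.+ n ℕ.+ n) ℕ.+ d ℕ.* ((d ℕ.+ n) ℕ.* k) ℕ.+ (d ℕ.+ n ℕ.+ n) ℕ.* a
                        ≡ C (d ℕ.+ n) ℕ.+ (k ℕ.* tri n ℕ.+ a ℕ.* n)
    exponent⁺ d n = trans (cong (λ t → k ℕ.* t ℕ.+ d ℕ.* ((d ℕ.+ n) ℕ.* k) ℕ.+ (d ℕ.+ n ℕ.+ n) ℕ.* a) (tri-+ (d ℕ.+ n) n))
      (arith a k d n (tri (d ℕ.+ n)) (tri n))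
      where
      arith : ∀ a k d n x y → k ℕ.* (x ℕ.+ y ℕ.+ (d ℕ.+ n) ℕ.* n) ℕ.+ d ℕ.* ((d ℕ.+ n) ℕ.* k) ℕ.+ (d ℕ.+ n ℕ.+ n) ℕ.* a
        ≡ k ℕ.* x ℕ.+ a ℕ.* (d ℕ.+ n) ℕ.+ (d ℕ.+ n) ℕ.* ((d ℕ.+ n) ℕ.* k) ℕ.+ (k ℕ.* y ℕ.+ a ℕ.* n)
      arith = ℕ-Solver.solve-∀

    exponent⁻ : ∀ d n → k ℕ.* tri d ℕ.+ (d ℕ.+ n ℕ.+ n) ℕ.* ((d ℕ.+ n) ℕ.* k) ℕ.+ d ℕ.* a
                        ≡ C (d ℕ.+ n) ℕ.+ (k ℕ.* tri n ℕ.+ b ℕ.* n)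
    exponent⁻ d n = trans (arith₁ a b d n (tri d))
      -- n² is traded for 2·tri n + n, so that `tri-+` can assemble tri (d + n).
      (trans (cong (λ s → k ℕ.* tri d ℕ.+ k ℕ.* (d ℕ.* n) ℕ.+ (d ℕ.+ n) ℕ.* ((d ℕ.+ n) ℕ.* k) ℕ.+ k ℕ.* s ℕ.+ d ℕ.* a) (sym (tri-square n)))
      (trans (arith₂ a b d n (tri d) (tri n))
        (cong (λ t → k ℕ.* t ℕ.+ a ℕ.* (d ℕ.+ n) ℕ.+ (d ℕ.+ n) ℕ.* ((d ℕ.+ n) ℕ.* k) ℕ.+ (k ℕ.* tri n ℕ.+ b ℕ.* n)) (sym (tri-+ d n)))))
      where
      arith₁ : ∀ a b d n x → (a ℕ.+ b) ℕ.* x ℕ.+ (d ℕ.+ n ℕ.+ n) ℕ.* ((d ℕ.+ n) ℕ.* (a ℕ.+ b)) ℕ.+ d ℕ.* a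
        ≡ (a ℕ.+ b) ℕ.* x ℕ.+ (a ℕ.+ b) ℕ.* (d ℕ.* n) ℕ.+ (d ℕ.+ n) ℕ.* ((d ℕ.+ n) ℕ.* (a ℕ.+ b)) ℕ.+ (a ℕ.+ b) ℕ.* (n ℕ.* n) ℕ.+ d ℕ.* a
      arith₁ = ℕ-Solver.solve-∀
      arith₂ : ∀ a b d n x y → (a ℕ.+ b) ℕ.* x ℕ.+ (a ℕ.+ b) ℕ.* (d ℕ.* n) ℕ.+ (d ℕ.+ n) ℕ.* ((d ℕ.+ n) ℕ.* (a ℕ.+ b)) ℕ.+ (a ℕ.+ b) ℕ.* (y ℕ.+ y ℕ.+ n) ℕ.+ d ℕ.* a
        ≡ (a ℕ.+ b) ℕ.* (x ℕ.+ y ℕ.+ d ℕ.* n) ℕ.+ a ℕ.* (d ℕ.+ n) ℕ.+ (d ℕ.+ n) ℕ.* ((d ℕ.+ n) ℕ.* (a ℕ.+ b)) ℕ.+ ((a ℕ.+ b) ℕ.* y ℕ.+ b ℕ.* n)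
      arith₂ = ℕ-Solver.solve-∀

  -- Cauchy's finite form of the triple product: the q-binomial theorem of length 2N at X = q^{Nk},
  -- Y = q^a. Product and centred sum carry the same sign and the same power q^{`C N`}, which are
  -- cancelled.
  finite-triple-product : ∀ N → factors k b N ⊛ factors k a N ≋ centred (positiveTerm N) (negativeTerm N) N
  finite-triple-product N = mono-cancel (C N) _ _ (begin
    mono (C N) ⊛ (factors k b N ⊛ factors k a N)
      ≈⟨ unsign (mono (C N) ⊛ (factors k b N ⊛ factors k a N)) ⟨
    s ⊛ (s ⊛ (mono (C N) ⊛ (factors k b N ⊛ factors k a N)))
      ≈⟨ ⊛-congˡ s (binom-factors N) ⟨
    s ⊛ binom k (N ℕ.+ N) (X N) (mono a)
      ≈⟨ ⊛-congˡ s (q-binomial k (N ℕ.+ N) (X N) (mono a)) ⟩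
    s ⊛ antidiagonal (binomTerm k (X N) (mono a)) (N ℕ.+ N)
      ≈⟨ ⊛-congˡ s (antidiagonal-centred (binomTerm k (X N) (mono a)) (λ n → s ⊛ (mono (C N) ⊛ positiveTerm N n)) (λ n → s ⊛ (mono (C N) ⊛ negativeTerm N n)) N pos neg) ⟩
    s ⊛ centred (λ n → s ⊛ (mono (C N) ⊛ positiveTerm N n)) (λ n → s ⊛ (mono (C N) ⊛ negativeTerm N n)) N
      ≈⟨ ⊛-congˡ s (centred-⊛ s (λ n → mono (C N) ⊛ positiveTerm N n) (λ n → mono (C N) ⊛ negativeTerm N n) N) ⟩
    s ⊛ (s ⊛ centred (λ n → mono (C N) ⊛ positiveTerm N n) (λ n → mono (C N) ⊛ negativeTerm N n) N)
      ≈⟨ unsign _ ⟩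
    centred (λ n → mono (C N) ⊛ positiveTerm N n) (λ n → mono (C N) ⊛ negativeTerm N n) N
      ≈⟨ centred-⊛ (mono (C N)) (positiveTerm N) (negativeTerm N) N ⟩
    mono (C N) ⊛ centred (positiveTerm N) (negativeTerm N) N ∎)
    where
    s : PS
    s = cst (alt N)
    unsign : ∀ f → s ⊛ (s ⊛ f) ≋ f
    unsign f = ≋-trans (≋-sym (⊛-assoc s s f)) (≋-trans (⊛-congʳ f (≋-trans (≋-sym (cst-* (alt N) (alt N))) (pointwise λ m → cong (λ c → cst c m) (alt-square N)))) (⊛-identityˡ f))
    pos : ∀ d n → d ℕ.+ n ≡ N → binomTerm k (X N) (mono a) d (d ℕ.+ n ℕ.+ n) ≋ s ⊛ (mono (C N) ⊛ positiveTerm N n)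
    pos d n refl rewrite ℕₚ.m+n∸n≡m d n = factor-out (d ℕ.+ n) n d (d ℕ.+ n ℕ.+ n) (k ℕ.* tri n ℕ.+ a ℕ.* n) (alt-+ (d ℕ.+ n) n) (exponent⁺ d n)
    neg : ∀ d n → d ℕ.+ n ≡ N → binomTerm k (X N) (mono a) (d ℕ.+ n ℕ.+ n) d ≋ s ⊛ (mono (C N) ⊛ negativeTerm N n)
    neg d n refl rewrite ℕₚ.m+n∸n≡m d n = factor-out (d ℕ.+ n) n (d ℕ.+ n ℕ.+ n) d (k ℕ.* tri n ℕ.+ b ℕ.* n) (sign⁻ d n) (exponent⁻ d n)

-- The limit of the finite triple product

module _ (k : ℕ) .{{_ : NonZero k}} where

  dilate-one : dilate k one ≋ one
  dilate-one = ≋-trans (dilate-cong k (≋-sym mono-0)) (≋-trans (dilate-mono k 0) mono-0)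

  poch-dilate : ∀ N → dilate k (pochPoly N) ≋ poch k N
  poch-dilate zero    = dilate-one
  poch-dilate (suc N) = ≋-trans (dilate-⊛ k (pochPoly N) (one ⊟ mono (suc N)))
    (⊛-cong (poch-dilate N) (≋-trans (dilate-⊟ k one (mono (suc N))) (⊟-cong dilate-one (dilate-mono k (suc N)))))

  poch-≈ : ∀ {L N} → L ℕ.≤ N → poch k N ≈[ L ] dilate k E
  poch-≈ {L} {N} L≤N = ≈-trans (≋⇒≈ (≋-sym (poch-dilate N))) (dilate-≈ k (≈-sym (≈-weaken (ℕₚ.m≤n⇒m≤1+n L≤N) (E-≈ N))))

  dilate-E-0 : dilate k E 0 ≡ 1ℤ
  dilate-E-0 = dilate-below k E (ℕ.>-nonZero⁻¹ k)

  -- In `gauss-poch` all three products are congruent to E(q^k) modulo q^L, hence E(q^k)²·[i+j; j] ≡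
  -- E(q^k), and one factor E(q^k) cancels.
  gauss-limit : ∀ {L i j} → L ℕ.≤ i → L ℕ.≤ j → dilate k E ⊛ gauss k i j ≈[ L ] one
  gauss-limit {L} {i} {j} L≤i L≤j = ⊛-cancelˡ-≈ L Eₖ (Eₖ ⊛ gauss k i j) one dilate-E-0
    (≈-trans (≋⇒≈ (rotate₂ Eₖ (gauss k i j)))
    (≈-trans (⊛-≈ (⊛-≈ (≈-refl {f = gauss k i j}) (≈-sym (poch-≈ L≤i))) (≈-sym (poch-≈ L≤j)))
    (≈-trans (≋⇒≈ (gauss-poch k i j))
    (≈-trans (poch-≈ (ℕₚ.≤-trans L≤i (ℕₚ.m≤m+n i j))) (≋⇒≈ (≋-sym (⊛-identityʳ Eₖ)))))))
    where
    Eₖ : PS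
    Eₖ = dilate k E

module _ (a b : ℕ) .{{_ : NonZero a}} .{{_ : NonZero b}} .{{_ : NonZero (a ℕ.+ b)}} where
  private
    k : ℕ
    k = a ℕ.+ b
    Eₖ : PS
    Eₖ = dilate k E

  bareTerm-≈ : ∀ {L} c .{{_ : NonZero c}} n → L ℕ.≤ n → bareTerm a b c n ≈[ L ] zeroPS
  bareTerm-≈ c n L≤n = ≈-trans (⊛-≈ (≈-refl {f = cst (alt n)})
      (mono-≈ (ℕₚ.≤-trans L≤n (ℕₚ.≤-trans (ℕₚ.m≤n*m n c) (ℕₚ.m≤n+m (c ℕ.* n) (k ℕ.* tri n))))))
    (≋⇒≈ (⊛-zeroʳ (cst (alt n))))

  private
    term-limit : ∀ L c .{{_ : NonZero c}} n g → (n ℕ.≤ L → Eₖ ⊛ g ≈[ L ] one) → Eₖ ⊛ (bareTerm a b c n ⊛ g) ≈[ L ] bareTerm a b c n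
    term-limit L c n g lim with n ℕ.≤? L
    ... | yes n≤L = ≈-trans (≋⇒≈ (*-swap Eₖ (bareTerm a b c n) g)) (≈-trans (⊛-≈ (≈-refl {f = bareTerm a b c n}) (lim n≤L)) (≋⇒≈ (⊛-identityʳ (bareTerm a b c n))))
    ... | no  n≰L = ≈-trans (≋⇒≈ (*-swap Eₖ (bareTerm a b c n) g)) (≈-trans (⊛-≈ small (≈-refl {f = Eₖ ⊛ g})) (≈-trans (≋⇒≈ (⊛-zeroˡ (Eₖ ⊛ g))) (≈-sym small)))
      where
      small : bareTerm a b c n ≈[ L ] zeroPS
      small = bareTerm-≈ c n (ℕₚ.<⇒≤ (ℕₚ.≰⇒> n≰L))

    jacTerm-bare : ∀ n → jacTerm a b n ≋ bareTerm a b a n ⊕ bareTerm a b b (suc n)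
    jacTerm-bare n = ≋-trans (signed-pair (cst (alt n)) (mono (jacExp a b (+ n))) (mono (jacExp a b -[1+ n ])))
      (⊕-congˡ (bareTerm a b a n) (⊛-congʳ (mono (jacExp a b -[1+ n ])) (≋-sym (cst-neg (alt n)))))

    -- `jac` pairs n with -1-n, the centred sum pairs n with -n; one term is left over.
    psum-jac : ∀ N → psum (jacTerm a b) N ≋ centred (bareTerm a b a) (bareTerm a b b) N ⊕ bareTerm a b b (suc N)
    psum-jac zero    = jacTerm-bare 0
    psum-jac (suc N) = ≋-trans (⊕-cong (psum-jac N) (jacTerm-bare (suc N)))
      (+-rearrange (centred (bareTerm a b a) (bareTerm a b b) N) (bareTerm a b b (suc N)) (bareTerm a b a (suc N)) (bareTerm a b b (suc (suc N))))

  -- With N = 2L every n ≤ L has N - n ≥ L, so `gauss-limit` applies to its term; the terms with n >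
  -- L vanish modulo q^L.
  triple-product : ∀ L → jac a b ≈[ L ] Eₖ ⊛ (factors k b (L ℕ.+ L) ⊛ factors k a (L ℕ.+ L))
  triple-product L = ≈-trans (sum∞-≈ (jacTerm-rising a b) (ℕₚ.m≤n⇒m≤1+n (ℕₚ.m≤m+n L L)))
    (≈-trans (≋⇒≈ (psum-jac N))
    (≈-trans (⊕-≈ (≈-refl {f = V}) (bareTerm-≈ b (suc N) (ℕₚ.m≤n⇒m≤1+n (ℕₚ.m≤m+n L L))))
    (≈-trans (≋⇒≈ (⊕-identityʳ V))
    (≈-trans (≈-sym (centred-≈ N
        (λ n _ → term-limit L a n (gauss k (N ℕ.∸ n) (N ℕ.∸ n ℕ.+ n ℕ.+ n)) λ n≤L → gauss-limit k (large n n≤L) (larger n n≤L))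
        (λ n _ → term-limit L b n (gauss k (N ℕ.∸ n ℕ.+ n ℕ.+ n) (N ℕ.∸ n)) λ n≤L → gauss-limit k (larger n n≤L) (large n n≤L))))
    (≋⇒≈ (≋-trans (centred-⊛ Eₖ (positiveTerm a b N) (negativeTerm a b N) N) (⊛-congˡ Eₖ (≋-sym (finite-triple-product a b N)))))))))
    where
    N : ℕ
    N = L ℕ.+ L
    V : PS
    V = centred (bareTerm a b a) (bareTerm a b b) N
    large : ∀ n → n ℕ.≤ L → L ℕ.≤ N ℕ.∸ n
    large n n≤L = ℕₚ.≤-trans (ℕₚ.≤-reflexive (sym (ℕₚ.m+n∸n≡m L L))) (ℕₚ.∸-monoʳ-≤ N n≤L)
    larger : ∀ n → n ℕ.≤ L → L ℕ.≤ N ℕ.∸ n ℕ.+ n ℕ.+ n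
    larger n n≤L = ℕₚ.≤-trans (large n n≤L) (ℕₚ.≤-trans (ℕₚ.m≤m+n _ n) (ℕₚ.m≤m+n _ n))

-- The factors of (q;q)_{3N} sorted by residue modulo 3. `suc N * 3` unfolds to `3 + N * 3`, which
-- exposes the three new factors by definition.
poch-3 : ∀ N → poch 3 N ⊛ (factors 3 1 N ⊛ factors 3 2 N) ≋ pochPoly (N ℕ.* 3)
poch-3 zero    = ≋-trans (⊛-identityˡ _) (⊛-identityˡ one)
poch-3 (suc N) = ≋-trans
  (merge₃ (poch 3 N) (factors 3 1 N) (factors 3 2 N) (one ⊟ mono (1 ℕ.+ N ℕ.* 3)) (one ⊟ mono (2 ℕ.+ N ℕ.* 3)) (one ⊟ mono (3 ℕ.+ N ℕ.* 3)))
  (⊛-congʳ (one ⊟ mono (3 ℕ.+ N ℕ.* 3)) (⊛-congʳ (one ⊟ mono (2 ℕ.+ N ℕ.* 3)) (⊛-congʳ (one ⊟ mono (1 ℕ.+ N ℕ.* 3)) (poch-3 N))))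

poch-5 : ∀ N → poch 5 N ⊛ (factors 5 2 N ⊛ factors 5 3 N ⊛ (factors 5 1 N ⊛ factors 5 4 N)) ≋ pochPoly (N ℕ.* 5)
poch-5 zero    = ≋-trans (⊛-identityˡ _) (≋-trans (⊛-cong (⊛-identityˡ one) (⊛-identityˡ one)) (⊛-identityˡ one))
poch-5 (suc N) = ≋-trans
  (merge₅ (poch 5 N) (factors 5 1 N) (factors 5 2 N) (factors 5 3 N) (factors 5 4 N) (f 1) (f 2) (f 3) (f 4) (f 5))
  (⊛-congʳ (f 5) (⊛-congʳ (f 4) (⊛-congʳ (f 3) (⊛-congʳ (f 2) (⊛-congʳ (f 1) (poch-5 N))))))
  where
  f : ℕ → PS
  f c = one ⊟ mono (c ℕ.+ N ℕ.* 5)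

pochPoly-limit : ∀ {L M} → L ℕ.≤ M → pochPoly M ≈[ L ] E
pochPoly-limit {L} {M} L≤M = ≈-sym (≈-weaken (ℕₚ.m≤n⇒m≤1+n L≤M) (E-≈ M))

pentagonal : jac 2 1 ≋ E
pentagonal = ≈⇒≋ λ L → let N = L ℕ.+ L in
  ≈-trans (triple-product 2 1 L)
  (≈-trans (⊛-≈ (≈-sym (poch-≈ 3 (ℕₚ.m≤m+n L L))) (≈-refl {f = factors 3 1 N ⊛ factors 3 2 N}))
  (≈-trans (≋⇒≈ (poch-3 N)) (pochPoly-limit (ℕₚ.≤-trans (ℕₚ.m≤m+n L L) (ℕₚ.m≤m*n N 3)))))

jac-product : jac 3 2 ⊛ jac 4 1 ≋ dilate 5 E ⊛ E
jac-product = ≈⇒≋ λ L → let N = L ℕ.+ L; F = factors 5 2 N ⊛ factors 5 3 N; F′ = factors 5 1 N ⊛ factors 5 4 N in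
  ≈-trans (⊛-≈ (triple-product 3 2 L) (triple-product 4 1 L))
  (≈-trans (≋⇒≈ (pair-products (dilate 5 E) F F′))
  (⊛-≈ (≈-refl {f = dilate 5 E})
    (≈-trans (⊛-≈ (≈-sym (poch-≈ 5 (ℕₚ.m≤m+n L L))) (≈-refl {f = F ⊛ F′}))
    (≈-trans (≋⇒≈ (poch-5 N)) (pochPoly-limit (ℕₚ.≤-trans (ℕₚ.m≤m+n L L) (ℕₚ.m≤m*n N 5)))))))

-- The theta expansions of E·G², E·H² and E·G·H

-- The hypotheses on x·v and u·v give v·(E·x) = v·u². The series v and E have constant term 1 and
-- cancel, and u = E·y turns u² = E·x into x = E·y².
E-quotient : ∀ u v x y → v 0 ≡ 1ℤ → x ⊛ v ≋ dilate 5 jacE ⊛ u → u ⊛ v ≋ dilate 5 E ⊛ E → u ≋ E ⊛ y → x ≋ E ⊛ y ⊛ y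
E-quotient u v x y v₀ quotient product u≋Ey = ⊛-cancelˡ E x (E ⊛ y ⊛ y) refl (≋-trans
  (⊛-cancelˡ v (E ⊛ x) (u ⊛ u) v₀ (begin
    v ⊛ (E ⊛ x)                    ≈⟨ rotate₃ v E x ⟩
    E ⊛ (x ⊛ v)                    ≈⟨ ⊛-congˡ E (≋-trans quotient (⊛-congʳ u (dilate-cong 5 pentagonal))) ⟩
    E ⊛ (dilate 5 E ⊛ u)           ≈⟨ *-swap E (dilate 5 E) u ⟩
    dilate 5 E ⊛ (E ⊛ u)           ≈⟨ ⊛-assoc (dilate 5 E) E u ⟨
    dilate 5 E ⊛ E ⊛ u             ≈⟨ ⊛-congʳ u product ⟨
    u ⊛ v ⊛ u                      ≈⟨ *-rotate u v u ⟩
    u ⊛ (u ⊛ v)                    ≈⟨ rotate₃ v u u ⟨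
    v ⊛ (u ⊛ u)                    ∎))
  (≋-trans (⊛-cong u≋Ey u≋Ey) (square-factor E y y)))

quintG≋EGG : quintG ≋ E ⊛ G ⊛ G
quintG≋EGG = E-quotient jacEG jacEH quintG G refl quintG-quotient jac-product (≋-sym rogers-ramanujan-G)

quintH≋EHH : quintH ≋ E ⊛ H ⊛ H
quintH≋EHH = E-quotient jacEH jacEG quintH H refl quintH-quotient (≋-trans (⊛-comm jacEH jacEG) jac-product) (≋-sym rogers-ramanujan-H)

E₅≋EGH : dilate 5 E ≋ E ⊛ G ⊛ H
E₅≋EGH = ⊛-cancelˡ E (dilate 5 E) (E ⊛ G ⊛ H) refl (begin
  E ⊛ dilate 5 E       ≈⟨ ⊛-comm E (dilate 5 E) ⟩
  dilate 5 E ⊛ E       ≈⟨ jac-product ⟨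
  jacEG ⊛ jacEH              ≈⟨ ⊛-cong rogers-ramanujan-G rogers-ramanujan-H ⟨
  E ⊛ G ⊛ (E ⊛ H)      ≈⟨ square-factor E G H ⟩
  E ⊛ (E ⊛ G ⊛ H)      ∎)

dilate-product₃ : ∀ k .{{_ : NonZero k}} {x} f g h → x ≋ f ⊛ g ⊛ h → dilate k x ≋ dilate k f ⊛ dilate k g ⊛ dilate k h
dilate-product₃ k f g h p = ≋-trans (dilate-cong k p) (≋-trans (dilate-⊛ k (f ⊛ g) h) (⊛-congʳ (dilate k h) (dilate-⊛ k f g)))

dilate-E₅ : ∀ k .{{_ : NonZero k}} .{{_ : NonZero (5 ℕ.* k)}} → dilate (5 ℕ.* k) jacE ≋ dilate k E ⊛ dilate k G ⊛ dilate k H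
dilate-E₅ k = ≋-trans (dilate-cong (5 ℕ.* k) pentagonal) (≋-trans (≋-sym (dilate-dilate k 5 E)) (dilate-product₃ k E G H E₅≋EGH))

dilate-Uplus : dilate 3 (Uplus 1 39) ≋ dilate 3 G ⊛ dilate 117 G ⊕ mono 24 ⊛ (dilate 3 H ⊛ dilate 117 H)
dilate-Uplus = ≋-trans (dilate-⊕ 3 (dilate 1 G ⊛ dilate 39 G) (mono 8 ⊛ (dilate 1 H ⊛ dilate 39 H)))
  (⊕-cong (pair G) (≋-trans (dilate-⊛ 3 (mono 8) (dilate 1 H ⊛ dilate 39 H)) (⊛-cong (dilate-mono 3 8) (pair H))))
  where
  pair : ∀ f → dilate 3 (dilate 1 f ⊛ dilate 39 f) ≋ dilate 3 f ⊛ dilate 117 f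
  pair f = ≋-trans (dilate-⊛ 3 (dilate 1 f) (dilate 39 f)) (⊛-cong (dilate-dilate 3 1 f) (dilate-dilate 3 39 f))

dilate-Uminus : dilate 3 (Uminus 3 13) ≋ dilate 9 H ⊛ dilate 39 G ⊟ mono 6 ⊛ (dilate 9 G ⊛ dilate 39 H)
dilate-Uminus = ≋-trans (dilate-⊟ 3 (dilate 3 H ⊛ dilate 13 G) (mono 2 ⊛ (dilate 3 G ⊛ dilate 13 H)))
  (⊟-cong (pair H G) (≋-trans (dilate-⊛ 3 (mono 2) (dilate 3 G ⊛ dilate 13 H)) (⊛-cong (dilate-mono 3 2) (pair G H))))
  where
  pair : ∀ f g → dilate 3 (dilate 3 f ⊛ dilate 13 g) ≋ dilate 9 f ⊛ dilate 39 g
  pair f g = ≋-trans (dilate-⊛ 3 (dilate 3 f) (dilate 13 g)) (⊛-cong (dilate-dilate 3 3 f) (dilate-dilate 3 13 g))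

-- Assembling the identities

Θ₁ Θ₂ Θ₃ Θ₄ : PS
Θ₁ = theta (+ 2) (+ 1) (+ 44) ⊟ theta (+ 8) (+ 1) (+ 11)
Θ₂ = theta (+ 5) (+ 3) (+ 18) ⊟ theta (+ 8) (+ 1) (+ 11)
Θ₃ = theta (+ 4) (+ 1) (+ 22) ⊟ theta (+ 10) (+ 7) (+ 10)
Θ₄ = theta (+ 1) (+ 1) (+ 88) ⊟ theta (+ 9) (+ 3) (+ 10)

identity₁ : Θ₁ ≋ cst (+ 2) ⊛ mono 2 ⊛ dilate 9 E ⊛ dilate 39 E
identity₁ = ≋-trans theta₁ (≋-trans
  (⊛-congˡ (cst (+ 2)) (⊛-cong (⊛-congˡ (mono 2) (dilate-cong 9 pentagonal)) (dilate-cong 39 pentagonal)))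
  (*-assoc₄ (cst (+ 2)) (mono 2) (dilate 9 E) (dilate 39 E)))

identity₂ : Θ₂ ≋ cst (+ 2) ⊛ mono 5 ⊛ dilate 3 E ⊛ dilate 117 E
identity₂ = ≋-trans theta₂ (≋-trans
  (⊛-congˡ (cst (+ 2)) (⊛-cong (⊛-congˡ (mono 5) (dilate-cong 3 pentagonal)) (dilate-cong 117 pentagonal)))
  (*-assoc₄ (cst (+ 2)) (mono 5) (dilate 3 E) (dilate 117 E)))

identity₃ : Θ₃ ≋ cst (+ 2) ⊛ mono 4 ⊛ dilate 9 E ⊛ dilate 39 E ⊛ (dilate 3 (Uminus 3 13) ⊛ dilate 3 (Uminus 3 13))
identity₃ = ≋-trans theta₃ (≋-trans
  (⊛-congˡ (cst (+ 2)) (⊕-cong (⊟-cong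
    (⊛-cong (⊛-congˡ (mono 4) (dilate-product₃ 9 E H H quintH≋EHH)) (dilate-product₃ 39 E G G quintG≋EGG))
    (⊛-congˡ (cst (+ 2)) (⊛-cong (⊛-cong (mono-+ 4 6) (dilate-E₅ 9)) (dilate-E₅ 39))))
    (⊛-cong (⊛-cong (≋-trans (mono-+ 4 12) (⊛-congˡ (mono 4) (mono-+ 6 6))) (dilate-product₃ 9 E G G quintG≋EGG)) (dilate-product₃ 39 E H H quintH≋EHH))))
  (≋-trans (U₂-square (cst (+ 2)) (mono 4) (mono 6) (dilate 9 E) (dilate 39 E) (dilate 9 G) (dilate 39 G) (dilate 9 H) (dilate 39 H))
    (⊛-congˡ (cst (+ 2) ⊛ mono 4 ⊛ dilate 9 E ⊛ dilate 39 E) (⊛-cong (≋-sym dilate-Uminus) (≋-sym dilate-Uminus)))))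

identity₄ : Θ₄ ≋ cst (+ 2) ⊛ mono 1 ⊛ dilate 3 E ⊛ dilate 117 E ⊛ (dilate 3 (Uplus 1 39) ⊛ dilate 3 (Uplus 1 39))
identity₄ = ≋-trans theta₄ (≋-trans
  (⊛-congˡ (cst (+ 2)) (⊕-cong (⊕-cong
    (⊛-cong (⊛-congˡ (mono 1) (dilate-product₃ 3 E G G quintG≋EGG)) (dilate-product₃ 117 E G G quintG≋EGG))
    (⊛-congˡ (cst (+ 2)) (⊛-cong (⊛-cong (mono-+ 1 24) (dilate-E₅ 3)) (dilate-E₅ 117))))
    (⊛-cong (⊛-cong (≋-trans (mono-+ 1 48) (⊛-congˡ (mono 1) (mono-+ 24 24))) (dilate-product₃ 3 E H H quintH≋EHH)) (dilate-product₃ 117 E H H quintH≋EHH))))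
  (≋-trans (U₁-square (cst (+ 2)) (mono 1) (mono 24) (dilate 3 E) (dilate 117 E) (dilate 3 G) (dilate 117 G) (dilate 3 H) (dilate 117 H))
    (⊛-congˡ (cst (+ 2) ⊛ mono 1 ⊛ dilate 3 E ⊛ dilate 117 E) (⊛-cong (≋-sym dilate-Uplus) (≋-sym dilate-Uplus)))))

-- The constant term 2 is no unit, so `⊛-cancelˡ` does not apply; multiplication by 2 is injective
-- on each coefficient.
double-cancel : ∀ f g → cst (+ 2) ⊛ f ≋ cst (+ 2) ⊛ g → f ≋ g
double-cancel f g p .at n = ℤₚ.*-cancelˡ-≡ (+ 2) (f n) (g n) (trans (sym (cst-⊛-at (+ 2) f n)) (trans (p .at n) (cst-⊛-at (+ 2) g n)))

dilate-EG : ∀ k .{{_ : NonZero k}} → dilate k jacEG ≋ dilate k E ⊛ dilate k G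
dilate-EG k = ≋-trans (dilate-cong k (≋-sym rogers-ramanujan-G)) (dilate-⊛ k E G)

dilate-EH : ∀ k .{{_ : NonZero k}} → dilate k jacEH ≋ dilate k E ⊛ dilate k H
dilate-EH k = ≋-trans (dilate-cong k (≋-sym rogers-ramanujan-H)) (dilate-⊛ k E H)

-- One of Ramanujan's forty identities.
U-ratio : E ⊛ dilate 39 E ⊛ Uplus 1 39 ≋ dilate 3 E ⊛ dilate 13 E ⊛ Uminus 3 13
-- The common theta difference (1,1,10) - (3,3,4) yields both sides multiplied by q.
U-ratio = mono-cancel 1 _ _ (begin
  mono 1 ⊛ (E ⊛ dilate 39 E ⊛ Uplus 1 39)
    ≈⟨ ⊛-congˡ (mono 1) (⊛-congˡ (E ⊛ dilate 39 E) (⊕-cong (⊛-congʳ (dilate 39 G) (dilate-1 G)) (⊛-congˡ (mono 8) (⊛-congʳ (dilate 39 H) (dilate-1 H))))) ⟩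
  mono 1 ⊛ (E ⊛ dilate 39 E ⊛ (G ⊛ dilate 39 G ⊕ mono 8 ⊛ (H ⊛ dilate 39 H)))
    ≈⟨ U₁-linear (mono 1) (mono 8) E (dilate 39 E) G (dilate 39 G) H (dilate 39 H) ⟨
  mono 1 ⊛ (E ⊛ G) ⊛ (dilate 39 E ⊛ dilate 39 G) ⊕ mono 1 ⊛ mono 8 ⊛ (E ⊛ H) ⊛ (dilate 39 E ⊛ dilate 39 H)
    ≈⟨ ⊕-cong (⊛-cong (⊛-congˡ (mono 1) (≋-sym rogers-ramanujan-G)) (dilate-EG 39))
              (⊛-cong (⊛-cong (mono-+ 1 8) (≋-sym rogers-ramanujan-H)) (dilate-EH 39)) ⟨
  mono 1 ⊛ jacEG ⊛ dilate 39 jacEG ⊕ mono 9 ⊛ jacEH ⊛ dilate 39 jacEH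
    ≈⟨ double-cancel _ _ theta-39 ⟩
  mono 1 ⊛ dilate 3 jacEH ⊛ dilate 13 jacEG ⊟ mono 3 ⊛ dilate 3 jacEG ⊛ dilate 13 jacEH
    ≈⟨ ⊟-cong (⊛-cong (⊛-congˡ (mono 1) (dilate-EH 3)) (dilate-EG 13))
              (⊛-cong (⊛-cong (mono-+ 1 2) (dilate-EG 3)) (dilate-EH 13)) ⟩
  mono 1 ⊛ (dilate 3 E ⊛ dilate 3 H) ⊛ (dilate 13 E ⊛ dilate 13 G) ⊟ mono 1 ⊛ mono 2 ⊛ (dilate 3 E ⊛ dilate 3 G) ⊛ (dilate 13 E ⊛ dilate 13 H)
    ≈⟨ U₂-linear (mono 1) (mono 2) (dilate 3 E) (dilate 13 E) (dilate 3 G) (dilate 13 G) (dilate 3 H) (dilate 13 H) ⟩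
  mono 1 ⊛ (dilate 3 E ⊛ dilate 13 E ⊛ Uminus 3 13) ∎)

dilated-U-ratio : dilate 3 E ⊛ dilate 117 E ⊛ dilate 3 (Uplus 1 39) ≋ dilate 9 E ⊛ dilate 39 E ⊛ dilate 3 (Uminus 3 13)
dilated-U-ratio = begin
  dilate 3 E ⊛ dilate 117 E ⊛ dilate 3 (Uplus 1 39)
    ≈⟨ ⊛-congʳ (dilate 3 (Uplus 1 39)) (⊛-congˡ (dilate 3 E) (dilate-dilate 3 39 E)) ⟨
  dilate 3 E ⊛ dilate 3 (dilate 39 E) ⊛ dilate 3 (Uplus 1 39)
    ≈⟨ dilate-product₃ 3 E (dilate 39 E) (Uplus 1 39) ≋-refl ⟨
  dilate 3 (E ⊛ dilate 39 E ⊛ Uplus 1 39)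
    ≈⟨ dilate-product₃ 3 (dilate 3 E) (dilate 13 E) (Uminus 3 13) U-ratio ⟩
  dilate 3 (dilate 3 E) ⊛ dilate 3 (dilate 13 E) ⊛ dilate 3 (Uminus 3 13)
    ≈⟨ ⊛-congʳ (dilate 3 (Uminus 3 13)) (⊛-cong (dilate-dilate 3 3 E) (dilate-dilate 3 13 E)) ⟩
  dilate 9 E ⊛ dilate 39 E ⊛ dilate 3 (Uminus 3 13) ∎

-- The equality of the two quotients of theta differences, cross-multiplied. It is the square of
-- `dilated-U-ratio` up to the factor 4q⁶.
identity₅ : Θ₃ ⊛ Θ₁ ≋ Θ₂ ⊛ Θ₄
identity₅ = begin
  Θ₃ ⊛ Θ₁
    ≈⟨ ⊛-cong identity₃ identity₁ ⟩
  cst (+ 2) ⊛ mono 4 ⊛ e ⊛ e′ ⊛ (u ⊛ u) ⊛ (cst (+ 2) ⊛ mono 2 ⊛ e ⊛ e′)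
    ≈⟨ gather-left (cst (+ 2)) (mono 4) (mono 2) e e′ u ⟩
  cst (+ 2) ⊛ cst (+ 2) ⊛ (mono 4 ⊛ mono 2) ⊛ (e ⊛ e′ ⊛ u ⊛ (e ⊛ e′ ⊛ u))
    ≈⟨ ⊛-cong (⊛-congˡ (cst (+ 2) ⊛ cst (+ 2)) (≋-trans (≋-sym (mono-+ 4 2)) (mono-+ 5 1))) (⊛-cong (≋-sym dilated-U-ratio) (≋-sym dilated-U-ratio)) ⟩
  cst (+ 2) ⊛ cst (+ 2) ⊛ (mono 5 ⊛ mono 1) ⊛ (f ⊛ f′ ⊛ v ⊛ (f ⊛ f′ ⊛ v))
    ≈⟨ gather-right (cst (+ 2)) (mono 5) (mono 1) f f′ v ⟨
  cst (+ 2) ⊛ mono 5 ⊛ f ⊛ f′ ⊛ (cst (+ 2) ⊛ mono 1 ⊛ f ⊛ f′ ⊛ (v ⊛ v))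
    ≈⟨ ⊛-cong identity₂ identity₄ ⟨
  Θ₂ ⊛ Θ₄ ∎
  where
  e e′ f f′ u v : PS
  e  = dilate 9 E
  e′ = dilate 39 E
  f  = dilate 3 E
  f′ = dilate 117 E
  u  = dilate 3 (Uminus 3 13)
  v  = dilate 3 (Uplus 1 39)

-- The quotient Θ₂/Θ₁, again cross-multiplied; the factor q³ is q⁵/q² from the two product formulas.
identity₆ : Θ₂ ⊛ (dilate 9 E ⊛ dilate 39 E) ≋ mono 3 ⊛ (dilate 3 E ⊛ dilate 117 E) ⊛ Θ₁
identity₆ = begin
  Θ₂ ⊛ (dilate 9 E ⊛ dilate 39 E)
    ≈⟨ ⊛-congʳ (dilate 9 E ⊛ dilate 39 E) identity₂ ⟩
  cst (+ 2) ⊛ mono 5 ⊛ dilate 3 E ⊛ dilate 117 E ⊛ (dilate 9 E ⊛ dilate 39 E)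
    ≈⟨ ⊛-congʳ (dilate 9 E ⊛ dilate 39 E) (⊛-congʳ (dilate 117 E) (⊛-congʳ (dilate 3 E) (⊛-congˡ (cst (+ 2)) (mono-+ 3 2)))) ⟩
  cst (+ 2) ⊛ (mono 3 ⊛ mono 2) ⊛ dilate 3 E ⊛ dilate 117 E ⊛ (dilate 9 E ⊛ dilate 39 E)
    ≈⟨ cross-ratio (cst (+ 2)) (mono 3) (mono 2) (dilate 3 E) (dilate 117 E) (dilate 9 E) (dilate 39 E) ⟩
  mono 3 ⊛ (dilate 3 E ⊛ dilate 117 E) ⊛ (cst (+ 2) ⊛ mono 2 ⊛ dilate 9 E ⊛ dilate 39 E)
    ≈⟨ ⊛-congˡ (mono 3 ⊛ (dilate 3 E ⊛ dilate 117 E)) identity₁ ⟨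
  mono 3 ⊛ (dilate 3 E ⊛ dilate 117 E) ⊛ Θ₁ ∎

theorem4p2 : (theta (+ 2) (+ 1) (+ 44) ⊟ theta (+ 8) (+ 1) (+ 11)
    ≗ cst (+ 2) ⊛ mono 2 ⊛ dilate 9 E ⊛ dilate 39 E)
    × (theta (+ 5) (+ 3) (+ 18) ⊟ theta (+ 8) (+ 1) (+ 11)
    ≗ cst (+ 2) ⊛ mono 5 ⊛ dilate 3 E ⊛ dilate 117 E)
    × (theta (+ 4) (+ 1) (+ 22) ⊟ theta (+ 10) (+ 7) (+ 10)
    ≗ cst (+ 2) ⊛ mono 4 ⊛ dilate 9 E ⊛ dilate 39 E
    ⊛ (dilate 3 (Uminus 3 13) ⊛ dilate 3 (Uminus 3 13)))
    × (theta (+ 1) (+ 1) (+ 88) ⊟ theta (+ 9) (+ 3) (+ 10)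
    ≗ cst (+ 2) ⊛ mono 1 ⊛ dilate 3 E ⊛ dilate 117 E
    ⊛ (dilate 3 (Uplus 1 39) ⊛ dilate 3 (Uplus 1 39)))
    × ((theta (+ 4) (+ 1) (+ 22) ⊟ theta (+ 10) (+ 7) (+ 10))
    ⊛ (theta (+ 2) (+ 1) (+ 44) ⊟ theta (+ 8) (+ 1) (+ 11))
    ≗ (theta (+ 5) (+ 3) (+ 18) ⊟ theta (+ 8) (+ 1) (+ 11))
    ⊛ (theta (+ 1) (+ 1) (+ 88) ⊟ theta (+ 9) (+ 3) (+ 10)))
    × ((theta (+ 5) (+ 3) (+ 18) ⊟ theta (+ 8) (+ 1) (+ 11))
    ⊛ (dilate 9 E ⊛ dilate 39 E)
    ≗ mono 3 ⊛ (dilate 3 E ⊛ dilate 117 E)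
    ⊛ (theta (+ 2) (+ 1) (+ 44) ⊟ theta (+ 8) (+ 1) (+ 11)))
theorem4p2 = identity₁ .at , identity₂ .at , identity₃ .at , identity₄ .at , identity₅ .at , identity₆ .at
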